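{- Let $p$ be a prime, $f\ge 1$ an integer, $q=p^f$, and let $k\ge 1$, $d\ge 1$, $e\ge 0$ be integers. Let $C$ be a $[g_q(k,d),k,d]_q$ Griesmer code. If $q^e\mid d$, then $p^e\mid \mathrm{wt}(c)$ for every codeword $c\in C$.
   Context: An $[n,k,d]_q$ code is a $k$-dimensional $\mathbb{F}_q$-linear subspace of $\mathbb{F}_q^n$ whose minimum Hamming weight of a nonzero codeword is $d$; $\mathrm{wt}(c)$ is the number of nonzero coordinates of $c$. For positive integers $k,d$, $g_q(k,d):=\sum_{i=0}^{k-1}\lceil d/q^i\rceil$. Every $[n,k,d]_q$ code satisfies $n\ge g_q(k,d)$ (Griesmer bound); an $[n,k,d]_q$ code with $n=g_q(k,d)$ is called a Griesmer code. Codes are assumed to have full length (no coordinate at which all codewords vanish). -}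

module Defs where

open import Level using (Level; _⊔_) renaming (suc to lsuc)
open import Algebra.Bundles using (CommutativeRing)
open import Data.Nat using (ℕ; zero; suc; _^_; _/_)
import Data.Nat as ℕ
open import Data.Fin using (Fin)
import Data.Fin as Fin
open import Data.Product using (∃; _,_; proj₁; _×_)
open import Data.Vec.Functional using (Vector)
open import Relation.Nullary using (¬_; Dec; yes; no)
open import Relation.Binary using (Decidable)
open import Relation.Binary.PropositionalEquality as ≡ using (_≡_)
open import Function.Bundles using (Inverse)

-- Ceiling division ⌈ m / n ⌉ (only used with n ≥ 1; value 0 for n = 0).
⌈_/_⌉ : ℕ → ℕ → ℕ
⌈ m / zero ⌉ = 0
⌈ m / suc n ⌉ = (m ℕ.+ n) / suc n

griesmer : ℕ → ℕ → ℕ → ℕ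
griesmer q zero    d = 0
griesmer q (suc k) d = griesmer q k d ℕ.+ ⌈ d / q ^ k ⌉

record Field (c ℓ : Level) : Set (lsuc (c ⊔ ℓ)) where
  field
    commutativeRing : CommutativeRing c ℓ
  open CommutativeRing commutativeRing public
  field
    0≉1     : ¬ (0# ≈ 1#)
    inverse : ∀ x → ¬ (x ≈ 0#) → ∃ λ y → x * y ≈ 1#

record FiniteField (c ℓ : Level) (q : ℕ) : Set (lsuc (c ⊔ ℓ)) where
  field
    field′   : Field c ℓ
  open Field field′ public
  field
    card : Inverse setoid (≡.setoid (Fin q))

  _≟_ : Decidable _≈_
  x ≟ y with Inverse.to card x Fin.≟ Inverse.to card y
  ... | yes eq = yes (trans (sym (Inverse.strictlyInverseʳ card x))
                       (trans (Inverse.from-cong card eq) (Inverse.strictlyInverseʳ card y)))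
  ... | no ne  = no λ x≈y → ne (Inverse.to-cong card x≈y)

module Coding {c ℓ : Level} {q : ℕ} (F : FiniteField c ℓ q) where
  open FiniteField F

  wt : ∀ {n} → Vector Carrier n → ℕ
  wt {zero}  v = 0
  wt {suc n} v with v Fin.zero ≟ 0#
  ... | yes _ = wt {n} (λ i → v (Fin.suc i))
  ... | no  _ = suc (wt {n} (λ i → v (Fin.suc i)))

  lincomb : ∀ {k n} → (Fin k → Vector Carrier n) → Vector Carrier k → Vector Carrier n
  lincomb {zero}  G x j = 0#
  lincomb {suc k} G x j = x Fin.zero * G Fin.zero j
                          + lincomb {k} (λ i → G (Fin.suc i)) (λ i → x (Fin.suc i)) j

  IsZero : ∀ {n} → Vector Carrier n → Set ℓ
  IsZero v = ∀ j → v j ≈ 0#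

  -- A linear [n,k,d]_q code, given by a generator matrix G (k × n) whose
  -- rows are linearly independent, so that the code
  --   C = { lincomb G x | x ∈ F^k }
  -- is a k-dimensional subspace of F^n; it has full length and minimum
  -- distance exactly d.
  record LinearCode (n k d : ℕ) : Set (c ⊔ ℓ) where
    field
      G           : Fin k → Vector Carrier n
      independent : ∀ (x : Vector Carrier k) → IsZero (lincomb G x) → ∀ i → x i ≈ 0#
      fullLength  : ∀ (j : Fin n) → ∃ λ (x : Vector Carrier k) → ¬ (lincomb G x j ≈ 0#)
      minWt       : ∀ (x : Vector Carrier k) → ¬ IsZero (lincomb G x) → d ℕ.≤ wt (lincomb G x)
      attained    : ∃ λ (x : Vector Carrier k) → (¬ IsZero (lincomb G x)) × (wt (lincomb G x) ≡ d)

    codeword : Vector Carrier k → Vector Carrier n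
    codeword = lincomb G

{-# OPTIONS --safe #-}

-- Write the code as a list g of columns in F ^ k and, for e ≥ 1, put M = (q - 1) p ^ (e - 1). In a ring of Witt vector
-- type over F, y ^ M modulo p ^ e depends only on y modulo p, and is 0 or 1 according as y vanishes modulo p. Hence
-- the weights modulo p ^ e are values of the form Ψ (X) = Σ (X · v) ^ M, summed over the columns v, and it suffices that
-- Ψ vanishes identically modulo p ^ e. If P is a point of maximal multiplicity ⌈ d / q ^ (k - 1) ⌉, then the codewords
-- vanishing at P form a Griesmer code of dimension k - 1 with the same d, so by induction Ψ vanishes on the hyperplane
-- X · P = 0. If k > e there are at least q ^ e > M maximal points, and a form of degree M that vanishes on more than M
-- hyperplanes is zero. In the base case k = e + 1 every point is maximal and Ψ is a multiple of the same form for the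
-- set of all points, to which the hyperplane argument applies again, combined with a Frobenius twist that raises
-- the exponent of p. If k ≤ e, the code has constant weight d.
module Submission where

open import Defs
open import Level using (Level; _⊔_) renaming (suc to lsuc)
open import Data.Nat as ℕ using (ℕ; zero; suc; z≤n; s≤s; _≤_; _<_; _∸_; NonZero)
open import Data.Nat.Primality using (Prime; prime⇒nonZero; prime⇒nonTrivial; euclidsLemma)
open import Data.Nat.Divisibility
  using (_∣_; divides; n/m≡quotient; m%n≡0⇒n∣m; ∣⇒≤; ∣1⇒≡1; ∣m⇒∣m*n; 1∣_; _∣0; ∣-refl; ∣-trans; *-monoʳ-∣; *-pres-∣; m∣m*n)
open import Data.Vec.Functional as Vector using (Vector; removeAt; insertAt)
open import Relation.Binary.PropositionalEquality as ≡ using (_≡_; _≢_)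

open import Algebra.Bundles using (CommutativeMonoid; CommutativeRing)
open import Algebra.Solver.Ring.AlmostCommutativeRing
  using (fromCommutativeRing; _-Raw-AlmostCommutative⟶_; Induced-equivalence)
open import Data.Fin as Fin using (Fin; zero; suc; toℕ; punchIn; punchOut; finToFun; funToFin)
open import Data.Fin.Permutation using (permutation)
import Data.Fin.Properties as Fin
open import Data.Integer as ℤ using (ℤ; +_; -[1+_]; _⊖_; _◃_)
import Data.Integer.Properties as ℤ
open import Data.List as List using (List; []; _∷_; concatMap)
open import Data.Maybe using (just; nothing)
open import Data.Nat.Base using (_!)
open import Data.Nat.Combinatorics as ℕ using (nCk≡n!/k![n-k]!; k![n∸k]!∣n!; nCn≡1)
open import Data.Nat.Coprimality using (prime⇒coprime; coprime-Bézout)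
open import Data.Nat.DivMod using (_/_; _%_; m≡m%n+[m/n]*n; m%n<n; m<n*o⇒m/o<n)
open import Data.Nat.GCD using (module Bézout)
import Data.Nat.Properties as ℕ
open import Data.Nat.Properties using (_!*_!≢0)
open import Data.Product using (_×_; _,_; ∃; ∃₂; proj₁; proj₂)
import Data.Sign as Sign
open import Data.Sum using (_⊎_; inj₁; inj₂)
open import Data.Vec as Vec using (Vec; []; _∷_)
open import Data.Vec.Functional.Properties using (insertAt-lookup; insertAt-punchIn)
open import Function using (_∘_; Inverse)
open import Relation.Binary.Definitions using (WeaklyDecidable)
open import Relation.Nullary using (¬_; Dec; yes; no; contradiction)
open import Relation.Nullary.Decidable using (¬?; _×-dec_)
open import Relation.Unary using (Pred; Decidable)
import Algebra.Properties.CommutativeMonoid.Mult as CommutativeMonoidMult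
import Algebra.Properties.CommutativeMonoid.Sum as Sum
import Algebra.Properties.CommutativeSemigroup as CommutativeSemigroup
import Algebra.Properties.CommutativeSemiring.Binomial as Binomial
import Algebra.Properties.CommutativeSemiring.Exp as CommutativeExp
import Algebra.Properties.Monoid.Mult as MonoidMult
import Algebra.Properties.Monoid.Sum as MonoidSum
import Algebra.Properties.Semiring.Exp as Exp
import Algebra.Properties.Semiring.Mult as Mult
import Relation.Binary.Reasoning.Setoid as SetoidReasoning

module RingSolver {c ℓ} (R : CommutativeRing c ℓ) where
  open CommutativeRing R
  open import Algebra.Properties.Ring ring
  open import Algebra.Properties.CommutativeSemigroup +-commutativeSemigroup using (interchange)
  open import Algebra.Properties.Semiring.Mult semiring
    using (×-homo-+; ×1-homo-*) renaming (_×_ to _·_)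
  open import Algebra.Properties.Semiring.Mult.TCOptimised semiring
    using (×ᵤ≈×) renaming (_×_ to _·′_)
  open SetoidReasoning setoid

  module IntegerEmbedding where
    ⟦_⟧ : ℤ → Carrier
    ⟦ + n ⟧ = n ·′ 1#
    ⟦ -[1+ n ] ⟧ = - (suc n · 1#)

    ⟦+⟧ : ∀ n → ⟦ + n ⟧ ≈ n · 1#
    ⟦+⟧ n = sym (×ᵤ≈× n 1#)

    ⟦⊖⟧ : ∀ m n → ⟦ m ⊖ n ⟧ ≈ m · 1# - n · 1#
    ⟦⊖⟧ m zero = trans (⟦+⟧ m) (sym (trans (+-congˡ -0#≈0#) (+-identityʳ _)))
    ⟦⊖⟧ zero (suc n) = sym (+-identityˡ _)
    ⟦⊖⟧ (suc m) (suc n) = begin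
      ⟦ suc m ⊖ suc n ⟧                ≡⟨ ≡.cong ⟦_⟧ (ℤ.[1+m]⊖[1+n]≡m⊖n m n) ⟩
      ⟦ m ⊖ n ⟧                        ≈⟨ ⟦⊖⟧ m n ⟩
      m · 1# - n · 1#                  ≈⟨ +-identityˡ _ ⟨
      0# + (m · 1# - n · 1#)           ≈⟨ +-congʳ (-‿inverseʳ 1#) ⟨
      (1# - 1#) + (m · 1# - n · 1#)    ≈⟨ interchange _ _ _ _ ⟩
      suc m · 1# + (- 1# - n · 1#)     ≈⟨ +-congˡ (-‿+-comm _ _) ⟩
      suc m · 1# - suc n · 1#          ∎

    ⟦neg⟧ : ∀ n → ⟦ Sign.- ◃ n ⟧ ≈ - (n · 1#)
    ⟦neg⟧ zero = sym -0#≈0#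
    ⟦neg⟧ (suc n) = refl

    ⟦pos⟧ : ∀ n → ⟦ Sign.+ ◃ n ⟧ ≈ n · 1#
    ⟦pos⟧ zero = refl
    ⟦pos⟧ (suc n) = ⟦+⟧ (suc n)

    +-homo : ∀ x y → ⟦ x ℤ.+ y ⟧ ≈ ⟦ x ⟧ + ⟦ y ⟧
    +-homo (+ m) (+ n) = trans (⟦+⟧ (m ℕ.+ n)) (trans (×-homo-+ 1# m n) (sym (+-cong (⟦+⟧ m) (⟦+⟧ n))))
    +-homo (+ m) -[1+ n ] = trans (⟦⊖⟧ m (suc n)) (+-congʳ (sym (⟦+⟧ m)))
    +-homo -[1+ m ] (+ n) = trans (⟦⊖⟧ n (suc m)) (trans (+-congʳ (sym (⟦+⟧ n))) (+-comm _ _))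
    +-homo -[1+ m ] -[1+ n ] = begin
      - (suc (suc (m ℕ.+ n)) · 1#)        ≡⟨ ≡.cong (λ k → - (suc k · 1#)) (≡.sym (ℕ.+-suc m n)) ⟩
      - ((suc m ℕ.+ suc n) · 1#)          ≈⟨ -‿cong (×-homo-+ 1# (suc m) (suc n)) ⟩
      - (suc m · 1# + suc n · 1#)         ≈⟨ -‿+-comm _ _ ⟨
      - (suc m · 1#) - suc n · 1#         ∎

    *-homo : ∀ x y → ⟦ x ℤ.* y ⟧ ≈ ⟦ x ⟧ * ⟦ y ⟧
    *-homo (+ m) (+ n) = trans (⟦pos⟧ (m ℕ.* n)) (trans (×1-homo-* m n) (sym (*-cong (⟦+⟧ m) (⟦+⟧ n))))
    *-homo (+ m) -[1+ n ] = trans (⟦neg⟧ (m ℕ.* suc n))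
      (trans (-‿cong (trans (×1-homo-* m (suc n)) (*-congʳ (sym (⟦+⟧ m))))) (-‿distribʳ-* _ _))
    *-homo -[1+ m ] (+ n) = trans (⟦neg⟧ (suc m ℕ.* n))
      (trans (-‿cong (trans (×1-homo-* (suc m) n) (*-congˡ (sym (⟦+⟧ n))))) (-‿distribˡ-* _ _))
    *-homo -[1+ m ] -[1+ n ] = trans (⟦pos⟧ (suc m ℕ.* suc n)) (trans (×1-homo-* (suc m) (suc n))
      (trans (sym (-‿involutive _)) (trans (-‿cong (-‿distribˡ-* _ _)) (-‿distribʳ-* _ _))))

    -‿homo : ∀ x → ⟦ ℤ.- x ⟧ ≈ - ⟦ x ⟧
    -‿homo (+ zero) = sym -0#≈0#
    -‿homo (+ suc n) = -‿cong (sym (⟦+⟧ (suc n)))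
    -‿homo -[1+ n ] = trans (⟦+⟧ (suc n)) (sym (-‿involutive _))

  private
    open IntegerEmbedding

    morphism : ℤ.+-*-rawRing -Raw-AlmostCommutative⟶ fromCommutativeRing R
    morphism = record
      { ⟦_⟧ = ⟦_⟧
      ; +-homo = +-homo
      ; *-homo = *-homo
      ; -‿homo = -‿homo
      ; 0-homo = refl
      ; 1-homo = refl
      }

    equal? : WeaklyDecidable (Induced-equivalence morphism)
    equal? x y with x ℤ.≟ y
    ... | no _ = nothing
    ... | yes x≡y = just (reflexive (≡.cong ⟦_⟧ x≡y))

  open import Algebra.Solver.Ring ℤ.+-*-rawRing (fromCommutativeRing R) morphism equal? public
    using (solve; _:=_; _:+_; _:*_; _:-_; :-_; _:^_; con)

module ListSum {a b} (M : CommutativeMonoid a b) where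
  open CommutativeMonoid M
  open CommutativeSemigroup commutativeSemigroup using (interchange)

  ∑ : ∀ {d} {B : Set d} → List B → (B → Carrier) → Carrier
  ∑ xs h = List.foldr (λ x s → h x ∙ s) ε xs

  ∑-cong : ∀ {d} {B : Set d} (xs : List B) {h h′ : B → Carrier} → (∀ x → h x ≈ h′ x) → ∑ xs h ≈ ∑ xs h′
  ∑-cong [] eq = refl
  ∑-cong (x ∷ xs) eq = ∙-cong (eq x) (∑-cong xs eq)

  ∑-ε : ∀ {d} {B : Set d} (xs : List B) → ∑ xs (λ _ → ε) ≈ ε
  ∑-ε [] = refl
  ∑-ε (x ∷ xs) = trans (identityˡ _) (∑-ε xs)

  ∑-∙ : ∀ {d} {B : Set d} (xs : List B) (h h′ : B → Carrier) → ∑ xs (λ x → h x ∙ h′ x) ≈ ∑ xs h ∙ ∑ xs h′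
  ∑-∙ [] h h′ = sym (identityˡ _)
  ∑-∙ (x ∷ xs) h h′ = trans (∙-congˡ (∑-∙ xs h h′)) (interchange _ _ _ _)

  ∑-swap : ∀ {d d′} {B : Set d} {B′ : Set d′} (xs : List B) (ys : List B′) (h : B → B′ → Carrier) →
           ∑ xs (λ x → ∑ ys (h x)) ≈ ∑ ys (λ y → ∑ xs (λ x → h x y))
  ∑-swap [] ys h = sym (∑-ε ys)
  ∑-swap (x ∷ xs) ys h = trans (∙-congˡ (∑-swap xs ys h)) (sym (∑-∙ ys (h x) _))

  ∑-++ : ∀ {d} {B : Set d} (xs ys : List B) (h : B → Carrier) → ∑ (xs List.++ ys) h ≈ ∑ xs h ∙ ∑ ys h
  ∑-++ [] ys h = sym (identityˡ _)
  ∑-++ (x ∷ xs) ys h = trans (∙-congˡ (∑-++ xs ys h)) (sym (assoc _ _ _))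

  ∑-map : ∀ {d d′} {B : Set d} {B′ : Set d′} (f : B → B′) (xs : List B) (h : B′ → Carrier) →
          ∑ (List.map f xs) h ≈ ∑ xs (h ∘ f)
  ∑-map f [] h = refl
  ∑-map f (x ∷ xs) h = ∙-congˡ (∑-map f xs h)

  ∑-concatMap : ∀ {d d′} {B : Set d} {B′ : Set d′} (f : B → List B′) (xs : List B) (h : B′ → Carrier) →
                ∑ (concatMap f xs) h ≈ ∑ xs (λ x → ∑ (f x) h)
  ∑-concatMap f [] h = refl
  ∑-concatMap f (x ∷ xs) h = trans (∑-++ (f x) _ h) (∙-congˡ (∑-concatMap f xs h))

  ∑-tabulate : ∀ {d} {B : Set d} {n} (f : Fin n → B) (h : B → Carrier) →
               ∑ (List.tabulate f) h ≈ Sum.sum M (h ∘ f)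
  ∑-tabulate {n = zero} f h = refl
  ∑-tabulate {n = suc n} f h = ∙-congˡ (∑-tabulate (f ∘ suc) h)

module PowerSeries {a b} (R : CommutativeRing a b) where
  open CommutativeRing R
  open RingSolver R
  open SetoidReasoning setoid

  Series : Set a
  Series = ℕ → Carrier

  infix 4 _≈ₛ_
  _≈ₛ_ : Series → Series → Set b
  f ≈ₛ g = ∀ n → f n ≈ g n

  infixl 7 _*ₛ_
  _*ₛ_ : Series → Series → Series
  (f *ₛ g) zero = f 0 * g 0
  (f *ₛ g) (suc n) = f 0 * g (suc n) + ((f ∘ suc) *ₛ g) n

  const : Carrier → Series
  const x zero = x
  const x (suc n) = 0#

  *ₛ-cong : ∀ {f f′ g g′} → f ≈ₛ f′ → g ≈ₛ g′ → f *ₛ g ≈ₛ f′ *ₛ g′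
  *ₛ-cong f≈f′ g≈g′ zero = *-cong (f≈f′ 0) (g≈g′ 0)
  *ₛ-cong f≈f′ g≈g′ (suc n) = +-cong (*-cong (f≈f′ 0) (g≈g′ (suc n))) (*ₛ-cong (f≈f′ ∘ suc) g≈g′ n)

  0-*ₛ : ∀ {f} g → (∀ n → f n ≈ 0#) → ∀ n → (f *ₛ g) n ≈ 0#
  0-*ₛ g f≈0 zero = trans (*-congʳ (f≈0 0)) (zeroˡ _)
  0-*ₛ g f≈0 (suc n) = trans (+-cong (trans (*-congʳ (f≈0 0)) (zeroˡ _)) (0-*ₛ g (f≈0 ∘ suc) n)) (+-identityˡ _)

  const-*ₛ : ∀ x g n → (const x *ₛ g) n ≈ x * g n
  const-*ₛ x g zero = refl
  const-*ₛ x g (suc n) = trans (+-congˡ (0-*ₛ g (λ _ → refl) n)) (+-identityʳ _)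

  *ₛ-tail : ∀ f g n → (f *ₛ g) (suc n) ≈ f (suc n) * g 0 + (f *ₛ (g ∘ suc)) n
  *ₛ-tail f g zero = +-comm _ _
  *ₛ-tail f g (suc n) = trans (+-congˡ (*ₛ-tail (f ∘ suc) g n))
    (solve 3 (λ x y z → x :+ (y :+ z) := y :+ (x :+ z)) refl _ _ _)

  *ₛ-comm : ∀ f g → f *ₛ g ≈ₛ g *ₛ f
  *ₛ-comm f g zero = *-comm _ _
  *ₛ-comm f g (suc n) = trans (+-cong (*-comm _ _) (*ₛ-comm (f ∘ suc) g n)) (sym (*ₛ-tail g f n))

  *ₛ-distribʳ : ∀ h f g n → ((λ i → f i + g i) *ₛ h) n ≈ (f *ₛ h) n + (g *ₛ h) n
  *ₛ-distribʳ h f g zero = distribʳ _ _ _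
  *ₛ-distribʳ h f g (suc n) = trans (+-congˡ (*ₛ-distribʳ h (f ∘ suc) (g ∘ suc) n))
    (solve 5 (λ h x y u v → (x :+ y) :* h :+ (u :+ v) := (x :* h :+ u) :+ (y :* h :+ v)) refl _ _ _ _ _)

  scale-*ₛ : ∀ x f g n → ((λ i → x * f i) *ₛ g) n ≈ x * (f *ₛ g) n
  scale-*ₛ x f g zero = *-assoc _ _ _
  scale-*ₛ x f g (suc n) = trans (+-cong (*-assoc _ _ _) (scale-*ₛ x (f ∘ suc) g n)) (sym (distribˡ _ _ _))

  *ₛ-assoc : ∀ f g h → (f *ₛ g) *ₛ h ≈ₛ f *ₛ (g *ₛ h)
  *ₛ-assoc f g h zero = *-assoc _ _ _
  *ₛ-assoc f g h (suc n) = begin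
    (f 0 * g 0) * h (suc n) + ((λ i → f 0 * g (suc i) + ((f ∘ suc) *ₛ g) i) *ₛ h) n
      ≈⟨ +-congˡ (trans (*ₛ-distribʳ h _ _ n) (+-cong (scale-*ₛ (f 0) (g ∘ suc) h n) (*ₛ-assoc (f ∘ suc) g h n))) ⟩
    (f 0 * g 0) * h (suc n) + (f 0 * ((g ∘ suc) *ₛ h) n + ((f ∘ suc) *ₛ (g *ₛ h)) n)
      ≈⟨ solve 5 (λ x y z u v → (x :* y) :* z :+ (x :* u :+ v) := x :* (y :* z :+ u) :+ v) refl _ _ _ _ _ ⟩
    (f *ₛ (g *ₛ h)) (suc n) ∎

  1-*ₛ : ∀ g n → (const 1# *ₛ g) n ≈ g n
  1-*ₛ g n = trans (const-*ₛ 1# g n) (*-identityˡ _)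

  seriesRing : CommutativeRing a b
  seriesRing = record
    { _≈_ = _≈ₛ_
    ; _+_ = λ f g n → f n + g n
    ; _*_ = _*ₛ_
    ; -_ = λ f n → - f n
    ; 0# = λ _ → 0#
    ; 1# = const 1#
    ; isCommutativeRing = record
      { isRing = record
        { +-isAbelianGroup = record
          { isGroup = record
            { isMonoid = record
              { isSemigroup = record
                { isMagma = record
                  { isEquivalence = record
                    { refl = λ _ → refl
                    ; sym = λ e n → sym (e n)
                    ; trans = λ e e′ n → trans (e n) (e′ n)
                    }
                  ; ∙-cong = λ e e′ n → +-cong (e n) (e′ n)
                  }
                ; assoc = λ f g h n → +-assoc _ _ _
                }
              ; identity = (λ f n → +-identityˡ _) , (λ f n → +-identityʳ _)
              }
            ; inverse = (λ f n → -‿inverseˡ _) , (λ f n → -‿inverseʳ _)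
            ; ⁻¹-cong = λ e n → -‿cong (e n)
            }
          ; comm = λ f g n → +-comm _ _
          }
        ; *-cong = λ {f} {f′} {g} {g′} → *ₛ-cong {f} {f′} {g} {g′}
        ; *-assoc = *ₛ-assoc
        ; *-identity = 1-*ₛ , λ f n → trans (*ₛ-comm f (const 1#) n) (1-*ₛ f n)
        ; distrib = (λ f g h n → trans (*ₛ-comm f _ n) (trans (*ₛ-distribʳ f g h n) (+-cong (*ₛ-comm g f n) (*ₛ-comm h f n))))
                  , *ₛ-distribʳ
        }
      ; *-comm = *ₛ-comm
      }
    }

module RingIdentities {a b} (R : CommutativeRing a b) where
  open CommutativeRing R
  open RingSolver R

  determinant-neg : ∀ a b z w → a * (- w) - (- z) * b ≈ b * z - a * w
  determinant-neg = solve 4 (λ a b z w → a :* (:- w) :- (:- z) :* b := b :* z :- a :* w) refl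

  incidence : ∀ a b → a * b + (- b) * a ≈ 0#
  incidence = solve 2 (λ a b → a :* b :+ (:- b) :* a := con (+ 0)) refl

  first-coordinate : ∀ a b → 1# * a + 0# * b ≈ a
  first-coordinate = solve 2 (λ a b → con (+ 1) :* a :+ con (+ 0) :* b := a) refl

prime∤! : ∀ {p} → Prime p → ∀ m → m < p → ¬ p ∣ m !
prime∤! pp zero _ p∣1 = contradiction (∣1⇒≡1 p∣1) (ℕ.nonTrivial⇒≢1 {{prime⇒nonTrivial pp}})
prime∤! pp (suc m) m<p p∣m! with euclidsLemma (suc m) (m !) pp p∣m!
... | inj₁ p∣1+m = ℕ.<⇒≱ m<p (∣⇒≤ p∣1+m)
... | inj₂ p∣m! = prime∤! pp m (ℕ.<-trans (ℕ.n<1+n m) m<p) p∣m!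

prime∣C : ∀ {p} → Prime p → ∀ k → 0 < k → k < p → p ∣ p ℕ.C k
prime∣C {p} pp k 0<k k<p with euclidsLemma (p ℕ.C k) (k ! ℕ.* (p ∸ k) !) pp p∣C*k!*[p-k]!
  where
  instance _ = k !* (p ∸ k) !≢0
  k!*[p-k]!∣p! : k ! ℕ.* (p ∸ k) ! ∣ p !
  k!*[p-k]!∣p! = k![n∸k]!∣n! (ℕ.<⇒≤ k<p)
  C*k!*[p-k]!≡p! : (p ℕ.C k) ℕ.* (k ! ℕ.* (p ∸ k) !) ≡ p !
  C*k!*[p-k]!≡p! = ≡.trans (≡.cong (ℕ._* (k ! ℕ.* (p ∸ k) !)) (nCk≡n!/k![n-k]! (ℕ.<⇒≤ k<p)))
                           (≡.trans (≡.cong (ℕ._* (k ! ℕ.* (p ∸ k) !)) (n/m≡quotient k!*[p-k]!∣p!)) (≡.sym (_∣_.equality k!*[p-k]!∣p!)))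
  p∣p! : ∀ {p} → .{{NonZero p}} → p ∣ p !
  p∣p! {suc p} = ∣m⇒∣m*n (p !) ∣-refl
  p∣C*k!*[p-k]! : p ∣ (p ℕ.C k) ℕ.* (k ! ℕ.* (p ∸ k) !)
  p∣C*k!*[p-k]! = ≡.subst (p ∣_) (≡.sym C*k!*[p-k]!≡p!) (p∣p! {{prime⇒nonZero pp}})
... | inj₁ p∣C = p∣C
... | inj₂ p∣k!*[p-k]! with euclidsLemma (k !) ((p ∸ k) !) pp p∣k!*[p-k]!
...   | inj₁ p∣k! = contradiction p∣k! (prime∤! pp k k<p)
...   | inj₂ p∣[p-k]! = contradiction p∣[p-k]! (prime∤! pp (p ∸ k) (ℕ.∸-monoʳ-< 0<k (ℕ.<⇒≤ k<p)))

module Freshman {a b} (R : CommutativeRing a b) where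
  open CommutativeRing R hiding (zero)
  open Exp semiring using (_^_)
  open Mult semiring renaming (_×_ to _·_)
  open Binomial commutativeSemiring using (theorem; binomialTerm)
  open MonoidSum +-monoid using (sum; sum-init-last)
  open SetoidReasoning setoid
  open RingSolver R

  private
    multiple-sum : ∀ m {n} (t : Vector Carrier n) → (∀ i → ∃ λ z → t i ≈ m · z) → ∃ λ z → sum t ≈ m · z
    multiple-sum m {zero} t _ = 0# , sym (trans (×-comm-0 m) refl)
      where
      ×-comm-0 : ∀ m → m · 0# ≈ 0#
      ×-comm-0 zero = refl
      ×-comm-0 (suc m) = trans (+-identityˡ _) (×-comm-0 m)
    multiple-sum m {suc n} t multiple =
      let z , eq = multiple zero
          z′ , eq′ = multiple-sum m (t ∘ suc) (multiple ∘ suc)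
      in z + z′ , trans (+-cong eq eq′) (sym (·-distrib-+ m z z′))
      where
      ·-distrib-+ : ∀ m x y → m · (x + y) ≈ m · x + m · y
      ·-distrib-+ zero x y = sym (+-identityˡ _)
      ·-distrib-+ (suc m) x y = trans (+-congˡ (·-distrib-+ m x y))
        (solve 4 (λ x y u v → (x :+ y) :+ (u :+ v) := (x :+ u) :+ (y :+ v)) refl x y _ _)

  freshman : ∀ {p} → Prime p → ∀ x y → ∃ λ z → (x + y) ^ p ≈ x ^ p + y ^ p + p · z
  freshman {zero} pp = contradiction ≡.refl (ℕ.≢-nonZero⁻¹ 0 {{prime⇒nonZero pp}})
  freshman {p@(suc p′)} pp x y =
    let z , eq = multiple-sum p (Vector.init t′) middle in z , (begin
      (x + y) ^ p
        ≈⟨ theorem p x y ⟩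
      t zero + sum t′
        ≈⟨ +-cong first (trans (sum-init-last t′) (+-cong eq last)) ⟩
      y ^ p + (p · z + x ^ p)
        ≈⟨ solve 3 (λ y z x → y :+ (z :+ x) := x :+ y :+ z) refl _ _ _ ⟩
      x ^ p + y ^ p + p · z ∎)
    where
    t : Vector Carrier (suc p)
    t = binomialTerm x y p
    t′ : Vector Carrier p
    t′ = t ∘ suc

    first : t zero ≈ y ^ p
    first = trans (+-identityʳ _) (*-identityˡ _)

    last : t′ (Fin.fromℕ p′) ≈ x ^ p
    last = begin
      (p ℕ.C suc (toℕ (Fin.fromℕ p′))) · (x ^ suc (toℕ (Fin.fromℕ p′)) * y ^ (p′ ∸ toℕ (Fin.fromℕ p′)))
        ≡⟨ ≡.cong (λ k → (p ℕ.C suc k) · (x ^ suc k * y ^ (p′ ∸ k))) (Fin.toℕ-fromℕ p′) ⟩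
      (p ℕ.C p) · (x ^ p * y ^ (p′ ∸ p′))
        ≡⟨ ≡.cong₂ (λ m k → m · (x ^ p * y ^ k)) (nCn≡1 p) (ℕ.n∸n≡0 p′) ⟩
      1 · (x ^ p * 1#)
        ≈⟨ trans (+-identityʳ _) (*-identityʳ _) ⟩
      x ^ p ∎

    middle : ∀ i → ∃ λ z → Vector.init t′ i ≈ p · z
    middle i with prime∣C pp (suc (toℕ (Fin.inject₁ i))) (s≤s z≤n) (s≤s (≡.subst (_< p′) (≡.sym (Fin.toℕ-inject₁ i)) (Fin.toℕ<n i)))
    ... | divides m eq = m · w , (begin
      (p ℕ.C suc (toℕ (Fin.inject₁ i))) · w   ≡⟨ ≡.cong (_· w) (≡.trans eq (ℕ.*-comm m p)) ⟩
      (p ℕ.* m) · w                         ≈⟨ ×-assocˡ w p m ⟨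
      p · (m · w) ∎)
      where
      w = x ^ suc (toℕ (Fin.inject₁ i)) * y ^ (p′ ∸ toℕ (Fin.inject₁ i))

module Modulo {a b} (R : CommutativeRing a b) (m : CommutativeRing.Carrier R) where
  open CommutativeRing R hiding (zero)
  open RingSolver R
  open Exp semiring using (_^_)

  infix 4 _~_
  _~_ : Carrier → Carrier → Set (a ⊔ b)
  x ~ y = ∃ λ z → x ≈ y + m * z

  ~-reflexive : ∀ {x y} → x ≈ y → x ~ y
  ~-reflexive {x} {y} x≈y = 0# , trans x≈y (solve 2 (λ y m → y := y :+ m :* con (+ 0)) refl y m)

  ~-trans : ∀ {x y z} → x ~ y → y ~ z → x ~ z
  ~-trans {z = z} (u , x≈) (v , y≈) = u + v , trans x≈ (trans (+-congʳ y≈)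
    (solve 4 (λ z m u v → (z :+ m :* v) :+ m :* u := z :+ m :* (u :+ v)) refl z m u v))

  ~-sym : ∀ {x y} → x ~ y → y ~ x
  ~-sym {x} {y} (z , x≈) = - z , sym (trans (+-congʳ x≈)
    (solve 3 (λ y m z → (y :+ m :* z) :+ m :* (:- z) := y) refl y m z))

  ~-+ : ∀ {x y x′ y′} → x ~ y → x′ ~ y′ → x + x′ ~ y + y′
  ~-+ (u , x≈) (v , y≈) = u + v , trans (+-cong x≈ y≈)
    (solve 5 (λ y y′ m u v → (y :+ m :* u) :+ (y′ :+ m :* v) := (y :+ y′) :+ m :* (u :+ v)) refl _ _ m u v)

  ~-* : ∀ {x y x′ y′} → x ~ y → x′ ~ y′ → x * x′ ~ y * y′
  ~-* {y = y} {y′ = y′} (u , x≈) (v , y≈) = y * v + u * y′ + u * (m * v) , trans (*-cong x≈ y≈)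
    (solve 5 (λ y y′ m u v → (y :+ m :* u) :* (y′ :+ m :* v) := (y :* y′) :+ m :* (y :* v :+ u :* y′ :+ u :* (m :* v))) refl y y′ m u v)

  ~-^ : ∀ n {x y} → x ~ y → x ^ n ~ y ^ n
  ~-^ zero _ = ~-reflexive refl
  ~-^ (suc n) x~y = ~-* x~y (~-^ n x~y)

  ~-neg : ∀ {x y z} → x + y ~ 0# → x ~ z → y ~ - z
  ~-neg {x} {y} {z} (u , x+y≈) (v , x≈) = u - v , trans
    (solve 2 (λ x y → y := (x :+ y) :- x) refl x y)
    (trans (+-cong x+y≈ (-‿cong x≈))
      (solve 4 (λ z m u v → (con (+ 0) :+ m :* u) :- (z :+ m :* v) := :- z :+ m :* (u :- v)) refl z m u v))

module JIdentities {a b} (R : CommutativeRing a b) where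
  open CommutativeRing R
  open RingSolver R

  J-+-identity : ∀ u v x y P z w → u * x ≈ P * z → v * y ≈ P * w → (u * v) * (x + y) ≈ P * (v * z + u * w)
  J-+-identity u v x y P z w eq eq′ = trans
    (solve 4 (λ u v x y → (u :* v) :* (x :+ y) := v :* (u :* x) :+ u :* (v :* y)) refl u v x y)
    (trans (+-cong (*-congˡ eq) (*-congˡ eq′))
      (solve 5 (λ u v P z w → v :* (P :* z) :+ u :* (P :* w) := P :* (v :* z :+ u :* w)) refl u v P z w))

  J-*-identity : ∀ u v x y P P′ P″ z w → P″ ≈ P * P′ → u * x ≈ P * z → v * y ≈ P′ * w → (u * v) * (x * y) ≈ P″ * (z * w)
  J-*-identity u v x y P P′ P″ z w eq″ eq eq′ = trans
    (solve 4 (λ u v x y → (u :* v) :* (x :* y) := (u :* x) :* (v :* y)) refl u v x y)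
    (trans (*-cong eq eq′) (trans
      (solve 4 (λ P z P′ w → (P :* z) :* (P′ :* w) := (P :* P′) :* (z :* w)) refl P z P′ w) (*-congʳ (sym eq″))))

  J-suc-identity : ∀ u x P P′ P″ z → P″ ≈ P * P′ → u * x ≈ P″ * z → u * x ≈ P′ * (P * z)
  J-suc-identity u x P P′ P″ z eq eq′ = trans eq′ (trans (*-congʳ eq)
    (solve 3 (λ P P′ z → (P :* P′) :* z := P′ :* (P :* z)) refl P P′ z))

  kernel-identity : ∀ x y P P′ z → P ≈ P′ → x * y ≈ x + P * z → (1# - y) * x ≈ P′ * (- z)
  kernel-identity x y P P′ z eq′ eq = trans
    (solve 2 (λ x y → (con (+ 1) :- y) :* x := x :- x :* y) refl x y)
    (trans (+-congˡ (-‿cong eq)) (trans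
      (solve 3 (λ x P z → x :- (x :+ P :* z) := P :* (:- z)) refl x P z) (*-congʳ eq′)))

  torsion-identity : ∀ u N N′ P P′ P″ z → N ≈ N′ * P → P″ ≈ P * P′ → u * N ≈ P″ * z → P * (u * N′) ≈ P * (P′ * z)
  torsion-identity u N N′ P P′ P″ z eqN eqP eq = trans
    (solve 3 (λ u N′ P → P :* (u :* N′) := u :* (N′ :* P)) refl u N′ P)
    (trans (*-congˡ (sym eqN)) (trans eq (trans (*-congʳ eqP) (*-assoc P P′ z))))

module Divisibility {c ℓ : Level} {q : ℕ} (F : FiniteField c ℓ q) (p : ℕ) (p-prime : Prime p)
                    (f : ℕ) (q≡p^f : q ≡ p ℕ.^ f) (f≥1 : f ℕ.≥ 1) where

  module K = FiniteField F
  open Exp K.semiring using () renaming (_^_ to _^K_)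
  open Mult K.semiring using () renaming (_×_ to _·K_)

  -- A substitute for an algebra over the Witt vectors of F: ideals J i with the formal properties of
  -- the ideals (p ^ i), and a lift ⟨_⟩ of F that is multiplicative and additive modulo J 1 only.
  record LiftRing : Set (lsuc (c ⊔ ℓ)) where
    field
      commutativeRing : CommutativeRing c (c ⊔ ℓ)
    open CommutativeRing commutativeRing public hiding (zero)
    open Mult semiring public using () renaming (_×_ to _·_)
    field
      J      : ℕ → Carrier → Set (c ⊔ ℓ)
      J-cong : ∀ i {x y} → x ≈ y → J i x → J i y
      J-+    : ∀ i {x y} → J i x → J i y → J i (x + y)
      J-*    : ∀ i j {x y} → J i x → J j y → J (i ℕ.+ j) (x * y)
      J-all  : ∀ x → J 0 x
      J-suc  : ∀ i {x} → J (suc i) x → J i x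
      J-p    : J 1 (p · 1#)
      ⟨_⟩    : K.Carrier → Carrier
      ⟨⟩-cong : ∀ {a b} → a K.≈ b → J 1 (⟨ a ⟩ - ⟨ b ⟩)
      ⟨⟩-+    : ∀ a b → J 1 (⟨ a K.+ b ⟩ - (⟨ a ⟩ + ⟨ b ⟩))
      ⟨⟩-*    : ∀ a b → J 1 (⟨ a K.* b ⟩ - ⟨ a ⟩ * ⟨ b ⟩)
      ⟨⟩-1    : J 1 (⟨ K.1# ⟩ - 1#)

  module LiftRingProperties (A : LiftRing) where
    open LiftRing A
    open RingSolver commutativeRing
    open import Algebra.Properties.Ring ring using (-0#≈0#)
    open Exp semiring using (_^_; ^-assocʳ)

    infix 4 _≡_[_]
    _≡_[_] : Carrier → Carrier → ℕ → Set (c ⊔ ℓ)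
    x ≡ y [ i ] = J i (x - y)

    J-*ˡ : ∀ i x {y} → J i y → J i (x * y)
    J-*ˡ i x = J-* 0 i (J-all x)

    J-*ʳ : ∀ i {x} y → J i x → J i (x * y)
    J-*ʳ i y j = J-cong i (*-comm _ _) (J-*ˡ i y j)

    J-neg : ∀ i {x} → J i x → J i (- x)
    J-neg i j = J-cong i (solve 1 (λ x → (:- con (+ 1)) :* x := :- x) refl _) (J-*ˡ i (- 1#) j)

    J-≤ : ∀ {i j x} → i ≤ j → J j x → J i x
    J-≤ {i} {j} i≤j = go (ℕ.≤⇒≤′ i≤j)
      where
      go : ∀ {j x} → i ℕ.≤′ j → J j x → J i x
      go ℕ.≤′-refl Jx = Jx
      go (ℕ.≤′-step le) Jx = go le (J-suc _ Jx)

    J-0 : ∀ i → J i 0#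
    J-0 zero = J-all _
    J-0 (suc i) = J-cong (suc i) (zeroʳ _) (J-* 1 i J-p (J-0 i))

    ≈⇒≡ : ∀ i {x y} → x ≈ y → x ≡ y [ i ]
    ≈⇒≡ i x≈y = J-cong i (sym (trans (+-congʳ x≈y) (-‿inverseʳ _))) (J-0 i)

    quotient : ℕ → CommutativeRing c (c ⊔ ℓ)
    quotient i = record
      { _≈_ = λ x y → x ≡ y [ i ]
      ; _+_ = _+_
      ; _*_ = _*_
      ; -_ = -_
      ; 0# = 0#
      ; 1# = 1#
      ; isCommutativeRing = record
        { isRing = record
          { +-isAbelianGroup = record
            { isGroup = record
              { isMonoid = record
                { isSemigroup = record
                  { isMagma = record
                    { isEquivalence = record
                      { refl = ≈⇒≡ i refl
                      ; sym = λ j → J-cong i (solve 2 (λ x y → :- (x :- y) := y :- x) refl _ _) (J-neg i j)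
                      ; trans = λ j k → J-cong i (solve 3 (λ x y z → (x :- y) :+ (y :- z) := x :- z) refl _ _ _) (J-+ i j k)
                      }
                    ; ∙-cong = λ j k → J-cong i (solve 4 (λ x y u v → (x :- y) :+ (u :- v) := (x :+ u) :- (y :+ v)) refl _ _ _ _) (J-+ i j k)
                    }
                  ; assoc = λ x y z → ≈⇒≡ i (+-assoc x y z)
                  }
                ; identity = (λ x → ≈⇒≡ i (+-identityˡ x)) , (λ x → ≈⇒≡ i (+-identityʳ x))
                }
              ; inverse = (λ x → ≈⇒≡ i (-‿inverseˡ x)) , (λ x → ≈⇒≡ i (-‿inverseʳ x))
              ; ⁻¹-cong = λ j → J-cong i (solve 2 (λ x y → :- (x :- y) := (:- x) :- (:- y)) refl _ _) (J-neg i j)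
              }
            ; comm = λ x y → ≈⇒≡ i (+-comm x y)
            }
          ; *-cong = λ {x} {y} {u} {v} j k →
              J-cong i (solve 4 (λ x y u v → (x :- y) :* u :+ y :* (u :- v) := x :* u :- y :* v) refl x y u v)
                (J-+ i (J-*ʳ i u j) (J-*ˡ i y k))
          ; *-assoc = λ x y z → ≈⇒≡ i (*-assoc x y z)
          ; *-identity = (λ x → ≈⇒≡ i (*-identityˡ x)) , (λ x → ≈⇒≡ i (*-identityʳ x))
          ; distrib = (λ x y z → ≈⇒≡ i (distribˡ x y z)) , (λ x y z → ≈⇒≡ i (distribʳ x y z))
          }
        ; *-comm = λ x y → ≈⇒≡ i (*-comm x y)
        }
      }

    module Q (i : ℕ) = CommutativeRing (quotient i)

    ≡0⇒J : ∀ i {x} → x ≡ 0# [ i ] → J i x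
    ≡0⇒J i = J-cong i (trans (+-congˡ -0#≈0#) (+-identityʳ _))

    J⇒≡0 : ∀ i {x} → J i x → x ≡ 0# [ i ]
    J⇒≡0 i = J-cong i (sym (trans (+-congˡ -0#≈0#) (+-identityʳ _)))

    J-≡ : ∀ i {x y} → x ≡ y [ i ] → J i y → J i x
    J-≡ i x≡y Jy = ≡0⇒J i (Q.trans i x≡y (J⇒≡0 i Jy))

    p·∈J : ∀ x → J 1 (p · x)
    p·∈J x = J-cong 1 (trans (Mult.×-assoc-* semiring p 1# x) (Mult.×-congʳ semiring p (*-identityˡ x))) (J-*ʳ 1 x J-p)

    ⟨0⟩ : J 1 ⟨ K.0# ⟩
    ⟨0⟩ = J-cong 1 (solve 1 (λ x → (x :+ x) :- x := x) refl _)
      (Q.trans 1 (Q.sym 1 (⟨⟩-+ K.0# K.0#)) (⟨⟩-cong (K.+-identityˡ K.0#)))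

    ⟨⟩-neg : ∀ a → ⟨ K.- a ⟩ ≡ - ⟨ a ⟩ [ 1 ]
    ⟨⟩-neg a = J-cong 1 (solve 2 (λ x y → (x :+ y) :- (:- (:- x) :- :- (:- x)) := y :- :- x) refl _ _)
      (J-+ 1 (J-≡ 1 (Q.trans 1 (Q.sym 1 (⟨⟩-+ a (K.- a))) (⟨⟩-cong (K.-‿inverseʳ a))) ⟨0⟩)
             (J-neg 1 (≈⇒≡ 1 refl)))

    ⟨⟩-- : ∀ a b → ⟨ a K.- b ⟩ ≡ ⟨ a ⟩ - ⟨ b ⟩ [ 1 ]
    ⟨⟩-- a b = Q.trans 1 (⟨⟩-+ a (K.- b)) (Q.+-congˡ 1 (⟨⟩-neg b))

    ⟨⟩-^ : ∀ a n → ⟨ a ^K n ⟩ ≡ ⟨ a ⟩ ^ n [ 1 ]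
    ⟨⟩-^ a zero = ⟨⟩-1
    ⟨⟩-^ a (suc n) = Q.trans 1 (⟨⟩-* a _) (Q.*-congˡ 1 (⟨⟩-^ a n))

    private
      geometric : ℕ → Carrier → Carrier → Carrier
      geometric zero x y = 0#
      geometric (suc n) x y = x ^ n + y * geometric n x y

      geometric-telescopes : ∀ n x y → x ^ n - y ^ n ≈ (x - y) * geometric n x y
      geometric-telescopes zero x y = solve 2 (λ x y → con (+ 1) :- con (+ 1) := (x :- y) :* con (+ 0)) refl x y
      geometric-telescopes (suc n) x y = trans
        (solve 4 (λ x y u v → x :* u :- y :* v := (x :- y) :* u :+ y :* (u :- v)) refl x y (x ^ n) (y ^ n))
        (trans (+-congˡ (*-congˡ (geometric-telescopes n x y)))
          (solve 4 (λ x y u g → (x :- y) :* u :+ y :* ((x :- y) :* g) := (x :- y) :* (u :+ y :* g)) refl x y (x ^ n) _))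

      geometric-diagonal : ∀ n {x y} → x ≡ y [ 1 ] → geometric (suc n) x y ≡ suc n · x ^ n [ 1 ]
      geometric-diagonal zero {x} {y} x≡y = ≈⇒≡ 1 (+-congˡ (zeroʳ y))
      geometric-diagonal (suc n) {x} {y} x≡y = Q.+-congˡ 1
        (Q.trans 1 (Q.*-cong 1 (Q.sym 1 x≡y) (geometric-diagonal n x≡y))
          (≈⇒≡ 1 (Mult.×-comm-* semiring (suc n) x _)))

      geometric-multiple : ∀ n {x y} → x ≡ y [ 1 ] → ∃ λ z → geometric n x y ≡ n · z [ 1 ]
      geometric-multiple zero _ = 0# , ≈⇒≡ 1 refl
      geometric-multiple (suc n) {x} x≡y = x ^ n , geometric-diagonal n x≡y

      geometric-p : ∀ {x y} → x ≡ y [ 1 ] → J 1 (geometric p x y)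
      geometric-p x≡y = let z , eq = geometric-multiple p x≡y in J-≡ 1 eq (p·∈J z)

    ^p-cong : ∀ i {x y} → x ≡ y [ suc i ] → x ^ p ≡ y ^ p [ suc (suc i) ]
    ^p-cong i {x} {y} x≡y = J-cong (suc (suc i)) (sym (geometric-telescopes p x y))
      (≡.subst (λ j → J j ((x - y) * geometric p x y)) (ℕ.+-comm (suc i) 1) (J-* (suc i) 1 x≡y (geometric-p (J-≤ (s≤s z≤n) x≡y))))

    ^p^-cong : ∀ i {x y} → x ≡ y [ 1 ] → x ^ (p ℕ.^ i) ≡ y ^ (p ℕ.^ i) [ suc i ]
    ^p^-cong zero x≡y = Q.*-cong 1 x≡y (Q.refl 1)
    ^p^-cong (suc i) {x} {y} x≡y = Q.trans _ (≈⇒≡ _ (split x)) (Q.trans _ (^p-cong i (^p^-cong i x≡y)) (≈⇒≡ _ (sym (split y))))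
      where
      split : ∀ x → x ^ (p ℕ.^ suc i) ≈ (x ^ (p ℕ.^ i)) ^ p
      split x = trans (Exp.^-congʳ semiring x (ℕ.*-comm p (p ℕ.^ i))) (sym (^-assocʳ x (p ℕ.^ i) p))

    Cancellable : Carrier → Set (c ⊔ ℓ)
    Cancellable x = ∀ i y → J i (x * y) → J i y

    -- An inverse modulo J 1 pushes y from J l into J (suc l), as long as x * y ∈ J (suc l).
    unit-cancellable : ∀ {x y} → x * y ≡ 1# [ 1 ] → Cancellable x
    unit-cancellable {x} {y} xy≡1 i z Jxz = go i ℕ.≤-refl
      where
      go : ∀ l → l ≤ i → J l z
      go zero _ = J-all z
      go (suc l) l<i = J-cong (suc l) (solve 3 (λ x y z → x :* z :* y :- (x :* y :- con (+ 1)) :* z := z) refl x y z)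
        (J-+ (suc l) (J-*ʳ (suc l) y (J-≤ l<i Jxz)) (J-neg (suc l) (J-* 1 l xy≡1 (go l (ℕ.<⇒≤ l<i)))))

    ≡-unit-cancellable : ∀ {x a} → x ≡ ⟨ a ⟩ [ 1 ] → a K.≉ K.0# → Cancellable x
    ≡-unit-cancellable {x} {a} x≡a a≉0 with K.inverse a a≉0
    ... | b , ab≈1 = unit-cancellable {y = ⟨ b ⟩}
      (Q.trans 1 (Q.*-congʳ 1 x≡a) (Q.trans 1 (Q.sym 1 (⟨⟩-* a b)) (Q.trans 1 (⟨⟩-cong ab≈1) ⟨⟩-1)))

    cancellable-cong : ∀ {x y} → x ≈ y → Cancellable x → Cancellable y
    cancellable-cong x≈y cx i z Jyz = cx i z (J-cong i (*-congʳ (sym x≈y)) Jyz)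

  module SeriesLift (A : LiftRing) where
    open LiftRing A
    open LiftRingProperties A
    open PowerSeries commutativeRing public
    open RingSolver commutativeRing
    private module S = CommutativeRing seriesRing

    Jₛ : ℕ → Series → Set (c ⊔ ℓ)
    Jₛ i f = ∀ n → J i (f n)

    Jₛ-* : ∀ i j {f g} → Jₛ i f → Jₛ j g → Jₛ (i ℕ.+ j) (f *ₛ g)
    Jₛ-* i j Jf Jg zero = J-* i j (Jf 0) (Jg 0)
    Jₛ-* i j Jf Jg (suc n) = J-+ _ (J-* i j (Jf 0) (Jg (suc n))) (Jₛ-* i j (Jf ∘ suc) Jg n)

    private
      coefficient-· : ∀ m f n → Mult._×_ S.semiring m f n ≈ m · f n
      coefficient-· zero f n = refl
      coefficient-· (suc m) f n = +-congˡ (coefficient-· m f n)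

      J-const : ∀ {f x} → (∀ n → f n ≈ const x n) → J 1 x → Jₛ 1 f
      J-const f≈x Jx zero = J-cong 1 (sym (f≈x 0)) Jx
      J-const f≈x Jx (suc n) = J-cong 1 (sym (f≈x (suc n))) (J-0 1)

    series : LiftRing
    series = record
      { commutativeRing = seriesRing
      ; J = Jₛ
      ; J-cong = λ i f≈g Jf n → J-cong i (f≈g n) (Jf n)
      ; J-+ = λ i Jf Jg n → J-+ i (Jf n) (Jg n)
      ; J-* = Jₛ-*
      ; J-all = λ f n → J-all _
      ; J-suc = λ i Jf n → J-suc i (Jf n)
      ; J-p = λ n → J-cong 1 (sym (coefficient-· p (const 1#) n)) (p·∈J _)
      ; ⟨_⟩ = λ a → const ⟨ a ⟩
      ; ⟨⟩-cong = λ a≈b → J-const (λ { zero → refl ; (suc n) → -‿inverseʳ 0# }) (⟨⟩-cong a≈b)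
      ; ⟨⟩-+ = λ a b → J-const (λ { zero → refl ; (suc n) → trans (+-congˡ (-‿cong (+-identityʳ 0#))) (-‿inverseʳ 0#) }) (⟨⟩-+ a b)
      ; ⟨⟩-* = λ a b → J-const (λ { zero → refl ; (suc n) →
          trans (+-congˡ (-‿cong (trans (const-*ₛ ⟨ a ⟩ (const ⟨ b ⟩) (suc n)) (zeroʳ _)))) (-‿inverseʳ 0#) }) (⟨⟩-* a b)
      ; ⟨⟩-1 = J-const (λ { zero → refl ; (suc n) → -‿inverseʳ 0# }) ⟨⟩-1
      }

    private
      tail-∈J : ∀ j {f g} → J j (f 0 * g 0) → (∀ n → J j (f 0 * g (suc n))) → Jₛ j (f *ₛ g) → ∀ n → J j (((f ∘ suc) *ₛ g) n)
      tail-∈J j {f} {g} J0 Jf₀ Jfg n = J-cong j (solve 2 (λ x y → (x :+ y) :- x := y) refl _ _)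
        (J-+ j (Jfg (suc n)) (J-neg j (Jf₀ n)))

      push : ∀ l m f g → (∀ n → n < m → J 1 (f n)) → Cancellable (f m) →
             Jₛ l g → Jₛ (suc l) (f *ₛ g) → Jₛ (suc l) g
      push l (suc m) f g low cancel Jg Jfg = push l m (f ∘ suc) g (λ n n<m → low (suc n) (s≤s n<m)) cancel Jg
        (tail-∈J (suc l) (J-* 1 l (low 0 (s≤s z≤n)) (Jg 0)) (λ n → J-* 1 l (low 0 (s≤s z≤n)) (Jg (suc n))) Jfg)
      push l zero f g low cancel Jg Jfg n = go n g Jfg
        where
        go : ∀ n g → Jₛ (suc l) (f *ₛ g) → J (suc l) (g n)
        go zero g Jfg = cancel (suc l) (g 0) (Jfg 0)
        go (suc n) g Jfg = go n (g ∘ suc) λ m →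
          J-cong (suc l) (*ₛ-comm (g ∘ suc) f m)
            (tail-∈J (suc l) {g} {f} (g₀f 0) (λ k → g₀f (suc k)) (λ k → J-cong (suc l) (*ₛ-comm f g k) (Jfg k)) m)
          where
          g₀f : ∀ k → J (suc l) (g 0 * f k)
          g₀f k = J-*ʳ (suc l) (f k) (cancel (suc l) (g 0) (Jfg 0))

    series-cancellable : ∀ m {f} → (∀ n → n < m → J 1 (f n)) → Cancellable (f m) → LiftRingProperties.Cancellable series f
    series-cancellable m {f} low cancel i g Jfg = go i ℕ.≤-refl
      where
      go : ∀ l → l ≤ i → Jₛ l g
      go zero _ n = J-all _
      go (suc l) l<i = push l m f g low cancel (go l (ℕ.<⇒≤ l<i)) (λ n → J-≤ l<i (Jfg n))

  module Evaluation (A : LiftRing) where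
    open LiftRing A
    open LiftRingProperties A
    open RingSolver commutativeRing
    open Sum +-commutativeMonoid using (sum)
    open ListSum +-commutativeMonoid
    open Exp semiring using (_^_)

    infix 7 _⊙_
    _⊙_ : ∀ {k} → Vector Carrier k → Vector K.Carrier k → Carrier
    X ⊙ v = sum (λ i → X i * ⟨ v i ⟩)

    ⊙-congˡ : ∀ {k} {X Y : Vector Carrier k} v → (∀ i → X i ≈ Y i) → X ⊙ v ≈ Y ⊙ v
    ⊙-congˡ {zero} v X≈Y = refl
    ⊙-congˡ {suc k} v X≈Y = +-cong (*-congʳ (X≈Y zero)) (⊙-congˡ (v ∘ suc) (X≈Y ∘ suc))

    ⊙-linear : ∀ {k} x y (X Y : Vector Carrier k) v → (λ i → x * X i + y * Y i) ⊙ v ≈ x * (X ⊙ v) + y * (Y ⊙ v)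
    ⊙-linear {zero} x y X Y v = solve 2 (λ x y → con (+ 0) := x :* con (+ 0) :+ y :* con (+ 0)) refl x y
    ⊙-linear {suc k} x y X Y v = trans (+-congˡ (⊙-linear x y (X ∘ suc) (Y ∘ suc) (v ∘ suc)))
      (solve 7 (λ x y X Y v s t → (x :* X :+ y :* Y) :* v :+ (x :* s :+ y :* t) := x :* (X :* v :+ s) :+ y :* (Y :* v :+ t))
        refl x y (X zero) (Y zero) ⟨ v zero ⟩ _ _)

    0⊙ : ∀ {k} (v : Vector K.Carrier k) → (λ _ → 0#) ⊙ v ≈ 0#
    0⊙ {zero} v = refl
    0⊙ {suc k} v = trans (+-cong (zeroˡ _) (0⊙ (v ∘ suc))) (+-identityˡ _)

    powerSum : ∀ {k} → ℕ → List (Vector K.Carrier k) → Vector Carrier k → Carrier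
    powerSum M g X = ∑ g (λ v → (X ⊙ v) ^ M)

  module BinaryForm (A : LiftRing) where
    open LiftRing A
    open LiftRingProperties A
    open RingSolver commutativeRing
    open ListSum +-commutativeMonoid
    open Exp semiring using (_^_)

    eval : ∀ {m} → Vec Carrier (suc m) → Carrier → Carrier → Carrier
    eval (b ∷ []) x y = b
    eval {suc m} (b ∷ bs@(_ ∷ _)) x y = b * x ^ suc m + y * eval bs x y

    eval-scale : ∀ z {m} (bs : Vec Carrier (suc m)) x y → eval (Vec.map (z *_) bs) x y ≈ z * eval bs x y
    eval-scale z (b ∷ []) x y = refl
    eval-scale z {suc m} (b ∷ bs@(_ ∷ _)) x y = trans (+-congˡ (*-congˡ (eval-scale z bs x y)))
      (solve 5 (λ z b X y e → (z :* b) :* X :+ y :* (z :* e) := z :* (b :* X :+ y :* e)) refl z b (x ^ suc m) y (eval bs x y))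

    deflate : ∀ {m} → Carrier → Carrier → Vec Carrier (suc m) → Vec Carrier m
    deflate x₀ y₀ (b ∷ []) = []
    deflate x₀ y₀ (b ∷ bs@(_ ∷ _)) = eval bs x₀ y₀ ∷ Vec.map (x₀ *_) (deflate x₀ y₀ bs)

    deflate-eval : ∀ {m} x₀ y₀ (bs : Vec Carrier (suc (suc m))) x y →
      x₀ ^ suc m * eval bs x y ≈ (x₀ * y - y₀ * x) * eval (deflate x₀ y₀ bs) x y + x ^ suc m * eval bs x₀ y₀
    deflate-eval {zero} x₀ y₀ (b ∷ b′ ∷ []) x y =
      solve 6 (λ x₀ y₀ b b′ x y → x₀ :^ 1 :* (b :* x :^ 1 :+ y :* b′) :=
                                 (x₀ :* y :- y₀ :* x) :* b′ :+ x :^ 1 :* (b :* x₀ :^ 1 :+ y₀ :* b′)) refl x₀ y₀ b b′ x y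
    deflate-eval {suc m} x₀ y₀ (b ∷ bs@(b′ ∷ bs′@(_ ∷ _))) x y = begin
      x₀ * U * (b * (x * P) + y * E)
        ≈⟨ solve 7 (λ x₀ U b x P y E → x₀ :* U :* (b :* (x :* P) :+ y :* E) := x₀ :* U :* (b :* (x :* P)) :+ x₀ :* y :* (U :* E)) refl x₀ U b x P y E ⟩
      x₀ * U * (b * (x * P)) + x₀ * y * (U * E)
        ≈⟨ +-congˡ (*-congˡ (deflate-eval x₀ y₀ bs x y)) ⟩
      x₀ * U * (b * (x * P)) + x₀ * y * ((x₀ * y - y₀ * x) * D + P * E₀)
        ≈⟨ solve 9 (λ x₀ y₀ U b x P y D E₀ → x₀ :* U :* (b :* (x :* P)) :+ x₀ :* y :* ((x₀ :* y :- y₀ :* x) :* D :+ P :* E₀)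
                     := (x₀ :* y :- y₀ :* x) :* (E₀ :* P :+ y :* (x₀ :* D)) :+ x :* P :* (b :* (x₀ :* U) :+ y₀ :* E₀)) refl x₀ y₀ U b x P y D E₀ ⟩
      (x₀ * y - y₀ * x) * (E₀ * P + y * (x₀ * D)) + x * P * (b * (x₀ * U) + y₀ * E₀)
        ≈⟨ +-congʳ (*-congˡ (+-congˡ (*-congˡ (eval-scale x₀ (deflate x₀ y₀ bs) x y)))) ⟨
      (x₀ * y - y₀ * x) * eval (deflate x₀ y₀ (b ∷ bs)) x y + x * P * eval (b ∷ bs) x₀ y₀ ∎
      where
      open SetoidReasoning setoid
      U = x₀ ^ suc m
      P = x ^ suc m
      E = eval bs x y
      E₀ = eval bs x₀ y₀
      D = eval (deflate x₀ y₀ bs) x y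

    cancellable-^ : ∀ n {x} → Cancellable x → Cancellable (x ^ n)
    cancellable-^ zero cx i y Jy = J-cong i (*-identityˡ y) Jy
    cancellable-^ (suc n) cx i y Jy = cancellable-^ n cx i y (cx i _ (J-cong i (*-assoc _ _ _) Jy))

    form-vanishes : ∀ i {m} (bs : Vec Carrier (suc m)) (x y : Fin (suc m) → Carrier) →
      (∀ s → Cancellable (x s)) → (∀ s t → s ≢ t → Cancellable (x s * y t - y s * x t)) →
      (∀ s → J i (eval bs (x s) (y s))) → ∀ u v → J i (eval bs u v)
    form-vanishes i (b ∷ []) x y cx cδ Je u v = Je zero
    form-vanishes i {suc m} bs@(_ ∷ _ ∷ _) x y cx cδ Je u v = cancellable-^ (suc m) (cx zero) i _
      (J-cong i (sym (deflate-eval (x zero) (y zero) bs u v))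
        (J-+ i (J-*ˡ i _ (form-vanishes i (deflate (x zero) (y zero) bs) (x ∘ suc) (y ∘ suc) (cx ∘ suc)
                            (λ s t s≢t → cδ (suc s) (suc t) (s≢t ∘ Fin.suc-injective)) deflated u v))
               (J-*ˡ i _ (Je zero))))
      where
      deflated : ∀ s → J i (eval (deflate (x zero) (y zero) bs) (x (suc s)) (y (suc s)))
      deflated s = cδ zero (suc s) (λ ()) i _
        (J-cong i (solve 2 (λ a b → (a :+ b) :- b := a) refl _ _)
          (J-+ i (J-cong i (deflate-eval (x zero) (y zero) bs (x (suc s)) (y (suc s))) (J-*ˡ i _ (Je (suc s))))
                 (J-neg i (J-*ˡ i _ (Je zero)))))

    IsForm : ℕ → (Carrier → Carrier → Carrier) → Set (c ⊔ ℓ)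
    IsForm m f = ∃ λ (bs : Vec Carrier (suc m)) → ∀ x y → f x y ≈ eval bs x y

    form-0 : ∀ m → IsForm m (λ _ _ → 0#)
    form-0 zero = 0# ∷ [] , λ _ _ → refl
    form-0 (suc m) with form-0 m
    ... | bs@(_ ∷ _) , eq = 0# ∷ bs , λ x y → sym (trans (+-cong (zeroˡ _) (trans (*-congˡ (sym (eq x y))) (zeroʳ y))) (+-identityˡ _))

    form-+ : ∀ m {f g} → IsForm m f → IsForm m g → IsForm m (λ x y → f x y + g x y)
    form-+ m (bs , f≈) (bs′ , g≈) = Vec.zipWith _+_ bs bs′ , λ x y → trans (+-cong (f≈ x y) (g≈ x y)) (sym (eval-+ bs bs′ x y))
      where
      eval-+ : ∀ {m} (bs bs′ : Vec Carrier (suc m)) x y → eval (Vec.zipWith _+_ bs bs′) x y ≈ eval bs x y + eval bs′ x y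
      eval-+ (b ∷ []) (b′ ∷ []) x y = refl
      eval-+ (b ∷ bs@(_ ∷ _)) (b′ ∷ bs′@(_ ∷ _)) x y = trans (+-congˡ (*-congˡ (eval-+ bs bs′ x y)))
        (solve 6 (λ b b′ P y e e′ → (b :+ b′) :* P :+ y :* (e :+ e′) := (b :* P :+ y :* e) :+ (b′ :* P :+ y :* e′)) refl _ _ _ _ _ _)

    form-x^ : ∀ m b → IsForm m (λ x _ → b * x ^ m)
    form-x^ zero b = b ∷ [] , λ x y → *-identityʳ b
    form-x^ (suc m) b with form-0 m
    ... | bs@(_ ∷ _) , eq = b ∷ bs , λ x y → sym (trans (+-congˡ (trans (*-congˡ (sym (eq x y))) (zeroʳ y))) (+-identityʳ _))

    form-y* : ∀ m {f} → IsForm m f → IsForm (suc m) (λ x y → y * f x y)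
    form-y* m (bs@(_ ∷ _) , eq) = 0# ∷ bs , λ x y → sym (trans (+-cong (zeroˡ _) (*-congˡ (sym (eq x y)))) (+-identityˡ _))

    form-cong : ∀ m {f g} → (∀ x y → f x y ≈ g x y) → IsForm m g → IsForm m f
    form-cong m f≈g (bs , eq) = bs , λ x y → trans (f≈g x y) (eq x y)

    form-linear* : ∀ m u v {f} → IsForm m f → IsForm (suc m) (λ x y → (x * u + y * v) * f x y)
    form-linear* zero u v ((b ∷ []) , eq) = form-cong 1
      (λ x y → trans (*-congˡ (eq x y)) (solve 5 (λ x y u v b → (x :* u :+ y :* v) :* b := u :* b :* x :^ 1 :+ y :* (v :* b)) refl x y u v b))
      (u * b ∷ v * b ∷ [] , λ x y → refl)
    form-linear* (suc m) u v {f} ((b ∷ bs@(_ ∷ _)) , eq) = form-cong (suc (suc m))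
      (λ x y → trans (*-congˡ (eq x y)) (solve 7 (λ x y u v b P e → (x :* u :+ y :* v) :* (b :* P :+ y :* e) :=
          u :* b :* (x :* P) :+ y :* (v :* b :* P :+ (x :* u :+ y :* v) :* e)) refl x y u v b (x ^ suc m) (eval bs x y)))
      (form-+ (suc (suc m)) (form-x^ (suc (suc m)) (u * b))
        (form-y* (suc m) (form-+ (suc m) (form-x^ (suc m) (v * b)) (form-linear* m u v (bs , λ x y → refl)))))

    form-^ : ∀ m u v → IsForm m (λ x y → (x * u + y * v) ^ m)
    form-^ zero u v = 1# ∷ [] , λ x y → refl
    form-^ (suc m) u v = form-linear* m u v (form-^ m u v)

    form-∑ : ∀ m {d} {B : Set d} (xs : List B) {f : B → Carrier → Carrier → Carrier} →
             (∀ b → IsForm m (f b)) → IsForm m (λ x y → ∑ xs (λ b → f b x y))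
    form-∑ m [] _ = form-0 m
    form-∑ m (b ∷ xs) forms = form-+ m (forms b) (form-∑ m xs forms)

  module GenericPoint (A : LiftRing) where
    open LiftRing A
    open LiftRingProperties A
    open SeriesLift A
    module Coefficients = Evaluation A
    module Eₛ = Evaluation series
    module S = LiftRing series
    open Coefficients using (_⊙_; ⊙-congˡ; 0⊙)
    open Exp semiring using (_^_)
    open Exp S.semiring using () renaming (_^_ to _^ₛ_)

    *ₛ-const : ∀ f x n → (f *ₛ const x) n ≈ f n * x
    *ₛ-const f x n = trans (*ₛ-comm f (const x) n) (trans (const-*ₛ x f n) (*-comm _ _))

    ⊙-coefficient : ∀ {k} (X : Vector Series k) v n → (X Eₛ.⊙ v) n ≈ (λ i → X i n) ⊙ v
    ⊙-coefficient {zero} X v n = refl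
    ⊙-coefficient {suc k} X v n = +-cong (*ₛ-const (X zero) ⟨ v zero ⟩ n) (⊙-coefficient (X ∘ suc) (v ∘ suc) n)

    monomial : ℕ → Series
    monomial zero = const 1#
    monomial (suc m) zero = 0#
    monomial (suc m) (suc n) = monomial m n

    generic : ∀ {k} → Vector Series k
    generic i = monomial (toℕ i)

    generic-⊙ : ∀ {k} (v : Vector K.Carrier k) i → (generic Eₛ.⊙ v) (toℕ i) ≈ ⟨ v i ⟩
    generic-⊙ v i = trans (⊙-coefficient generic v (toℕ i)) (select v i)
      where
      select : ∀ {k} (v : Vector K.Carrier k) i → (λ j → monomial (toℕ j) (toℕ i)) ⊙ v ≈ ⟨ v i ⟩
      select v zero = trans (+-cong (*-identityˡ _) (0⊙ (v ∘ suc))) (+-identityʳ _)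
      select v (suc i) = trans (+-cong (zeroˡ _) (select (v ∘ suc) i)) (+-identityˡ _)

    generic-⊙-above : ∀ {k} (v : Vector K.Carrier k) n → k ≤ n → (generic Eₛ.⊙ v) n ≈ 0#
    generic-⊙-above v n k≤n = trans (⊙-coefficient generic v n)
      (trans (⊙-congˡ v (λ j → monomial-off (toℕ j) n (ℕ.<-≤-trans (Fin.toℕ<n j) k≤n))) (0⊙ v))
      where
      monomial-off : ∀ m n → m < n → monomial m n ≈ 0#
      monomial-off zero (suc n) _ = refl
      monomial-off (suc m) (suc n) (s≤s m<n) = monomial-off m n m<n

    lowest-cancellable : ∀ {k r} {f} {P : Fin k → Set r} → Decidable P →
      (∀ i → P i → J 1 (f (toℕ i))) → (∀ i → ¬ P i → Cancellable (f (toℕ i))) → ¬ (∀ i → P i) →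
      LiftRingProperties.Cancellable series f
    lowest-cancellable {k} {f = f} {P} P? small cancel ¬all =
      let i , ¬Pi , below = Fin.¬∀⟶∃¬-smallest k P P? ¬all
          low : ∀ n → n < toℕ i → J 1 (f n)
          low n n<i = ≡.subst (λ m → J 1 (f m))
            (≡.trans (Fin.toℕ-inject (Fin.fromℕ< n<i)) (Fin.toℕ-fromℕ< n<i))
            (small _ (below (Fin.fromℕ< n<i)))
      in series-cancellable (toℕ i) low (cancel i ¬Pi)

    ^ₛ-head : ∀ f n → (f ^ₛ n) 0 ≈ f 0 ^ n
    ^ₛ-head f zero = refl
    ^ₛ-head f (suc n) = *-congˡ (^ₛ-head f n)

    IsLinear : Series → Set (c ⊔ ℓ)
    IsLinear f = ∀ n → f (suc (suc n)) ≈ 0#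

    linear-*ₛ : ∀ {f} → IsLinear f → ∀ g n → (f *ₛ g) (suc n) ≈ f 0 * g (suc n) + f 1 * g n
    linear-*ₛ lin g zero = refl
    linear-*ₛ lin g (suc n) = +-congˡ (trans (+-congˡ (0-*ₛ g lin n)) (+-identityʳ _))

    linear-^-above : ∀ {f} → IsLinear f → ∀ m n → m < n → (f ^ₛ m) n ≈ 0#
    linear-^-above lin zero (suc n) _ = refl
    linear-^-above {f} lin (suc m) (suc n) (s≤s m<n) = trans (linear-*ₛ {f} lin (f ^ₛ m) n)
      (trans (+-cong (trans (*-congˡ (linear-^-above {f} lin m (suc n) (ℕ.m<n⇒m<1+n m<n))) (zeroʳ _))
                     (trans (*-congˡ (linear-^-above {f} lin m n m<n)) (zeroʳ _)))
             (+-identityˡ _))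

    linear-^-top : ∀ {f} → IsLinear f → ∀ m → (f ^ₛ m) m ≈ f 1 ^ m
    linear-^-top lin zero = refl
    linear-^-top {f} lin (suc m) = trans (linear-*ₛ {f} lin (f ^ₛ m) m)
      (trans (+-cong (trans (*-congˡ (linear-^-above {f} lin m (suc m) ℕ.≤-refl)) (zeroʳ _)) (*-congˡ (linear-^-top {f} lin m)))
             (+-identityˡ _))

  record Points (N k : ℕ) : Set (c ⊔ ℓ) where
    field
      point    : Fin N → Vector K.Carrier k
      nonzero  : ∀ s → ∃ λ i → point s i K.≉ K.0#
      distinct : ∀ s t → s ≢ t → ∃₂ λ i j → point s i K.* point t j K.- point s j K.* point t i K.≉ K.0#

  Vanishes : ℕ → ∀ {k} → ℕ → List (Vector K.Carrier k) → Set (lsuc (c ⊔ ℓ))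
  Vanishes e {k} M g = ∀ (A : LiftRing) X → LiftRing.J A e (Evaluation.powerSum A M g X)

  VanishesAt : ℕ → ∀ {k} → ℕ → List (Vector K.Carrier k) → Vector K.Carrier k → Set (lsuc (c ⊔ ℓ))
  VanishesAt e {k} M g v = ∀ (A : LiftRing) X → LiftRing.J A 1 (Evaluation._⊙_ A X v) → LiftRing.J A e (Evaluation.powerSum A M g X)

  module _ {M k : ℕ} (P : Points (suc M) k) where
    open Points P

    module GenericLine (A : LiftRing) (X : Vector (LiftRing.Carrier A) k) where
      A₁ = SeriesLift.series A
      A₂ = SeriesLift.series A₁
      A₃ = SeriesLift.series A₂
      module S = SeriesLift A
      module S₁ = SeriesLift A₁
      module S₂ = SeriesLift A₂
      module R = LiftRing A
      module R₁ = LiftRing A₁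
      module R₂ = LiftRing A₂
      module R₃ = LiftRing A₃
      module L = LiftRingProperties A
      module L₁ = LiftRingProperties A₁
      module L₂ = LiftRingProperties A₂
      module L₃ = LiftRingProperties A₃
      module E = Evaluation A
      module E₁ = Evaluation A₁
      module E₂ = Evaluation A₂
      module E₃ = Evaluation A₃
      module G = GenericPoint A
      module G₁ = GenericPoint A₁
      module G₂ = GenericPoint A₂

      Y₁ : Vector R₁.Carrier k
      Y₁ = G.generic

      Y₂ Z₂ X₂ : Vector R₂.Carrier k
      Y₂ i = S₁.const (Y₁ i)
      Z₂ = G₁.generic
      X₂ i = S₁.const (S.const (X i))

      -- X₃ = Z₂ + u X₂ in the outermost variable u, so that X reappears in the coefficient of u ^ M.
      Y₃ X₃ : Vector R₃.Carrier k
      Y₃ i = S₂.const (Y₂ i)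
      X₃ i zero = Z₂ i
      X₃ i (suc zero) = X₂ i
      X₃ i (suc (suc n)) = R₂.0#

      Y₁-cancellable : ∀ s → L₁.Cancellable (Y₁ E₁.⊙ point s)
      Y₁-cancellable s = G.lowest-cancellable (λ i → point s i K.≟ K.0#)
        (λ i ≈0 → R.J-cong 1 (R.sym (G.generic-⊙ (point s) i)) (L.J-≡ 1 (R.⟨⟩-cong ≈0) L.⟨0⟩))
        (λ i ≉0 → L.≡-unit-cancellable (L.≈⇒≡ 1 (G.generic-⊙ (point s) i)) ≉0)
        (λ all → let i , ≉0 = nonzero s in ≉0 (all i))

      minor : Fin (suc M) → Fin (suc M) → Fin k → Fin k → K.Carrier
      minor s t i j = point s i K.* point t j K.- point s j K.* point t i

      δ₁ : Fin (suc M) → Fin (suc M) → Fin k → R₁.Carrier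
      δ₁ s t i = (Y₁ E₁.⊙ point t) R₁.* R₁.⟨ point s i ⟩ R₁.- (Y₁ E₁.⊙ point s) R₁.* R₁.⟨ point t i ⟩

      δ₁-coefficient : ∀ s t i j → δ₁ s t i (toℕ j) L.≡ R.⟨ minor s t i j ⟩ [ 1 ]
      δ₁-coefficient s t i j = L.Q.trans 1
        (L.≈⇒≡ 1 (R.+-cong (term t s) (R.-‿cong (term s t))))
        (L.Q.sym 1 (L.Q.trans 1 (L.⟨⟩-- _ _) (L.Q.+-cong 1 (lift-* s t i j) (L.Q.-‿cong 1 (L.Q.trans 1 (R.⟨⟩-cong (K.*-comm _ _)) (lift-* t s i j))))))
        where
        term : ∀ s t → ((Y₁ E₁.⊙ point s) R₁.* R₁.⟨ point t i ⟩) (toℕ j) R.≈ R.⟨ point s j ⟩ R.* R.⟨ point t i ⟩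
        term s t = R.trans (G.*ₛ-const (Y₁ E₁.⊙ point s) _ (toℕ j)) (R.*-congʳ (G.generic-⊙ (point s) j))
        lift-* : ∀ s t i j → R.⟨ point s i K.* point t j ⟩ L.≡ R.⟨ point t j ⟩ R.* R.⟨ point s i ⟩ [ 1 ]
        lift-* s t i j = L.Q.trans 1 (R.⟨⟩-* _ _) (L.≈⇒≡ 1 (R.*-comm _ _))

      δ₁-small : ∀ s t i → (∀ j → minor s t i j K.≈ K.0#) → R₁.J 1 (δ₁ s t i)
      δ₁-small s t i all n with n ℕ.<? k
      ... | yes n<k = ≡.subst (λ m → R.J 1 (δ₁ s t i m)) (Fin.toℕ-fromℕ< n<k)
        (L.J-≡ 1 (δ₁-coefficient s t i (Fin.fromℕ< n<k)) (L.J-≡ 1 (R.⟨⟩-cong (all _)) L.⟨0⟩))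
      ... | no n≮k = R.J-+ 1 (term t s) (L.J-neg 1 (term s t))
        where
        term : ∀ s t → R.J 1 (((Y₁ E₁.⊙ point s) R₁.* R₁.⟨ point t i ⟩) n)
        term s t = R.J-cong 1 (R.sym (R.trans (G.*ₛ-const (Y₁ E₁.⊙ point s) _ n)
          (R.trans (R.*-congʳ (G.generic-⊙-above (point s) n (ℕ.≮⇒≥ n≮k))) (R.zeroˡ _)))) (L.J-0 1)

      δ₁-cancellable : ∀ s t i → ¬ (∀ j → minor s t i j K.≈ K.0#) → L₁.Cancellable (δ₁ s t i)
      δ₁-cancellable s t i = G.lowest-cancellable (λ j → minor s t i j K.≟ K.0#)
        (λ j ≈0 → L.J-≡ 1 (δ₁-coefficient s t i j) (L.J-≡ 1 (R.⟨⟩-cong ≈0) L.⟨0⟩))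
        (λ j ≉0 → L.≡-unit-cancellable (δ₁-coefficient s t i j) ≉0)

      Y₂-head : ∀ v → (Y₂ E₂.⊙ v) R₂.≈ S₁.const (Y₁ E₁.⊙ v)
      Y₂-head v zero = G₁.⊙-coefficient Y₂ v 0
      Y₂-head v (suc n) = R₁.trans (G₁.⊙-coefficient Y₂ v (suc n)) (E₁.0⊙ v)

      δ₂ : Fin (suc M) → Fin (suc M) → R₂.Carrier
      δ₂ s t = (Y₂ E₂.⊙ point s) R₂.* (R₂.- (Z₂ E₂.⊙ point t)) R₂.- (R₂.- (Z₂ E₂.⊙ point s)) R₂.* (Y₂ E₂.⊙ point t)

      δ₂-coefficient : ∀ s t i → δ₂ s t (toℕ i) R₁.≈ δ₁ s t i
      δ₂-coefficient s t i = R₁.trans (rearranged (toℕ i))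
        (R₁.+-cong (R₁.*-congˡ (G₁.generic-⊙ (point s) i)) (R₁.-‿cong (R₁.*-congˡ (G₁.generic-⊙ (point t) i))))
        where
        rearranged : ∀ n → δ₂ s t n R₁.≈ (Y₁ E₁.⊙ point t) R₁.* (Z₂ E₂.⊙ point s) n R₁.- (Y₁ E₁.⊙ point s) R₁.* (Z₂ E₂.⊙ point t) n
        rearranged n = R₁.trans
          (RingIdentities.determinant-neg R₂.commutativeRing (Y₂ E₂.⊙ point s) (Y₂ E₂.⊙ point t) (Z₂ E₂.⊙ point s) (Z₂ E₂.⊙ point t) n)
          (R₁.+-cong (term t s) (R₁.-‿cong (term s t)))
          where
          term : ∀ s t → ((Y₂ E₂.⊙ point s) R₂.* (Z₂ E₂.⊙ point t)) n R₁.≈ (Y₁ E₁.⊙ point s) R₁.* (Z₂ E₂.⊙ point t) n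
          term s t = R₁.trans (R₂.*-cong {Y₂ E₂.⊙ point s} {S₁.const (Y₁ E₁.⊙ point s)} {Z₂ E₂.⊙ point t} {Z₂ E₂.⊙ point t}
                         (Y₂-head (point s)) (R₂.refl {Z₂ E₂.⊙ point t}) n)
            (S₁.const-*ₛ (Y₁ E₁.⊙ point s) (Z₂ E₂.⊙ point t) n)

      δ₂-cancellable : ∀ s t → s ≢ t → L₂.Cancellable (δ₂ s t)
      δ₂-cancellable s t s≢t = G₁.lowest-cancellable (λ i → Fin.all? (λ j → minor s t i j K.≟ K.0#))
        (λ i all → L₁.J-≡ 1 (L₁.≈⇒≡ 1 (δ₂-coefficient s t i)) (δ₁-small s t i all))
        (λ i ¬all → L₁.cancellable-cong (R₁.sym {δ₂ s t (toℕ i)} (δ₂-coefficient s t i)) (δ₁-cancellable s t i ¬all))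
        (λ all → let i , j , ≉0 = distinct s t s≢t in ≉0 (all i j))

      X₃-head : ∀ v → (X₃ E₃.⊙ v) 0 R₂.≈ Z₂ E₂.⊙ v
      X₃-head v = G₂.⊙-coefficient X₃ v 0

      Y₃-head : ∀ v → (Y₃ E₃.⊙ v) 0 R₂.≈ Y₂ E₂.⊙ v
      Y₃-head v = G₂.⊙-coefficient Y₃ v 0

      x y : Fin (suc M) → R₃.Carrier
      x s = Y₃ E₃.⊙ point s
      y s = R₃.- (X₃ E₃.⊙ point s)

      x-cancellable : ∀ s → L₃.Cancellable (x s)
      x-cancellable s = S₂.series-cancellable 0 (λ _ ())
        (L₂.cancellable-cong (R₂.sym {x s 0} (Y₃-head (point s)))
          (S₁.series-cancellable 0 (λ _ ())
            (L₁.cancellable-cong (R₁.sym {(Y₂ E₂.⊙ point s) 0} (Y₂-head (point s) 0)) (Y₁-cancellable s))))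

      δ₃-cancellable : ∀ s t → s ≢ t → L₃.Cancellable (x s R₃.* y t R₃.- y s R₃.* x t)
      δ₃-cancellable s t s≢t = S₂.series-cancellable 0 (λ _ ())
        (L₂.cancellable-cong (R₂.sym {(x s R₃.* y t R₃.- y s R₃.* x t) 0} {δ₂ s t}
           (R₂.+-cong {(x s 0) R₂.* (y t 0)} (R₂.*-cong {x s 0} (Y₃-head (point s)) (R₂.-‿cong {(X₃ E₃.⊙ point t) 0} (X₃-head (point t))))
              (R₂.-‿cong {y s 0 R₂.* x t 0} (R₂.*-cong {y s 0} (R₂.-‿cong {(X₃ E₃.⊙ point s) 0} (X₃-head (point s))) (Y₃-head (point t))))))
          (δ₂-cancellable s t s≢t))

    -- Restrict the power sum to the line through two generic points; the resulting binary form of degree M has M + 1 zeros.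
    vanishes-everywhere : ∀ e (g : List (Vector K.Carrier k)) →
      (∀ s → VanishesAt e M g (point s)) → Vanishes e M g
    vanishes-everywhere e g vanishesAt A X = R.J-cong e coefficient (onLine M 0 0)
      where
      open GenericLine A X
      open BinaryForm A₃
      open Exp R₃.semiring using () renaming (_^_ to _^₃_)
      module Sum₃ = ListSum R₃.+-commutativeMonoid

      form : IsForm M (λ u v → E₃.powerSum M g (λ i → u R₃.* X₃ i R₃.+ v R₃.* Y₃ i))
      form = form-∑ M g (λ w → form-cong M
        (λ u v → Exp.^-congˡ R₃.semiring M {(λ i → u R₃.* X₃ i R₃.+ v R₃.* Y₃ i) E₃.⊙ w} (E₃.⊙-linear u v X₃ Y₃ w))
        (form-^ M (X₃ E₃.⊙ w) (Y₃ E₃.⊙ w)))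

      onPoint : ∀ s → R₃.J e (E₃.powerSum M g (λ i → x s R₃.* X₃ i R₃.+ y s R₃.* Y₃ i))
      onPoint s = vanishesAt s A₃ _ (R₃.J-cong 1 {R₃.0#}
        (R₃.sym {(λ i → x s R₃.* X₃ i R₃.+ y s R₃.* Y₃ i) E₃.⊙ point s} {R₃.0#}
          (R₃.trans {(λ i → x s R₃.* X₃ i R₃.+ y s R₃.* Y₃ i) E₃.⊙ point s} {x s R₃.* (X₃ E₃.⊙ point s) R₃.+ y s R₃.* (Y₃ E₃.⊙ point s)} {R₃.0#}
            (E₃.⊙-linear (x s) (y s) X₃ Y₃ (point s))
            (RingIdentities.incidence R₃.commutativeRing (x s) (X₃ E₃.⊙ point s))))
        (L₃.J-0 1))

      onLine : R₃.J e (E₃.powerSum M g X₃)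
      onLine = R₃.J-cong e
        (R₃.trans {eval (proj₁ form) R₃.1# R₃.0#} (R₃.sym {E₃.powerSum M g (λ i → R₃.1# R₃.* X₃ i R₃.+ R₃.0# R₃.* Y₃ i)} (proj₂ form R₃.1# R₃.0#))
          (Sum₃.∑-cong g λ w → Exp.^-congˡ R₃.semiring M {(λ i → R₃.1# R₃.* X₃ i R₃.+ R₃.0# R₃.* Y₃ i) E₃.⊙ w}
            (E₃.⊙-congˡ w (λ i → RingIdentities.first-coordinate R₃.commutativeRing (X₃ i) (Y₃ i)))))
        (form-vanishes e (proj₁ form) x y x-cancellable δ₃-cancellable
          (λ s → R₃.J-cong e (proj₂ form (x s) (y s)) (onPoint s)) R₃.1# R₃.0#)

      power : ∀ w → ((X₃ E₃.⊙ w) ^₃ M) M 0 0 R.≈ Exp._^_ R.semiring (X E.⊙ w) M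
      power w = R.trans
        (G₂.linear-^-top {X₃ E₃.⊙ w} (λ n → R₂.trans {(X₃ E₃.⊙ w) (suc (suc n))} (G₂.⊙-coefficient X₃ w (suc (suc n))) (E₂.0⊙ w)) M 0 0)
        (R.trans (G₁.^ₛ-head ((X₃ E₃.⊙ w) 1) M 0) (R.trans (G.^ₛ-head ((X₃ E₃.⊙ w) 1 0) M)
          (Exp.^-congˡ R.semiring M
            (R.trans (G₂.⊙-coefficient X₃ w 1 0 0) (R.trans (G₁.⊙-coefficient X₂ w 0 0) (G.⊙-coefficient (λ i → S.const (X i)) w 0))))))

      coefficient : E₃.powerSum M g X₃ M 0 0 R.≈ E.powerSum M g X
      coefficient = sumCoefficient g
        where
        sumCoefficient : ∀ g → E₃.powerSum M g X₃ M 0 0 R.≈ E.powerSum M g X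
        sumCoefficient [] = R.refl
        sumCoefficient (w ∷ g) = R.+-cong (power w) (sumCoefficient g)

  -- Sums over F and F ^ k

  element : Fin q → K.Carrier
  element = Inverse.from K.card

  index : K.Carrier → Fin q
  index = Inverse.to K.card

  element-index : ∀ a → element (index a) K.≈ a
  element-index = Inverse.strictlyInverseʳ K.card

  index-element : ∀ i → index (element i) ≡ i
  index-element = Inverse.strictlyInverseˡ K.card

  elements : List K.Carrier
  elements = List.tabulate element

  infix 4 _≈ᵥ_
  _≈ᵥ_ : ∀ {k} → Vector K.Carrier k → Vector K.Carrier k → Set ℓ
  v ≈ᵥ w = ∀ i → v i K.≈ w i

  vecs : ∀ k → List (Vector K.Carrier k)
  vecs zero = Vector.[] ∷ []
  vecs (suc k) = concatMap (λ a → List.map (a Vector.∷_) (vecs k)) elements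

  ∷-cong : ∀ {k a b} {v w : Vector K.Carrier k} → a K.≈ b → v ≈ᵥ w → (a Vector.∷ v) ≈ᵥ (b Vector.∷ w)
  ∷-cong a≈b v≈w zero = a≈b
  ∷-cong a≈b v≈w (suc i) = v≈w i

  ∷-head-tail : ∀ {k} (v : Vector K.Carrier (suc k)) → (Vector.head v Vector.∷ Vector.tail v) ≈ᵥ v
  ∷-head-tail v zero = K.refl
  ∷-head-tail v (suc i) = K.refl

  module FieldSum {a b} (M : CommutativeMonoid a b) where
    open CommutativeMonoid M
    open Sum M using (sum; sum-cong-≋; sum-remove; sum-permute; sum-replicate)
    open MonoidMult monoid using () renaming (_×_ to _·_; ×-assocˡ to ·-assocˡ)
    open ListSum M

    when : ∀ {r} {P : Set r} → Dec P → Carrier → Carrier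
    when (yes _) x = x
    when (no _) x = ε

    private
      sum-ε : ∀ {n} (t : Vector Carrier n) → (∀ i → t i ≈ ε) → sum t ≈ ε
      sum-ε {zero} t t≈ε = refl
      sum-ε {suc n} t t≈ε = trans (∙-cong (t≈ε zero) (sum-ε (t ∘ suc) (t≈ε ∘ suc))) (identityˡ ε)

      sum-single : ∀ {n} (t : Vector Carrier n) i → (∀ j → j ≢ i → t j ≈ ε) → sum t ≈ t i
      sum-single {suc n} t i t≈ε = trans (sum-remove {i = i} t)
        (trans (∙-congˡ (sum-ε _ (λ j → t≈ε (punchIn i j) (Fin.punchInᵢ≢i i j)))) (identityʳ _))

    ∑F : (K.Carrier → Carrier) → Carrier
    ∑F = ∑ elements

    ∑F-const : ∀ x → ∑F (λ _ → x) ≈ q · x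
    ∑F-const x = trans (∑-tabulate element (λ _ → x)) (sum-replicate q)

    ∑F-single : ∀ {h} → (∀ {a b} → a K.≈ b → h a ≈ h b) → ∀ a → (∀ b → b K.≉ a → h b ≈ ε) → ∑F h ≈ h a
    ∑F-single {h} h-cong a h≈ε = trans (∑-tabulate element h) (trans
      (sum-single (h ∘ element) (index a) (λ j j≢ → h≈ε (element j)
        (λ j≈a → j≢ (≡.trans (≡.sym (index-element j)) (Inverse.to-cong K.card j≈a)))))
      (h-cong (element-index a)))

    ∑F-reindex : ∀ {h} → (∀ {a b} → a K.≈ b → h a ≈ h b) → ∀ (φ ψ : K.Carrier → K.Carrier) →
      (∀ {a b} → a K.≈ b → φ a K.≈ φ b) → (∀ {a b} → a K.≈ b → ψ a K.≈ ψ b) →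
      (∀ a → φ (ψ a) K.≈ a) → (∀ a → ψ (φ a) K.≈ a) → ∑F h ≈ ∑F (h ∘ φ)
    ∑F-reindex {h} h-cong φ ψ φ-cong ψ-cong φψ ψφ = trans (∑-tabulate element h) (trans
      (sum-permute (h ∘ element) (permutation (index ∘ φ ∘ element) (index ∘ ψ ∘ element) (inverse φ ψ φ-cong φψ) (inverse ψ φ ψ-cong ψφ)))
      (trans (sum-cong-≋ (λ i → h-cong (element-index (φ (element i))))) (sym (∑-tabulate element (h ∘ φ)))))
      where
      inverse : ∀ (φ ψ : K.Carrier → K.Carrier) → (∀ {a b} → a K.≈ b → φ a K.≈ φ b) → (∀ a → φ (ψ a) K.≈ a) →
                ∀ i → index (φ (element (index (ψ (element i))))) ≡ i
      inverse φ ψ φ-cong φψ i = ≡.trans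
        (Inverse.to-cong K.card (K.trans (φ-cong (element-index (ψ (element i)))) (φψ (element i))))
        (index-element i)

    ∑V : ∀ k → (Vector K.Carrier k → Carrier) → Carrier
    ∑V k = ∑ (vecs k)

    Congruent : ∀ {k} → (Vector K.Carrier k → Carrier) → Set (c ⊔ ℓ ⊔ b)
    Congruent h = ∀ {v w} → v ≈ᵥ w → h v ≈ h w

    ∑V-suc : ∀ k (h : Vector K.Carrier (suc k) → Carrier) → ∑V (suc k) h ≈ ∑F (λ a → ∑V k (λ v → h (a Vector.∷ v)))
    ∑V-suc k h = trans (∑-concatMap _ elements h) (∑-cong elements (λ a → ∑-map (a Vector.∷_) (vecs k) h))

    ∑V-const : ∀ k x → ∑V k (λ _ → x) ≈ (q ℕ.^ k) · x
    ∑V-const zero x = refl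
    ∑V-const (suc k) x = trans (∑V-suc k (λ _ → x)) (trans (∑-cong elements (λ _ → ∑V-const k x))
      (trans (∑F-const _) (·-assocˡ x q (q ℕ.^ k))))

    ∑V-single : ∀ {k h} → Congruent h → ∀ (w : Vector K.Carrier k) → (∀ v → ¬ v ≈ᵥ w → h v ≈ ε) → ∑V k h ≈ h w
    ∑V-single {zero} h-cong w h≈ε = trans (identityʳ _) (h-cong (λ ()))
    ∑V-single {suc k} {h} h-cong w h≈ε = trans (∑V-suc k h) (trans
      (∑F-single (λ a≈b → ∑-cong (vecs k) (λ v → h-cong (∷-cong a≈b (λ _ → K.refl)))) (w zero)
        (λ a a≉ → trans (∑-cong (vecs k) (λ v → h≈ε _ (λ eq → a≉ (eq zero)))) (∑-ε (vecs k))))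
      (trans (∑V-single (λ eq → h-cong (∷-cong K.refl eq)) (w ∘ suc) (λ v v≉ → h≈ε _ (λ eq → v≉ (eq ∘ suc))))
             (h-cong (∷-head-tail w))))

    ∑V-reindex : ∀ {k h} → Congruent h → ∀ (φ ψ : Fin k → K.Carrier → K.Carrier) →
      (∀ i {a b} → a K.≈ b → φ i a K.≈ φ i b) → (∀ i {a b} → a K.≈ b → ψ i a K.≈ ψ i b) →
      (∀ i a → φ i (ψ i a) K.≈ a) → (∀ i a → ψ i (φ i a) K.≈ a) → ∑V k h ≈ ∑V k (λ v → h (λ i → φ i (v i)))
    ∑V-reindex {zero} h-cong φ ψ φ-cong ψ-cong φψ ψφ = ∙-congʳ (h-cong (λ ()))
    ∑V-reindex {suc k} {h} h-cong φ ψ φ-cong ψ-cong φψ ψφ = trans (∑V-suc k h) (trans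
      (trans
        (∑F-reindex (λ a≈b → ∑-cong (vecs k) (λ v → h-cong (∷-cong a≈b (λ _ → K.refl)))) (φ zero) (ψ zero) (φ-cong zero) (ψ-cong zero) (φψ zero) (ψφ zero))
        (∑-cong elements (λ a → trans
          (∑V-reindex (λ eq → h-cong (∷-cong K.refl eq)) (φ ∘ suc) (ψ ∘ suc) (φ-cong ∘ suc) (ψ-cong ∘ suc) (φψ ∘ suc) (ψφ ∘ suc))
          (∑-cong (vecs k) (λ v → h-cong (λ { zero → K.refl ; (suc i) → K.refl }))))))
      (sym (∑V-suc k (λ v → h (λ i → φ i (v i))))))

    ∑V-translate : ∀ {k h} → Congruent h → ∀ (w : Vector K.Carrier k) → ∑V k h ≈ ∑V k (λ v → h (λ i → v i K.+ w i))
    ∑V-translate {k} {h} h-cong w = ∑V-reindex {k} {h} h-cong (λ i a → a K.+ w i) (λ i a → a K.+ K.- w i)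
      (λ i → K.+-congʳ) (λ i → K.+-congʳ) (λ i a → +-- a (w i)) (λ i a → -+- a (w i))
      where
      +-- : ∀ a b → (a K.+ K.- b) K.+ b K.≈ a
      +-- a b = K.trans (K.+-assoc a (K.- b) b) (K.trans (K.+-congˡ (K.-‿inverseˡ b)) (K.+-identityʳ a))
      -+- : ∀ a b → (a K.+ b) K.+ K.- b K.≈ a
      -+- a b = K.trans (K.+-assoc a b (K.- b)) (K.trans (K.+-congˡ (K.-‿inverseʳ b)) (K.+-identityʳ a))

  *-cancelˡ : ∀ {a} b b′ → a K.≉ K.0# → a K.* b K.≈ a K.* b′ → b K.≈ b′
  *-cancelˡ {a} b b′ a≉0 eq with K.inverse a a≉0
  ... | a⁻¹ , aa⁻¹≈1 = K.trans (K.sym (undo b)) (K.trans (K.*-congˡ eq) (undo b′))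
    where
    undo : ∀ b → a⁻¹ K.* (a K.* b) K.≈ b
    undo b = K.trans (K.sym (K.*-assoc _ _ _)) (K.trans (K.*-congʳ (K.trans (K.*-comm _ _) aa⁻¹≈1)) (K.*-identityˡ b))

  *-nonzero : ∀ {a b} → a K.≉ K.0# → b K.≉ K.0# → a K.* b K.≉ K.0#
  *-nonzero {a} {b} a≉0 b≉0 ab≈0 = b≉0 (*-cancelˡ b K.0# a≉0 (K.trans ab≈0 (K.sym (K.zeroʳ a))))

  1≉0 : K.1# K.≉ K.0#
  1≉0 1≈0 = K.0≉1 (K.sym 1≈0)

  module _ where
    private
      module Product = FieldSum K.*-commutativeMonoid
      open Product using (when)
      module List* = ListSum K.*-commutativeMonoid

      unit : K.Carrier → K.Carrier
      unit b = when (¬? (b K.≟ K.0#)) b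

      when-cong : ∀ {r s} {P : Set r} {Q : Set s} (P? : Dec P) (Q? : Dec Q) → (P → Q) → (Q → P) → ∀ {x y} → x K.≈ y → when P? x K.≈ when Q? y
      when-cong (yes p) (yes q) f g x≈y = x≈y
      when-cong (no ¬p) (no ¬q) f g x≈y = K.refl
      when-cong (yes p) (no ¬q) f g x≈y = contradiction (f p) ¬q
      when-cong (no ¬p) (yes q) f g x≈y = contradiction (g q) ¬p

      ≉0-cong : ∀ {a b} → a K.≈ b → a K.≉ K.0# → b K.≉ K.0#
      ≉0-cong a≈b a≉0 b≈0 = a≉0 (K.trans a≈b b≈0)

      unit-cong : ∀ {a b} → a K.≈ b → unit a K.≈ unit b
      unit-cong {a} {b} a≈b = when-cong (¬? (a K.≟ K.0#)) (¬? (b K.≟ K.0#)) (≉0-cong a≈b) (≉0-cong (K.sym a≈b)) a≈b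

      unit≉0 : ∀ b → unit b K.≉ K.0#
      unit≉0 b with b K.≟ K.0#
      ... | yes _ = 1≉0
      ... | no b≉0 = b≉0

      ∏≉0 : ∀ (xs : List K.Carrier) {h} → (∀ b → h b K.≉ K.0#) → List*.∑ xs h K.≉ K.0#
      ∏≉0 [] h≉0 = 1≉0
      ∏≉0 (x ∷ xs) h≉0 = *-nonzero (h≉0 x) (∏≉0 xs h≉0)

      ^q-unit : ∀ a → a K.≉ K.0# → a ^K q K.≈ a
      ^q-unit a a≉0 with K.inverse a a≉0
      ... | a⁻¹ , aa⁻¹≈1 = begin
        a ^K q                                                           ≈⟨ Product.∑F-const a ⟨
        Product.∑F (λ _ → a)                                            ≈⟨ List*.∑-cong elements split ⟩
        Product.∑F (λ b → scale b K.* rest b)                           ≈⟨ List*.∑-∙ elements scale rest ⟩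
        Product.∑F scale K.* Product.∑F rest                            ≈⟨ K.*-cong ∏scale≈1 (K.trans (Product.∑F-single rest-cong K.0# rest-off) rest-0) ⟩
        K.1# K.* a                                                      ≈⟨ K.*-identityˡ a ⟩
        a ∎
        where
        open SetoidReasoning K.setoid
        scale rest : K.Carrier → K.Carrier
        scale b = when (¬? (b K.≟ K.0#)) a
        rest b = when (b K.≟ K.0#) a

        split : ∀ b → a K.≈ scale b K.* rest b
        split b with b K.≟ K.0#
        ... | yes _ = K.sym (K.*-identityˡ a)
        ... | no _ = K.sym (K.*-identityʳ a)

        rest-cong : ∀ {b d} → b K.≈ d → rest b K.≈ rest d
        rest-cong {b} {d} b≈d = when-cong (b K.≟ K.0#) (d K.≟ K.0#) (K.trans (K.sym b≈d)) (K.trans b≈d) K.refl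

        rest-off : ∀ b → b K.≉ K.0# → rest b K.≈ K.1#
        rest-off b b≉0 with b K.≟ K.0#
        ... | yes b≈0 = contradiction b≈0 b≉0
        ... | no _ = K.refl

        rest-0 : rest K.0# K.≈ a
        rest-0 with K.0# K.≟ K.0#
        ... | yes _ = K.refl
        ... | no 0≉0 = contradiction K.refl 0≉0

        unit-* : ∀ b → unit (a K.* b) K.≈ scale b K.* unit b
        unit-* b with b K.≟ K.0# | (a K.* b) K.≟ K.0#
        ... | yes b≈0 | yes _ = K.sym (K.*-identityˡ _)
        ... | yes b≈0 | no ab≉0 = contradiction (K.trans (K.*-congˡ b≈0) (K.zeroʳ a)) ab≉0
        ... | no b≉0 | yes ab≈0 = contradiction ab≈0 (*-nonzero a≉0 b≉0)
        ... | no _ | no _ = K.refl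

        a*-inverse : ∀ {u v} → u K.* v K.≈ K.1# → ∀ b → u K.* (v K.* b) K.≈ b
        a*-inverse uv≈1 b = K.trans (K.sym (K.*-assoc _ _ _)) (K.trans (K.*-congʳ uv≈1) (K.*-identityˡ b))

        ∏scale≈1 : Product.∑F scale K.≈ K.1#
        ∏scale≈1 = *-cancelˡ _ _ (∏≉0 elements unit≉0) (begin
          Product.∑F unit K.* Product.∑F scale   ≈⟨ K.*-comm _ _ ⟩
          Product.∑F scale K.* Product.∑F unit   ≈⟨ List*.∑-∙ elements scale unit ⟨
          Product.∑F (λ b → scale b K.* unit b)  ≈⟨ List*.∑-cong elements unit-* ⟨
          Product.∑F (λ b → unit (a K.* b))      ≈⟨ Product.∑F-reindex unit-cong (a K.*_) (a⁻¹ K.*_) K.*-congˡ K.*-congˡ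
                                                      (a*-inverse aa⁻¹≈1) (a*-inverse (K.trans (K.*-comm _ _) aa⁻¹≈1)) ⟨
          Product.∑F unit                        ≈⟨ K.*-identityʳ _ ⟨
          Product.∑F unit K.* K.1#               ∎)

    ^q : .{{NonZero q}} → ∀ a → a ^K q K.≈ a
    ^q a with a K.≟ K.0#
    ... | no a≉0 = ^q-unit a a≉0
    ... | yes a≈0 = K.trans (Exp.^-congˡ K.semiring q a≈0) (K.trans (0^ q) (K.sym a≈0))
      where
      0^ : ∀ n → .{{NonZero n}} → K.0# ^K n K.≈ K.0#
      0^ (suc n) = K.zeroˡ _

  q·1≈0 : q ·K K.1# K.≈ K.0#
  q·1≈0 = +-identityʳ-unique _ _ (K.sym (begin
    ∑F (λ b → b)                       ≈⟨ ∑F-reindex (λ eq → eq) (K._+ K.1#) (K._- K.1#) K.+-congʳ K.+-congʳ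
                                            (λ a → K.trans (K.+-assoc a _ _) (K.trans (K.+-congˡ (K.-‿inverseˡ _)) (K.+-identityʳ a)))
                                            (λ a → K.trans (K.+-assoc a _ _) (K.trans (K.+-congˡ (K.-‿inverseʳ _)) (K.+-identityʳ a))) ⟩
    ∑F (λ b → b K.+ K.1#)              ≈⟨ ∑-∙ elements (λ b → b) (λ _ → K.1#) ⟩
    ∑F (λ b → b) K.+ ∑F (λ _ → K.1#)   ≈⟨ K.+-congˡ (∑F-const K.1#) ⟩
    ∑F (λ b → b) K.+ q ·K K.1#          ∎))
    where
    open SetoidReasoning K.setoid
    open FieldSum K.+-commutativeMonoid
    open ListSum K.+-commutativeMonoid
    open import Algebra.Properties.Ring K.ring using (+-identityʳ-unique)

  module Characteristic (f : ℕ) (q≡p^f : q ≡ p ℕ.^ f) where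

    p·1≈0 : p ·K K.1# K.≈ K.0#
    p·1≈0 with (p ·K K.1#) K.≟ K.0#
    ... | yes p1≈0 = p1≈0
    ... | no p1≉0 = contradiction (≡.subst (λ n → n ·K K.1# K.≈ K.0#) q≡p^f q·1≈0) (p^f≉0 f)
      where
      p^f≉0 : ∀ f → (p ℕ.^ f) ·K K.1# K.≉ K.0#
      p^f≉0 zero eq = 1≉0 (K.trans (K.sym (K.+-identityʳ _)) eq)
      p^f≉0 (suc f) eq = *-nonzero p1≉0 (p^f≉0 f) (K.trans (K.sym (Mult.×1-homo-* K.semiring p (p ℕ.^ f))) eq)

    multiple-of-p≈0 : ∀ n → (n ℕ.* p) ·K K.1# K.≈ K.0#
    multiple-of-p≈0 n = K.trans (Mult.×1-homo-* K.semiring n p) (K.trans (K.*-congˡ p·1≈0) (K.zeroʳ _))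

    p∣-from-≈0 : ∀ n → n ·K K.1# K.≈ K.0# → p ∣ n
    p∣-from-≈0 n n≈0 with n % p in eq
      where instance _ = prime⇒nonZero p-prime
    ... | zero = m%n≡0⇒n∣m n p eq
      where instance _ = prime⇒nonZero p-prime
    ... | suc r = contradiction (1≈0 (coprime-Bézout (prime⇒coprime p-prime r<p))) 1≉0
      where
      instance _ = prime⇒nonZero p-prime
      r<p : suc r < p
      r<p = ≡.subst (_< p) eq (m%n<n n p)
      r≈0 : suc r ·K K.1# K.≈ K.0#
      r≈0 = K.trans (K.sym (K.+-identityʳ _)) (K.trans (K.+-congˡ (K.sym (multiple-of-p≈0 (n / p))))
        (K.trans (K.sym (Mult.×-homo-+ K.semiring K.1# (suc r) (n / p ℕ.* p)))
          (≡.subst (λ m → m ·K K.1# K.≈ K.0#) (≡.trans (m≡m%n+[m/n]*n n p) (≡.cong (ℕ._+ n / p ℕ.* p) eq)) n≈0)))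
      multiple-of-r≈0 : ∀ m → (m ℕ.* suc r) ·K K.1# K.≈ K.0#
      multiple-of-r≈0 m = K.trans (Mult.×1-homo-* K.semiring m (suc r)) (K.trans (K.*-congˡ r≈0) (K.zeroʳ _))
      difference : ∀ m n → 1 ℕ.+ m ≡ n → m ·K K.1# K.≈ K.0# → n ·K K.1# K.≈ K.0# → K.1# K.≈ K.0#
      difference m n eq m≈0 n≈0 = K.trans (K.sym (K.+-identityʳ _)) (K.trans (K.+-congˡ (K.sym m≈0))
        (≡.subst (λ k → k ·K K.1# K.≈ K.0#) (≡.sym eq) n≈0))
      1≈0 : Bézout.Identity 1 p (suc r) → K.1# K.≈ K.0#
      1≈0 (Bézout.+- x y eq) = difference (y ℕ.* suc r) (x ℕ.* p) eq (multiple-of-r≈0 y) (multiple-of-p≈0 x)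
      1≈0 (Bézout.-+ x y eq) = difference (x ℕ.* p) (y ℕ.* suc r) eq (multiple-of-p≈0 x) (multiple-of-r≈0 y)

  instance
    p-nonZero : NonZero p
    p-nonZero = prime⇒nonZero p-prime

    q-nonZero : NonZero q
    q-nonZero = ≡.subst NonZero (≡.sym q≡p^f) (ℕ.m^n≢0 p f)

  f′ q′ : ℕ
  f′ = ℕ.pred f
  q′ = ℕ.pred q

  q≡1+q′ : q ≡ suc q′
  q≡1+q′ = ≡.sym (ℕ.suc-pred q)

  q≡p*p^f′ : q ≡ p ℕ.^ suc f′
  q≡p*p^f′ = ≡.trans q≡p^f (≡.cong (p ℕ.^_) (≡.sym (ℕ.suc-pred f {{ℕ.>-nonZero f≥1}})))

  p≤q : p ≤ q
  p≤q = ≡.subst (p ≤_) (≡.sym q≡p*p^f′) (ℕ.m≤m*n p (p ℕ.^ f′) {{ℕ.m^n≢0 p f′}})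

  2≤q : 2 ≤ q
  2≤q = ℕ.≤-trans (ℕ.nonTrivial⇒n>1 p {{prime⇒nonTrivial p-prime}}) p≤q

  instance
    q′-nonZero : NonZero q′
    q′-nonZero = ℕ.>-nonZero (ℕ.≤-pred (ℕ.≤-trans 2≤q (ℕ.≤-reflexive q≡1+q′)))

  module FrobeniusPowers {a b} (R : CommutativeRing a b) where
    open CommutativeRing R hiding (zero)
    open Exp semiring using (_^_; ^-assocʳ; ^-congʳ)
    open Mult semiring using (×-assoc-*; ×-congʳ) renaming (_×_ to _·_)
    open Modulo R (p · 1#) public

    ^p-+ : ∀ x y → (x + y) ^ p ~ x ^ p + y ^ p
    ^p-+ x y = let z , eq = Freshman.freshman R p-prime x y in
      z , trans eq (+-congˡ (sym (trans (×-assoc-* p 1# z) (×-congʳ p (*-identityˡ z)))))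

    ^p^-+ : ∀ i x y → (x + y) ^ (p ℕ.^ i) ~ x ^ (p ℕ.^ i) + y ^ (p ℕ.^ i)
    ^p^-+ zero x y = ~-reflexive (trans (*-identityʳ _) (sym (+-cong (*-identityʳ x) (*-identityʳ y))))
    ^p^-+ (suc i) x y = ~-trans (~-reflexive (split (x + y))) (~-trans (~-^ p (^p^-+ i x y))
      (~-trans (^p-+ _ _) (~-reflexive (sym (+-cong (split x) (split y))))))
      where
      split : ∀ x → x ^ (p ℕ.^ suc i) ≈ (x ^ (p ℕ.^ i)) ^ p
      split x = trans (^-congʳ x (ℕ.*-comm p (p ℕ.^ i))) (sym (^-assocʳ x (p ℕ.^ i) p))

  -- The monoid ring of F

  infixl 6 _⊕_
  infixl 7 _⊗_
  infix 8 ⊖_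

  data Term : Set c where
    ‹_› : K.Carrier → Term
    _⊕_ _⊗_ : Term → Term → Term
    ⊖_ : Term → Term
    𝟘 𝟙 : Term

  -- The monoid ring ℤ[F]: a term is identified with the operator it induces on functions F → ℤ, where ‹ a › acts by translation.
  act : Term → (K.Carrier → ℤ) → K.Carrier → ℤ
  act ‹ a › h x = h (a K.* x)
  act (s ⊕ t) h x = act s h x ℤ.+ act t h x
  act (s ⊗ t) h = act s (act t h)
  act (⊖ s) h x = ℤ.- act s h x
  act 𝟘 h x = + 0
  act 𝟙 h = h

  Respects : (K.Carrier → ℤ) → Set (c ⊔ ℓ)
  Respects h = ∀ {x y} → x K.≈ y → h x ≡ h y

  infix 4 _≈ₜ_
  record _≈ₜ_ (s t : Term) : Set (c ⊔ ℓ) where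
    constructor agree
    field at : ∀ h → Respects h → ∀ x → act s h x ≡ act t h x
  open _≈ₜ_

  act-respects : ∀ s {h} → Respects h → Respects (act s h)
  act-respects ‹ a › h-resp x≈y = h-resp (K.*-congˡ x≈y)
  act-respects (s ⊕ t) h-resp x≈y = ≡.cong₂ ℤ._+_ (act-respects s h-resp x≈y) (act-respects t h-resp x≈y)
  act-respects (s ⊗ t) h-resp = act-respects s (act-respects t h-resp)
  act-respects (⊖ s) h-resp x≈y = ≡.cong ℤ.-_ (act-respects s h-resp x≈y)
  act-respects 𝟘 h-resp x≈y = ≡.refl
  act-respects 𝟙 h-resp = h-resp

  act-cong : ∀ s {h h′} → (∀ x → h x ≡ h′ x) → ∀ x → act s h x ≡ act s h′ x
  act-cong ‹ a › eq x = eq _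
  act-cong (s ⊕ t) eq x = ≡.cong₂ ℤ._+_ (act-cong s eq x) (act-cong t eq x)
  act-cong (s ⊗ t) eq = act-cong s (act-cong t eq)
  act-cong (⊖ s) eq x = ≡.cong ℤ.-_ (act-cong s eq x)
  act-cong 𝟘 eq x = ≡.refl
  act-cong 𝟙 eq = eq

  act-+ : ∀ s h h′ x → act s (λ y → h y ℤ.+ h′ y) x ≡ act s h x ℤ.+ act s h′ x
  act-+ ‹ a › h h′ x = ≡.refl
  act-+ (s ⊕ t) h h′ x = ≡.trans (≡.cong₂ ℤ._+_ (act-+ s h h′ x) (act-+ t h h′ x)) (interchange (act s h x) (act s h′ x) (act t h x) (act t h′ x))
    where open import Algebra.Properties.CommutativeSemigroup ℤ.+-commutativeSemigroup using (interchange)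
  act-+ (s ⊗ t) h h′ x = ≡.trans (act-cong s (act-+ t h h′) x) (act-+ s _ _ x)
  act-+ (⊖ s) h h′ x = ≡.trans (≡.cong ℤ.-_ (act-+ s h h′ x)) (ℤ.neg-distrib-+ (act s h x) (act s h′ x))
  act-+ 𝟘 h h′ x = ≡.refl
  act-+ 𝟙 h h′ x = ≡.refl

  act-neg : ∀ s h x → act s (λ y → ℤ.- h y) x ≡ ℤ.- act s h x
  act-neg ‹ a › h x = ≡.refl
  act-neg (s ⊕ t) h x = ≡.trans (≡.cong₂ ℤ._+_ (act-neg s h x) (act-neg t h x)) (≡.sym (ℤ.neg-distrib-+ (act s h x) (act t h x)))
  act-neg (s ⊗ t) h x = ≡.trans (act-cong s (act-neg t h) x) (act-neg s _ x)
  act-neg (⊖ s) h x = ≡.cong ℤ.-_ (act-neg s h x)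
  act-neg 𝟘 h x = ≡.refl
  act-neg 𝟙 h x = ≡.refl

  act-0 : ∀ s x → act s (λ _ → + 0) x ≡ + 0
  act-0 ‹ a › x = ≡.refl
  act-0 (s ⊕ t) x = ≡.cong₂ ℤ._+_ (act-0 s x) (act-0 t x)
  act-0 (s ⊗ t) x = ≡.trans (act-cong s (act-0 t) x) (act-0 s x)
  act-0 (⊖ s) x = ≡.cong ℤ.-_ (act-0 s x)
  act-0 𝟘 x = ≡.refl
  act-0 𝟙 x = ≡.refl

  act-translate : ∀ t a h → Respects h → ∀ x → act t (λ y → h (a K.* y)) x ≡ act t h (a K.* x)
  act-translate ‹ b › a h h-resp x = h-resp (K.trans (K.sym (K.*-assoc a b x)) (K.trans (K.*-congʳ (K.*-comm a b)) (K.*-assoc b a x)))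
  act-translate (s ⊕ t) a h h-resp x = ≡.cong₂ ℤ._+_ (act-translate s a h h-resp x) (act-translate t a h h-resp x)
  act-translate (s ⊗ t) a h h-resp x = ≡.trans (act-cong s (act-translate t a h h-resp) x) (act-translate s a (act t h) (act-respects t h-resp) x)
  act-translate (⊖ s) a h h-resp x = ≡.cong ℤ.-_ (act-translate s a h h-resp x)
  act-translate 𝟘 a h h-resp x = ≡.refl
  act-translate 𝟙 a h h-resp x = ≡.refl

  act-comm : ∀ s t h → Respects h → ∀ x → act s (act t h) x ≡ act t (act s h) x
  act-comm ‹ a › t h h-resp x = ≡.sym (act-translate t a h h-resp x)
  act-comm (s ⊕ s′) t h h-resp x = ≡.trans (≡.cong₂ ℤ._+_ (act-comm s t h h-resp x) (act-comm s′ t h h-resp x)) (≡.sym (act-+ t _ _ x))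
  act-comm (s ⊗ s′) t h h-resp x = ≡.trans (act-cong s (act-comm s′ t h h-resp) x) (act-comm s t (act s′ h) (act-respects s′ h-resp) x)
  act-comm (⊖ s) t h h-resp x = ≡.trans (≡.cong ℤ.-_ (act-comm s t h h-resp x)) (≡.sym (act-neg t _ x))
  act-comm 𝟘 t h h-resp x = ≡.sym (act-0 t x)
  act-comm 𝟙 t h h-resp x = ≡.refl

  termRing : CommutativeRing c (c ⊔ ℓ)
  termRing = record
    { _≈_ = _≈ₜ_
    ; _+_ = _⊕_
    ; _*_ = _⊗_
    ; -_ = ⊖_
    ; 0# = 𝟘
    ; 1# = 𝟙
    ; isCommutativeRing = record
      { isRing = record
        { +-isAbelianGroup = record
          { isGroup = record
            { isMonoid = record
              { isSemigroup = record
                { isMagma = record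
                  { isEquivalence = record
                    { refl = agree λ h _ x → ≡.refl
                    ; sym = λ e → agree λ h r x → ≡.sym (at e h r x)
                    ; trans = λ e e′ → agree λ h r x → ≡.trans (at e h r x) (at e′ h r x)
                    }
                  ; ∙-cong = λ e e′ → agree λ h r x → ≡.cong₂ ℤ._+_ (at e h r x) (at e′ h r x)
                  }
                ; assoc = λ s t u → agree λ h r x → ℤ.+-assoc (act s h x) _ _
                }
              ; identity = (λ s → agree λ h r x → ℤ.+-identityˡ _) , (λ s → agree λ h r x → ℤ.+-identityʳ _)
              }
            ; inverse = (λ s → agree λ h r x → ℤ.+-inverseˡ (act s h x)) , (λ s → agree λ h r x → ℤ.+-inverseʳ (act s h x))
            ; ⁻¹-cong = λ e → agree λ h r x → ≡.cong ℤ.-_ (at e h r x)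
            }
          ; comm = λ s t → agree λ h r x → ℤ.+-comm (act s h x) _
          }
        ; *-cong = λ {s} {s′} {t} {t′} e e′ → agree λ h r x →
            ≡.trans (act-cong s (at e′ h r) x) (at e (act t′ h) (act-respects t′ r) x)
        ; *-assoc = λ s t u → agree λ h r x → ≡.refl
        ; *-identity = (λ s → agree λ h r x → ≡.refl) , (λ s → agree λ h r x → ≡.refl)
        ; distrib = (λ s t u → agree λ h r x → act-+ s (act t h) (act u h) x) , (λ s t u → agree λ h r x → ≡.refl)
        }
      ; *-comm = λ s t → agree (act-comm s t)
      }
    }

  module T = CommutativeRing termRing
  open Mult T.semiring using () renaming (_×_ to _·ₜ_)
  open Exp T.semiring using () renaming (_^_ to _^ₜ_)

  π : Term → K.Carrier
  π ‹ a › = a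
  π (s ⊕ t) = π s K.+ π t
  π (s ⊗ t) = π s K.* π t
  π (⊖ s) = K.- π s
  π 𝟘 = K.0#
  π 𝟙 = K.1#

  module _ where
    open RingSolver K.commutativeRing
    open RingSolver.IntegerEmbedding K.commutativeRing
    open FieldSum K.+-commutativeMonoid
    open ListSum K.+-commutativeMonoid
    open SetoidReasoning K.setoid

    private
      -- For h a = δ a this expresses π s through the operator of s alone.
      weighted : (K.Carrier → K.Carrier → ℤ) → K.Carrier → K.Carrier
      weighted h x = ∑F (λ a → ⟦ h a x ⟧ K.* a)

      weighted-act : ∀ s h d → (∀ x → weighted h x K.≈ d K.* x) → ∀ x → weighted (λ a → act s (h a)) x K.≈ π s K.* d K.* x
      weighted-act ‹ b › h d eq x = K.trans (eq (b K.* x)) (solve 3 (λ b d x → d :* (b :* x) := b :* d :* x) K.refl b d x)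
      weighted-act (s ⊕ t) h d eq x = begin
        weighted (λ a → act (s ⊕ t) (h a)) x
          ≈⟨ ∑-cong elements (λ a → K.trans (K.*-congʳ (+-homo (act s (h a) x) (act t (h a) x))) (K.distribʳ _ _ _)) ⟩
        ∑F (λ a → ⟦ act s (h a) x ⟧ K.* a K.+ ⟦ act t (h a) x ⟧ K.* a)
          ≈⟨ ∑-∙ elements _ _ ⟩
        weighted (λ a → act s (h a)) x K.+ weighted (λ a → act t (h a)) x
          ≈⟨ K.+-cong (weighted-act s h d eq x) (weighted-act t h d eq x) ⟩
        π s K.* d K.* x K.+ π t K.* d K.* x
          ≈⟨ solve 4 (λ s t d x → s :* d :* x :+ t :* d :* x := (s :+ t) :* d :* x) K.refl (π s) (π t) d x ⟩
        (π s K.+ π t) K.* d K.* x ∎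
      weighted-act (s ⊗ t) h d eq x = K.trans
        (weighted-act s (λ a → act t (h a)) (π t K.* d) (weighted-act t h d eq) x)
        (solve 4 (λ s t d x → s :* (t :* d) :* x := s :* t :* d :* x) K.refl (π s) (π t) d x)
      weighted-act (⊖ s) h d eq x = begin
        weighted (λ a → act (⊖ s) (h a)) x
          ≈⟨ ∑-cong elements (λ a → K.trans (K.*-congʳ (-‿homo (act s (h a) x))) (solve 2 (λ u a → (:- u) :* a := (:- con (+ 1)) :* (u :* a)) K.refl _ a)) ⟩
        ∑F (λ a → (K.- K.1#) K.* (⟦ act s (h a) x ⟧ K.* a))
          ≈⟨ ∑-*ˡ elements _ _ ⟩
        (K.- K.1#) K.* weighted (λ a → act s (h a)) x
          ≈⟨ K.*-congˡ (weighted-act s h d eq x) ⟩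
        (K.- K.1#) K.* (π s K.* d K.* x)
          ≈⟨ solve 3 (λ s d x → (:- con (+ 1)) :* (s :* d :* x) := (:- s) :* d :* x) K.refl (π s) d x ⟩
        (K.- π s) K.* d K.* x ∎
        where
        ∑-*ˡ : ∀ xs u (g : K.Carrier → K.Carrier) → ∑ xs (λ a → u K.* g a) K.≈ u K.* ∑ xs g
        ∑-*ˡ [] u g = K.sym (K.zeroʳ u)
        ∑-*ˡ (x ∷ xs) u g = K.trans (K.+-congˡ (∑-*ˡ xs u g)) (K.sym (K.distribˡ u _ _))
      weighted-act 𝟘 h d eq x = K.trans (K.trans (∑-cong elements (λ a → K.zeroˡ a)) (∑-ε elements))
        (solve 2 (λ d x → con (+ 0) := con (+ 0) :* d :* x) K.refl d x)
      weighted-act 𝟙 h d eq x = K.trans (eq x) (solve 2 (λ d x → d :* x := con (+ 1) :* d :* x) K.refl d x)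

      δ : K.Carrier → K.Carrier → ℤ
      δ a x with x K.≟ a
      ... | yes _ = + 1
      ... | no _ = + 0

      δ-respects : ∀ {a b x y} → a K.≈ b → x K.≈ y → δ a x ≡ δ b y
      δ-respects {a} {b} {x} {y} a≈b x≈y with x K.≟ a | y K.≟ b
      ... | yes _ | yes _ = ≡.refl
      ... | no _ | no _ = ≡.refl
      ... | yes x≈a | no y≉b = contradiction (K.trans (K.sym x≈y) (K.trans x≈a a≈b)) y≉b
      ... | no x≉a | yes y≈b = contradiction (K.trans x≈y (K.trans y≈b (K.sym a≈b))) x≉a

      δ-off : ∀ a x → a K.≉ x → δ a x ≡ + 0
      δ-off a x a≉x with x K.≟ a
      ... | yes x≈a = contradiction (K.sym x≈a) a≉x
      ... | no _ = ≡.refl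

      δ-on : ∀ x → δ x x ≡ + 1
      δ-on x with x K.≟ x
      ... | yes _ = ≡.refl
      ... | no x≉x = contradiction K.refl x≉x

      weighted-δ : ∀ x → weighted δ x K.≈ K.1# K.* x
      weighted-δ x = K.trans
        (∑F-single (λ a≈b → K.*-cong (K.reflexive (≡.cong ⟦_⟧ (δ-respects a≈b K.refl))) a≈b) x
          (λ a a≉x → K.trans (K.*-congʳ (K.reflexive (≡.cong ⟦_⟧ (δ-off a x a≉x)))) (K.zeroˡ a)))
        (K.*-congʳ (K.reflexive (≡.cong ⟦_⟧ (δ-on x))))

    π-cong : ∀ {s t} → s ≈ₜ t → π s K.≈ π t
    π-cong {s} {t} s≈t = K.trans (K.sym (expand s)) (K.trans
      (∑-cong elements (λ a → K.*-congʳ (K.reflexive (≡.cong ⟦_⟧ (at s≈t (δ a) (δ-respects K.refl) K.1#)))))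
      (expand t))
      where
      expand : ∀ s → weighted (λ a → act s (δ a)) K.1# K.≈ π s
      expand s = K.trans (weighted-act s δ K.1# weighted-δ K.1#) (K.trans (K.*-identityʳ _) (K.*-identityʳ _))

  ‹›-cong : ∀ {a b} → a K.≈ b → ‹ a › ≈ₜ ‹ b ›
  ‹›-cong a≈b = agree λ h h-resp x → h-resp (K.*-congʳ a≈b)

  ‹›-^ : ∀ a n → ‹ a › ^ₜ n ≈ₜ ‹ a ^K n ›
  ‹›-^ a zero = agree λ h h-resp x → h-resp (K.sym (K.*-identityˡ x))
  ‹›-^ a (suc n) = agree λ h h-resp x → ≡.trans (at (‹›-^ a n) h h-resp (a K.* x))
    (h-resp (K.trans (K.sym (K.*-assoc _ a x)) (K.*-congʳ (K.*-comm _ a))))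

  open FrobeniusPowers termRing

  ^q-+ : ∀ s t → (s ⊕ t) ^ₜ q ~ (s ^ₜ q) ⊕ (t ^ₜ q)
  ^q-+ s t = ≡.subst (λ n → (s ⊕ t) ^ₜ n ~ (s ^ₜ n) ⊕ (t ^ₜ n)) (≡.sym q≡p^f) (^p^-+ f s t)

  term^q : ∀ s → s ^ₜ q ~ s
  term^q ‹ a › = ~-reflexive (T.trans (‹›-^ a q) (‹›-cong (^q a)))
  term^q (s ⊗ t) = ~-trans (~-reflexive (CommutativeExp.^-distrib-* T.commutativeSemiring s t q)) (~-* (term^q s) (term^q t))
  term^q 𝟘 = ~-reflexive (0^ q)
    where
    0^ : ∀ n → .{{NonZero n}} → 𝟘 ^ₜ n ≈ₜ 𝟘
    0^ (suc n) = T.zeroˡ (𝟘 ^ₜ n)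
  term^q 𝟙 = ~-reflexive (1^ q)
    where
    1^ : ∀ n → 𝟙 ^ₜ n ≈ₜ 𝟙
    1^ zero = T.refl {𝟙}
    1^ (suc n) = T.trans (T.*-identityˡ _) (1^ n)
  term^q (s ⊕ t) = ~-trans (^q-+ s t) (~-+ (term^q s) (term^q t))
  term^q (⊖ s) = ~-trans (~-neg (~-trans (~-sym (^q-+ s (⊖ s))) (~-trans (~-^ q (~-reflexive (T.-‿inverseʳ s))) (term^q 𝟘))) (term^q s))
    (~-reflexive (T.refl {⊖ s}))

  pow : ℕ → Term
  pow i = (p ℕ.^ i) ·ₜ 𝟙

  -- The ideal (p ^ i) after inverting the elements that π maps to 1.
  Jₜ : ℕ → Term → Set (c ⊔ ℓ)
  Jₜ i x = ∃ λ u → (π u K.≈ K.1#) × ∃ λ z → u ⊗ x ≈ₜ pow i ⊗ z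

  p^-+ : ∀ i j → pow (i ℕ.+ j) ≈ₜ pow i ⊗ pow j
  p^-+ i j = T.trans {pow (i ℕ.+ j)} {(p ℕ.^ i ℕ.* p ℕ.^ j) ·ₜ 𝟙}
    (T.reflexive (≡.cong (_·ₜ 𝟙) (ℕ.^-distribˡ-+-* p i j))) (Mult.×1-homo-* T.semiring (p ℕ.^ i) (p ℕ.^ j))

  open JIdentities termRing

  π-·1 : ∀ n → π (n ·ₜ 𝟙) K.≈ n ·K K.1#
  π-·1 zero = K.refl
  π-·1 (suc n) = K.+-congˡ (π-·1 n)

  1*1≈1 : ∀ {a b} → a K.≈ K.1# → b K.≈ K.1# → a K.* b K.≈ K.1#
  1*1≈1 a≈1 b≈1 = K.trans (K.*-cong a≈1 b≈1) (K.*-identityˡ K.1#)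

  p^suc : ∀ i → pow (suc i) ≈ₜ (p ·ₜ 𝟙) ⊗ pow i
  p^suc i = Mult.×1-homo-* T.semiring p (p ℕ.^ i)

  p≈p^1 : p ·ₜ 𝟙 ≈ₜ pow 1
  p≈p^1 = T.reflexive (≡.cong (_·ₜ 𝟙) (≡.sym (ℕ.*-identityʳ p)))

  -- 1 - x ^ (q - 1) maps to 1 and annihilates x modulo p, because x ^ q ≡ x.
  kernel⊆J : ∀ x → π x K.≈ K.0# → Jₜ 1 x
  kernel⊆J x πx≈0 =
    let z , eq = ≡.subst (λ n → x ^ₜ n ~ x) q≡1+q′ (term^q x)
    in 𝟙 ⊕ ⊖ (x ^ₜ q′)
     , K.trans (K.+-congˡ (K.trans (K.-‿cong (π-^≈0 q′)) -0#≈0#)) (K.+-identityʳ _)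
     , ⊖ z , kernel-identity x (x ^ₜ q′) (p ·ₜ 𝟙) (pow 1) z p≈p^1 eq
    where
    open import Algebra.Properties.Ring K.ring using (-0#≈0#)
    π-^≈0 : ∀ n → .{{NonZero n}} → π (x ^ₜ n) K.≈ K.0#
    π-^≈0 (suc n) = K.trans (K.*-congʳ πx≈0) (K.zeroˡ _)

  private
    difference≈0 : ∀ {a b} → a K.≈ b → a K.- b K.≈ K.0#
    difference≈0 a≈b = K.trans (K.+-congʳ a≈b) (K.-‿inverseʳ _)

  termLift : LiftRing
  termLift = record
    { commutativeRing = termRing
    ; J = Jₜ
    ; J-cong = λ i {x} {y} x≈y (u , u≈1 , z , eq) →
        u , u≈1 , z , T.trans (T.*-congˡ (T.sym x≈y)) eq
    ; J-+ = λ i {x} {y} (u , u≈1 , z , eq) (v , v≈1 , w , eq′) →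
        u ⊗ v , 1*1≈1 u≈1 v≈1 , (v ⊗ z) ⊕ (u ⊗ w) , J-+-identity u v x y (pow i) z w eq eq′
    ; J-* = λ i j {x} {y} (u , u≈1 , z , eq) (v , v≈1 , w , eq′) →
        u ⊗ v , 1*1≈1 u≈1 v≈1 , z ⊗ w , J-*-identity u v x y (pow i) (pow j) (pow (i ℕ.+ j)) z w (p^-+ i j) eq eq′
    ; J-all = λ x → 𝟙 , K.refl , x , T.*-congʳ {x} {𝟙} {1 ·ₜ 𝟙} (T.sym {1 ·ₜ 𝟙} {𝟙} (T.+-identityʳ 𝟙))
    ; J-suc = λ i {x} (u , u≈1 , z , eq) → u , u≈1 , (p ·ₜ 𝟙) ⊗ z , J-suc-identity u x (p ·ₜ 𝟙) (pow i) (pow (suc i)) z (p^suc i) eq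
    ; J-p = 𝟙 , K.refl , 𝟙 , T.trans (T.*-identityˡ _) (T.trans p≈p^1 (T.sym (T.*-identityʳ _)))
    ; ⟨_⟩ = ‹_›
    ; ⟨⟩-cong = λ {a} {b} a≈b → kernel⊆J (‹ a › ⊕ ⊖ ‹ b ›) (difference≈0 a≈b)
    ; ⟨⟩-+ = λ a b → kernel⊆J (‹ a K.+ b › ⊕ ⊖ (‹ a › ⊕ ‹ b ›)) (difference≈0 K.refl)
    ; ⟨⟩-* = λ a b → kernel⊆J (‹ a K.* b › ⊕ ⊖ (‹ a › ⊗ ‹ b ›)) (difference≈0 K.refl)
    ; ⟨⟩-1 = kernel⊆J (‹ K.1# › ⊕ ⊖ 𝟙) (difference≈0 K.refl)
    }

  act-· : ∀ n h x → act (n ·ₜ 𝟙) h x ≡ + n ℤ.* h x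
  act-· zero h x = ≡.sym (ℤ.*-zeroˡ (h x))
  act-· (suc n) h x = ≡.trans (≡.cong (λ z → h x ℤ.+ z) (act-· n h x)) (≡.sym (ℤ.suc-* (+ n) (h x)))

  p-cancel : ∀ s t → (p ·ₜ 𝟙) ⊗ s ≈ₜ (p ·ₜ 𝟙) ⊗ t → s ≈ₜ t
  p-cancel s t eq = agree λ h h-resp x → ℤ.*-cancelˡ-≡ (+ p) (act s h x) (act t h x)
    (≡.trans (≡.sym (act-· p (act s h) x)) (≡.trans (at eq h h-resp x) (act-· p (act t h) x)))

  open Characteristic f q≡p^f

  Jₜ-integer : ∀ e n → Jₜ e (n ·ₜ 𝟙) → p ℕ.^ e ∣ n
  Jₜ-integer zero n _ = 1∣ n
  Jₜ-integer (suc e) n (u , u≈1 , z , eq) with p∣-from-≈0 n n≈0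
    where
    n≈0 : n ·K K.1# K.≈ K.0#
    n≈0 = K.trans (K.sym (π-·1 n)) (K.trans (K.sym (K.trans (K.*-congʳ u≈1) (K.*-identityˡ _)))
      (K.trans (π-cong {u ⊗ (n ·ₜ 𝟙)} {pow (suc e) ⊗ z} eq)
        (K.trans (K.*-congʳ (K.trans (π-cong {pow (suc e)} {(p ·ₜ 𝟙) ⊗ pow e} (p^suc e))
          (K.trans (K.*-congʳ (K.trans (π-·1 p) p·1≈0)) (K.zeroˡ _)))) (K.zeroˡ _))))
  ... | divides m ≡.refl = ≡.subst (p ℕ.* p ℕ.^ e ∣_) (ℕ.*-comm p m) (*-monoʳ-∣ p (Jₜ-integer e m
    (u , u≈1 , z , p-cancel (u ⊗ (m ·ₜ 𝟙)) (pow e ⊗ z)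
      (torsion-identity u ((m ℕ.* p) ·ₜ 𝟙) (m ·ₜ 𝟙) (p ·ₜ 𝟙) (pow e) (pow (suc e)) z (Mult.×1-homo-* T.semiring m p) (p^suc e) eq))))

  -- Power sums over all vectors

  frobenius unfrobenius : K.Carrier → K.Carrier
  frobenius a = a ^K p
  unfrobenius a = a ^K (p ℕ.^ f′)

  ^p^f : ∀ a → a ^K (p ℕ.^ suc f′) K.≈ a
  ^p^f a = ≡.subst (λ n → a ^K n K.≈ a) q≡p*p^f′ (^q a)

  frobenius-unfrobenius : ∀ a → frobenius (unfrobenius a) K.≈ a
  frobenius-unfrobenius a = K.trans (Exp.^-assocʳ K.semiring a (p ℕ.^ f′) p)
    (K.trans (Exp.^-congʳ K.semiring a (ℕ.*-comm (p ℕ.^ f′) p)) (^p^f a))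

  unfrobenius-frobenius : ∀ a → unfrobenius (frobenius a) K.≈ a
  unfrobenius-frobenius a = K.trans (Exp.^-assocʳ K.semiring a p (p ℕ.^ f′)) (^p^f a)

  -- The quotient map by the line through P in the coordinates other than i₀, where r is the inverse of P i₀.
  module Projection {k} (P : Vector K.Carrier (suc k)) (i₀ : Fin (suc k)) (r : K.Carrier) where
    coefficient : Vector K.Carrier (suc k) → K.Carrier
    coefficient v = v i₀ K.* r

    project : Vector K.Carrier (suc k) → Vector K.Carrier k
    project v i = v (punchIn i₀ i) K.- coefficient v K.* P (punchIn i₀ i)

  module Powers (A : LiftRing) where
    open LiftRing A
    open LiftRingProperties A
    open Evaluation A
    open RingSolver commutativeRing
    open Exp semiring using (_^_; ^-assocʳ)
    open ListSum +-commutativeMonoid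
    open Mult semiring using (×1-homo-*; ×-assoc-*; ×-congʳ)

    ≡-^ : ∀ i n {x y} → x ≡ y [ i ] → x ^ n ≡ y ^ n [ i ]
    ≡-^ i zero _ = Q.refl i
    ≡-^ i (suc n) x≡y = Q.*-cong i x≡y (≡-^ i n x≡y)

    ≡-^M : ∀ s {x y} → x ^ q′ ≡ y ^ q′ [ 1 ] → x ^ (q′ ℕ.* p ℕ.^ s) ≡ y ^ (q′ ℕ.* p ℕ.^ s) [ suc s ]
    ≡-^M s {x} {y} x≡y = Q.trans (suc s) (≈⇒≡ (suc s) (sym (^-assocʳ x q′ (p ℕ.^ s))))
      (Q.trans (suc s) (^p^-cong s x≡y) (≈⇒≡ (suc s) (^-assocʳ y q′ (p ℕ.^ s))))

    ⊙-≡ : ∀ {k} (X : Vector Carrier k) {v w} → v ≈ᵥ w → X ⊙ v ≡ X ⊙ w [ 1 ]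
    ⊙-≡ {zero} X v≈w = Q.refl 1
    ⊙-≡ {suc k} X v≈w = Q.+-cong 1 (Q.*-congˡ 1 (⟨⟩-cong (v≈w zero))) (⊙-≡ (X ∘ suc) (v≈w ∘ suc))

    ⊙-- : ∀ {k} (X : Vector Carrier k) v b w → X ⊙ (λ i → v i K.- b K.* w i) ≡ X ⊙ v - ⟨ b ⟩ * (X ⊙ w) [ 1 ]
    ⊙-- {zero} X v b w = ≈⇒≡ 1 (solve 1 (λ b → con (+ 0) := con (+ 0) :- b :* con (+ 0)) refl ⟨ b ⟩)
    ⊙-- {suc k} X v b w = Q.trans 1
      (Q.+-cong 1 (Q.*-congˡ 1 (Q.trans 1 (⟨⟩-- _ _) (Q.+-congˡ 1 (Q.-‿cong 1 (⟨⟩-* b (w zero)))))) (⊙-- (X ∘ suc) (v ∘ suc) b (w ∘ suc)))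
      (≈⇒≡ 1 (solve 6 (λ X v b w s t → X :* (v :- b :* w) :+ (s :- b :* t) := (X :* v :+ s) :- b :* (X :* w :+ t)) refl _ _ _ _ _ _))

    ⊙-scale : ∀ {k} (X : Vector Carrier k) b v → X ⊙ (λ i → b K.* v i) ≡ ⟨ b ⟩ * (X ⊙ v) [ 1 ]
    ⊙-scale {zero} X b v = ≈⇒≡ 1 (sym (zeroʳ _))
    ⊙-scale {suc k} X b v = Q.trans 1 (Q.+-cong 1 (Q.*-congˡ 1 (⟨⟩-* b (v zero))) (⊙-scale (X ∘ suc) b (v ∘ suc)))
      (≈⇒≡ 1 (solve 4 (λ X b v s → X :* (b :* v) :+ b :* s := b :* (X :* v :+ s)) refl _ _ _ _))

    ⊙-zero : ∀ {k} (X : Vector Carrier k) {v} → (∀ i → v i K.≈ K.0#) → J 1 (X ⊙ v)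
    ⊙-zero {zero} X v≈0 = J-0 1
    ⊙-zero {suc k} X v≈0 = J-+ 1 (J-*ˡ 1 _ (J-≡ 1 (⟨⟩-cong (v≈0 zero)) ⟨0⟩)) (⊙-zero (X ∘ suc) (v≈0 ∘ suc))

    ⊙-remove : ∀ {k} (X : Vector Carrier (suc k)) v i → X ⊙ v ≈ X i * ⟨ v i ⟩ + removeAt X i ⊙ removeAt v i
    ⊙-remove X v i = Sum.sum-remove +-commutativeMonoid (λ j → X j * ⟨ v j ⟩)

    ⊙-project : ∀ {k} (P : Vector K.Carrier (suc k)) i₀ r → P i₀ K.* r K.≈ K.1# → ∀ X → J 1 (X ⊙ P) →
      ∀ v → removeAt X i₀ ⊙ Projection.project P i₀ r v ≡ X ⊙ v [ 1 ]
    ⊙-project P i₀ r Pr≈1 X JXP v = begin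
      X′ ⊙ project v                                   ≈⟨ ⊙-- X′ (removeAt v i₀) μ (removeAt P i₀) ⟩
      S - ⟨ μ ⟩ * T                                    ≈⟨ Q.+-congˡ 1 (Q.-‿cong 1 (Q.*-congˡ 1 T≡)) ⟩
      S - ⟨ μ ⟩ * (- (X i₀ * ⟨ P i₀ ⟩))                ≈⟨ ≈⇒≡ 1 (solve 4 (λ S m x P → S :- m :* (:- (x :* P)) := x :* (m :* P) :+ S) refl S ⟨ μ ⟩ (X i₀) ⟨ P i₀ ⟩) ⟩
      X i₀ * (⟨ μ ⟩ * ⟨ P i₀ ⟩) + S                    ≈⟨ Q.+-congʳ 1 (Q.*-congˡ 1 (Q.trans 1 (Q.sym 1 (⟨⟩-* μ (P i₀))) (⟨⟩-cong μP≈v))) ⟩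
      X i₀ * ⟨ v i₀ ⟩ + S                              ≈⟨ ≈⇒≡ 1 (⊙-remove X v i₀) ⟨
      X ⊙ v ∎
      where
      open SetoidReasoning (Q.setoid 1)
      open Projection P i₀ r
      X′ = removeAt X i₀
      μ = coefficient v
      S = X′ ⊙ removeAt v i₀
      T = X′ ⊙ removeAt P i₀
      T≡ : T ≡ - (X i₀ * ⟨ P i₀ ⟩) [ 1 ]
      T≡ = J-cong 1 (trans (⊙-remove X P i₀) (solve 2 (λ a t → a :+ t := t :- (:- a)) refl _ T)) JXP
      μP≈v : μ K.* P i₀ K.≈ v i₀
      μP≈v = K.trans (K.*-assoc _ _ _) (K.trans (K.*-congˡ (K.trans (K.*-comm r (P i₀)) Pr≈1)) (K.*-identityʳ _))

    ⊙-frobenius : ∀ {k} (X : Vector Carrier k) v → (X ⊙ v) ^ p ≡ (λ i → X i ^ p) ⊙ (λ i → frobenius (v i)) [ 1 ]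
    ⊙-frobenius {zero} X v = ≈⇒≡ 1 (0^ p)
      where
      0^ : ∀ n → .{{NonZero n}} → 0# ^ n ≈ 0#
      0^ (suc n) = zeroˡ _
    ⊙-frobenius {suc k} X v =
      let z , eq = FrobeniusPowers.^p-+ commutativeRing (X zero * ⟨ v zero ⟩) ((X ∘ suc) ⊙ (v ∘ suc))
      in Q.trans 1 (Q.trans 1 (≈⇒≡ 1 eq) (Q.trans 1 (Q.+-congˡ 1 (J⇒≡0 1 (J-*ʳ 1 z J-p))) (Q.+-identityʳ 1 _)))
        (Q.+-cong 1
          (Q.trans 1 (≈⇒≡ 1 (CommutativeExp.^-distrib-* commutativeSemiring _ _ p)) (Q.*-congˡ 1 (Q.sym 1 (⟨⟩-^ (v zero) p))))
          (⊙-frobenius (X ∘ suc) (v ∘ suc)))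

    q∈J : J 1 (q · 1#)
    q∈J = ≡.subst (λ n → J 1 (n · 1#)) (≡.sym q≡p*p^f′)
      (J-cong 1 (sym (×1-homo-* p (p ℕ.^ f′))) (J-*ʳ 1 _ J-p))

    q·∈J : ∀ i {x} → J i x → J (suc i) (q · x)
    q·∈J i {x} Jx = J-cong (suc i) (trans (×-assoc-* q 1# x) (×-congʳ q (*-identityˡ x))) (J-* 1 i q∈J Jx)

  affinePoints : ∀ {N k} → N ≤ q ℕ.^ k → Points N (suc k)
  affinePoints {N} {k} N≤ = record
    { point = λ s → K.1# Vector.∷ coordinates s
    ; nonzero = λ s → zero , 1≉0
    ; distinct = λ s t s≢t →
        let j , ≉ = differ s t s≢t in zero , suc j , λ ≈0 → ≉ (K.sym (K.trans (K.sym (K.*-identityˡ _))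
          (K.trans (x∙y⁻¹≈ε⇒x≈y _ _ ≈0) (K.*-identityʳ _))))
    }
    where
    open import Algebra.Properties.Ring K.ring using (x∙y⁻¹≈ε⇒x≈y)
    coordinates : Fin N → Vector K.Carrier k
    coordinates s = element ∘ finToFun (Fin.inject≤ s N≤)

    funToFin-cong : ∀ {m n} {g h : Fin m → Fin n} → (∀ i → g i ≡ h i) → funToFin g ≡ funToFin h
    funToFin-cong {zero} eq = ≡.refl
    funToFin-cong {suc m} eq = ≡.cong₂ Fin.combine (eq zero) (funToFin-cong (eq ∘ suc))

    differ : ∀ s t → s ≢ t → ∃ λ j → coordinates s j K.≉ coordinates t j
    differ s t s≢t = Fin.¬∀⟶∃¬ k _ (λ j → coordinates s j K.≟ coordinates t j) λ all →
      s≢t (Fin.inject≤-injective N≤ N≤ s t (≡.trans (≡.sym (Fin.funToFin-finToFin {k} {q} _))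
        (≡.trans (funToFin-cong (λ j → ≡.trans (≡.sym (index-element _)) (≡.trans (Inverse.to-cong K.card (all j)) (index-element _))))
          (Fin.funToFin-finToFin {k} {q} _))))

  M : ℕ → ℕ
  M s = q′ ℕ.* p ℕ.^ s

  M<q^ : ∀ s → M s < q ℕ.^ suc s
  M<q^ s = ℕ.<-≤-trans (ℕ.*-monoˡ-< (p ℕ.^ s) {{ℕ.m^n≢0 p s}} (≡.subst (q′ <_) (≡.sym q≡1+q′) (ℕ.n<1+n q′)))
    (ℕ.*-monoʳ-≤ q (ℕ.^-monoˡ-≤ s p≤q))

  vanishes-twist : ∀ i s k → i ≤ suc s → Vanishes i (M s) (vecs k) → Vanishes i (M (suc s)) (vecs k)
  vanishes-twist i s k i≤ vanishes A X = J-≡ i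
    (Q.trans i (List∑.∑-cong (vecs k) twist) (Q.sym i (Field∑.∑V-reindex {k} {h} (λ v≈w → h-cong v≈w)
      (λ _ → frobenius) (λ _ → unfrobenius) (λ _ → Exp.^-congˡ K.semiring p) (λ _ → Exp.^-congˡ K.semiring (p ℕ.^ f′))
      (λ _ → frobenius-unfrobenius) (λ _ → unfrobenius-frobenius))))
    (vanishes A (λ j → X j ^ p))
    where
    open LiftRing A
    open LiftRingProperties A
    open Evaluation A
    open Powers A
    open Exp semiring using (_^_; ^-assocʳ; ^-congʳ)
    module List∑ = ListSum (Q.+-commutativeMonoid i)
    module Field∑ = FieldSum (Q.+-commutativeMonoid i)
    h : Vector K.Carrier k → Carrier
    h v = ((λ j → X j ^ p) ⊙ v) ^ M s
    h-cong : ∀ {v w} → v ≈ᵥ w → h v ≡ h w [ i ]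
    h-cong v≈w = J-≤ i≤ (≡-^M s (≡-^ 1 q′ (⊙-≡ (λ j → X j ^ p) v≈w)))
    twist : ∀ v → (X ⊙ v) ^ M (suc s) ≡ h (λ j → frobenius (v j)) [ i ]
    twist v = Q.trans i
      (≈⇒≡ i (trans (^-congʳ (X ⊙ v) exponent) (sym (^-assocʳ (X ⊙ v) p (M s)))))
      (J-≤ i≤ (≡-^M s (≡-^ 1 q′ (⊙-frobenius X v))))
      where
      exponent : M (suc s) ≡ p ℕ.* M s
      exponent = ≡.trans (≡.sym (ℕ.*-assoc q′ p (p ℕ.^ s))) (≡.trans (≡.cong (ℕ._* p ℕ.^ s) (ℕ.*-comm q′ p)) (ℕ.*-assoc p q′ (p ℕ.^ s)))

  all-vectors-vanish : ∀ k s → k ≤ suc s → Vanishes k (M s) (vecs (suc k))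
  all-vectors-vanish zero s _ A X = LiftRing.J-all A _
  all-vectors-vanish (suc k) s k≤s = go (ℕ.≤⇒≤′ (ℕ.≤-pred k≤s))
    where
    go : ∀ {s} → k ℕ.≤′ s → Vanishes (suc k) (M s) (vecs (suc (suc k)))
    go (ℕ.≤′-step {s} k≤′s) = vanishes-twist (suc k) s (suc (suc k)) (s≤s (ℕ.≤′⇒≤ k≤′s)) (go k≤′s)
    go ℕ.≤′-refl = vanishes-everywhere (affinePoints (M<q^ k)) (suc k) (vecs (suc (suc k))) λ s A X JXP →
      at-point A (element ∘ finToFun (Fin.inject≤ s (M<q^ k))) X JXP
      where
      at-point : ∀ (A : LiftRing) (a : Vector K.Carrier (suc k)) X → LiftRing.J A 1 (Evaluation._⊙_ A X (K.1# Vector.∷ a)) →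
                 LiftRing.J A (suc k) (Evaluation.powerSum A (M k) (vecs (suc (suc k))) X)
      at-point A a X JXP = J-≡ (suc k) (begin
        powerSum (M k) (vecs (suc (suc k))) X
          ≈⟨ List∑.∑-cong (vecs (suc (suc k))) (λ v → ≡-^M k (≡-^ 1 q′ (Q.sym 1 (⊙-project P zero K.1# (K.*-identityˡ K.1#) X JXP v)))) ⟩
        ∑V (suc (suc k)) (λ v → h (project v))
          ≈⟨ ∑V-suc (suc k) (λ v → h (project v)) ⟩
        ∑F (λ b → ∑V (suc k) (λ w → h (project (b Vector.∷ w))))
          ≈⟨ List∑.∑-cong elements (λ b → Q.sym (suc k) (∑V-translate {suc k} {h} h-cong (λ j → K.- (b K.* K.1# K.* a j)))) ⟩
        ∑F (λ b → ∑V (suc k) h)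
          ≈⟨ ≈⇒≡ (suc k) (FieldSum.∑F-const +-commutativeMonoid (∑V (suc k) h)) ⟩
        q · ∑V (suc k) h ∎)
        (q·∈J k (all-vectors-vanish k k (ℕ.n≤1+n k) A (X ∘ suc)))
        where
        open LiftRing A
        open LiftRingProperties A
        open Evaluation A
        open Powers A
        open Exp semiring using (_^_)
        open SetoidReasoning (Q.setoid (suc k))
        module List∑ = ListSum (Q.+-commutativeMonoid (suc k))
        open FieldSum (Q.+-commutativeMonoid (suc k))
        P = K.1# Vector.∷ a
        open Projection P zero K.1#
        h : Vector K.Carrier (suc k) → Carrier
        h w = ((X ∘ suc) ⊙ w) ^ M k
        h-cong : ∀ {v w} → v ≈ᵥ w → h v ≡ h w [ suc k ]
        h-cong v≈w = ≡-^M k (≡-^ 1 q′ (⊙-≡ (X ∘ suc) v≈w))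

  -- Counting columns on points and hyperplanes

  module ℕ∑ = ListSum ℕ.+-0-commutativeMonoid
  module ℕF = FieldSum ℕ.+-0-commutativeMonoid
  open ℕ∑ using (∑)
  open ℕF using (∑F; ∑V)

  indicator : ∀ {r} {P : Set r} → Dec P → ℕ
  indicator (yes _) = 1
  indicator (no _) = 0

  indicator-cong : ∀ {r s} {P : Set r} {Q : Set s} (P? : Dec P) (Q? : Dec Q) → (P → Q) → (Q → P) → indicator P? ≡ indicator Q?
  indicator-cong (yes _) (yes _) _ _ = ≡.refl
  indicator-cong (no _) (no _) _ _ = ≡.refl
  indicator-cong (yes p) (no ¬q) to from = contradiction (to p) ¬q
  indicator-cong (no ¬p) (yes q) to from = contradiction (from q) ¬p

  indicator-yes : ∀ {r} {P : Set r} (P? : Dec P) → P → indicator P? ≡ 1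
  indicator-yes (yes _) _ = ≡.refl
  indicator-yes (no ¬p) p = contradiction p ¬p

  indicator-no : ∀ {r} {P : Set r} (P? : Dec P) → ¬ P → indicator P? ≡ 0
  indicator-no (yes p) ¬p = contradiction p ¬p
  indicator-no (no _) _ = ≡.refl

  indicator-¬ : ∀ {r} {P : Set r} (P? : Dec P) → indicator (¬? P?) ℕ.+ indicator P? ≡ 1
  indicator-¬ (yes _) = ≡.refl
  indicator-¬ (no _) = ≡.refl

  ∑-mono : ∀ {d} {B : Set d} (xs : List B) {h h′ : B → ℕ} → (∀ x → h x ≤ h′ x) → ∑ xs h ≤ ∑ xs h′
  ∑-mono [] _ = z≤n
  ∑-mono (x ∷ xs) h≤h′ = ℕ.+-mono-≤ (h≤h′ x) (∑-mono xs h≤h′)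

  ∑-*ʳ : ∀ {d} {B : Set d} (xs : List B) (h : B → ℕ) n → ∑ xs (λ x → h x ℕ.* n) ≡ ∑ xs h ℕ.* n
  ∑-*ʳ [] h n = ≡.refl
  ∑-*ʳ (x ∷ xs) h n = ≡.trans (≡.cong (h x ℕ.* n ℕ.+_) (∑-*ʳ xs h n)) (≡.sym (ℕ.*-distribʳ-+ n (h x) _))

  ·≡* : ∀ m n → CommutativeMonoidMult._×_ ℕ.+-0-commutativeMonoid m n ≡ m ℕ.* n
  ·≡* zero n = ≡.refl
  ·≡* (suc m) n = ≡.cong (n ℕ.+_) (·≡* m n)

  ∑F-const : ∀ n → ∑F (λ _ → n) ≡ q ℕ.* n
  ∑F-const n = ≡.trans (ℕF.∑F-const n) (·≡* q n)

  ∑V-const : ∀ k n → ∑V k (λ _ → n) ≡ q ℕ.^ k ℕ.* n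
  ∑V-const k n = ≡.trans (ℕF.∑V-const k n) (·≡* (q ℕ.^ k) n)

  ∑F-≥ : ∀ {h : K.Carrier → ℕ} → (∀ {a b} → a K.≈ b → h a ≡ h b) → ∀ a → h a ≤ ∑F h
  ∑F-≥ {h} h-cong a = ℕ.≤-trans
    (ℕ.≤-reflexive (≡.trans (≡.sym (only-at a)) (≡.sym (ℕF.∑F-single {only} only-cong a only-off))))
    (∑-mono elements only≤)
    where
    only : K.Carrier → ℕ
    only b = indicator (b K.≟ a) ℕ.* h b
    only-at : ∀ b → only a ≡ h a
    only-at _ = ≡.trans (≡.cong (ℕ._* h a) (indicator-yes (a K.≟ a) K.refl)) (ℕ.*-identityˡ (h a))
    only-cong : ∀ {b d} → b K.≈ d → only b ≡ only d
    only-cong b≈d = ≡.cong₂ ℕ._*_ (indicator-cong (_ K.≟ a) (_ K.≟ a) (K.trans (K.sym b≈d)) (K.trans b≈d)) (h-cong b≈d)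
    only-off : ∀ b → b K.≉ a → only b ≡ 0
    only-off b b≉a = ≡.cong (ℕ._* h b) (indicator-no (b K.≟ a) b≉a)
    only≤ : ∀ b → only b ≤ h b
    only≤ b with b K.≟ a
    ... | yes _ = ℕ.≤-reflexive (ℕ.*-identityˡ (h b))
    ... | no _ = z≤n

  infix 4 _≟ᵥ_
  _≟ᵥ_ : ∀ {k} (v w : Vector K.Carrier k) → Dec (v ≈ᵥ w)
  v ≟ᵥ w = Fin.all? (λ i → v i K.≟ w i)

  0ᵥ : ∀ {k} → Vector K.Carrier k
  0ᵥ i = K.0#

  ≈ᵥ-sym : ∀ {k} {v w : Vector K.Carrier k} → v ≈ᵥ w → w ≈ᵥ v
  ≈ᵥ-sym v≈w i = K.sym (v≈w i)

  ≈ᵥ-trans : ∀ {k} {u v w : Vector K.Carrier k} → u ≈ᵥ v → v ≈ᵥ w → u ≈ᵥ w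
  ≈ᵥ-trans u≈v v≈w i = K.trans (u≈v i) (v≈w i)

  pivot : ∀ {k} {v : Vector K.Carrier k} → ¬ v ≈ᵥ 0ᵥ → ∃ λ i → v i K.≉ K.0#
  pivot {k} {v} v≉0 = Fin.¬∀⟶∃¬ k _ (λ i → v i K.≟ K.0#) v≉0

  searchF : ∀ {r} {P : Pred K.Carrier r} → (∀ {a b} → a K.≈ b → P a → P b) → Decidable P → (∃ P) ⊎ (∀ a → ¬ P a)
  searchF {P = P} resp P? with Fin.any? (λ i → P? (element i))
  ... | yes (i , Pi) = inj₁ (element i , Pi)
  ... | no ¬∃ = inj₂ λ a Pa → ¬∃ (index a , resp (K.sym (element-index a)) Pa)

  searchV : ∀ k {r} {P : Pred (Vector K.Carrier k) r} → (∀ {v w} → v ≈ᵥ w → P v → P w) → Decidable P → (∃ P) ⊎ (∀ v → ¬ P v)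
  searchV zero resp P? with P? Vector.[]
  ... | yes P[] = inj₁ (_ , P[])
  ... | no ¬P[] = inj₂ λ v Pv → ¬P[] (resp (λ ()) Pv)
  searchV (suc k) {P = P} resp P? with Fin.any? (λ i → extension? i)
    where
    extension? : ∀ i → Dec (∃ λ v → P (element i Vector.∷ v))
    extension? i with searchV k {P = λ v → P (element i Vector.∷ v)} (λ v≈w → resp (∷-cong K.refl v≈w)) (λ v → P? (element i Vector.∷ v))
    ... | inj₁ found = yes found
    ... | inj₂ none = no λ (v , Pv) → none v Pv
  ... | yes (i , v , Pv) = inj₁ (_ , Pv)
  ... | no ¬∃ = inj₂ λ v Pv → ¬∃ (index (v zero) , v ∘ suc ,
    resp (≈ᵥ-trans (≈ᵥ-sym (∷-head-tail v)) (∷-cong (K.sym (element-index (v zero))) (λ _ → K.refl))) Pv)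

  dot : ∀ {k} → Vector K.Carrier k → Vector K.Carrier k → K.Carrier
  dot x v = Sum.sum K.+-commutativeMonoid (λ i → x i K.* v i)

  module _ where
    open RingSolver K.commutativeRing

    dot-cong : ∀ {k} {x y v w : Vector K.Carrier k} → x ≈ᵥ y → v ≈ᵥ w → dot x v K.≈ dot y w
    dot-cong {zero} _ _ = K.refl
    dot-cong {suc k} x≈y v≈w = K.+-cong (K.*-cong (x≈y zero) (v≈w zero)) (dot-cong (x≈y ∘ suc) (v≈w ∘ suc))

    dot-+ : ∀ {k} (x y v : Vector K.Carrier k) → dot (λ i → x i K.+ y i) v K.≈ dot x v K.+ dot y v
    dot-+ {zero} x y v = K.sym (K.+-identityˡ _)
    dot-+ {suc k} x y v = K.trans (K.+-congˡ (dot-+ (x ∘ suc) (y ∘ suc) (v ∘ suc)))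
      (solve 5 (λ x y v s t → (x :+ y) :* v :+ (s :+ t) := (x :* v :+ s) :+ (y :* v :+ t)) K.refl _ _ _ _ _)

    dot-- : ∀ {k} (x v : Vector K.Carrier k) b w → dot x (λ i → v i K.- b K.* w i) K.≈ dot x v K.- b K.* dot x w
    dot-- {zero} x v b w = solve 1 (λ b → con (+ 0) := con (+ 0) :- b :* con (+ 0)) K.refl b
    dot-- {suc k} x v b w = K.trans (K.+-congˡ (dot-- (x ∘ suc) (v ∘ suc) b (w ∘ suc)))
      (solve 6 (λ x v b w s t → x :* (v :- b :* w) :+ (s :- b :* t) := (x :* v :+ s) :- b :* (x :* w :+ t)) K.refl _ _ _ _ _ _)

    0-dot : ∀ {k} (v : Vector K.Carrier k) → dot 0ᵥ v K.≈ K.0#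
    0-dot {zero} v = K.refl
    0-dot {suc k} v = K.trans (K.+-cong (K.zeroˡ _) (0-dot (v ∘ suc))) (K.+-identityˡ _)

    dot-0 : ∀ {k} (x : Vector K.Carrier k) {v} → (∀ i → v i K.≈ K.0#) → dot x v K.≈ K.0#
    dot-0 {zero} x v≈0 = K.refl
    dot-0 {suc k} x v≈0 = K.trans (K.+-cong (K.trans (K.*-congˡ (v≈0 zero)) (K.zeroʳ _)) (dot-0 (x ∘ suc) (v≈0 ∘ suc))) (K.+-identityˡ _)

    dot-remove : ∀ {k} (x v : Vector K.Carrier (suc k)) i → dot x v K.≈ x i K.* v i K.+ dot (removeAt x i) (removeAt v i)
    dot-remove x v i = Sum.sum-remove K.+-commutativeMonoid (λ j → x j K.* v j)

    dot-insert : ∀ {k} (x : Vector K.Carrier k) i b v → dot (insertAt x i b) v K.≈ b K.* v i K.+ dot x (removeAt v i)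
    dot-insert x i b v = K.trans (dot-remove (insertAt x i b) v i) (K.+-cong
      (K.*-congʳ (K.reflexive (insertAt-lookup x i b)))
      (dot-cong (λ j → K.reflexive (insertAt-punchIn x i b j)) (λ _ → K.refl)))

  isZero? : ∀ {k} (v : Vector K.Carrier k) → Dec (v ≈ᵥ 0ᵥ)
  isZero? v = v ≟ᵥ 0ᵥ

  effectiveLength : ∀ {k} → List (Vector K.Carrier k) → ℕ
  effectiveLength g = ∑ g (λ v → indicator (¬? (isZero? v)))

  weight : ∀ {k} → List (Vector K.Carrier k) → Vector K.Carrier k → ℕ
  weight g x = ∑ g (λ v → indicator (¬? (dot x v K.≟ K.0#)))

  Hits : ∀ {k} → Vector K.Carrier k → Vector K.Carrier k → K.Carrier → Set ℓ
  Hits w v a = a K.≉ K.0# × (λ i → a K.* w i) ≈ᵥ v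

  hits? : ∀ {k} (w v : Vector K.Carrier k) a → Dec (Hits w v a)
  hits? w v a = ¬? (a K.≟ K.0#) ×-dec ((λ i → a K.* w i) ≟ᵥ v)

  hits : ∀ {k} → Vector K.Carrier k → Vector K.Carrier k → ℕ
  hits w v = ∑F (λ a → indicator (hits? w v a))

  -- For v ≠ 0 this is the number of columns proportional to v.
  multiplicity : ∀ {k} → List (Vector K.Carrier k) → Vector K.Carrier k → ℕ
  multiplicity g v = ∑ g (λ w → hits w v)

  hits-cong : ∀ {k} (w : Vector K.Carrier k) {v v′} → v ≈ᵥ v′ → hits w v ≡ hits w v′
  hits-cong w v≈v′ = ℕ∑.∑-cong elements (λ a → indicator-cong (hits? w _ a) (hits? w _ a)
    (λ (a≉0 , aw≈v) → a≉0 , ≈ᵥ-trans aw≈v v≈v′) (λ (a≉0 , aw≈v) → a≉0 , ≈ᵥ-trans aw≈v (≈ᵥ-sym v≈v′)))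

  multiplicity-cong : ∀ {k} (g : List (Vector K.Carrier k)) {v v′} → v ≈ᵥ v′ → multiplicity g v ≡ multiplicity g v′
  multiplicity-cong g v≈v′ = ℕ∑.∑-cong g (λ w → hits-cong w v≈v′)

  MinimumDistance : ∀ {k} → ℕ → List (Vector K.Carrier k) → Set (c ⊔ ℓ)
  MinimumDistance d g = ∀ x → ¬ x ≈ᵥ 0ᵥ → d ≤ weight g x

  module _ {a b} (M : CommutativeMonoid a b) where
    open CommutativeMonoid M
    open CommutativeMonoidMult M using () renaming (_×_ to _·_; ×-homo-+ to ·-homo-+)
    module ∑M = ListSum M
    module FM = FieldSum M

    private
      ∑-· : ∀ {d} {B : Set d} (xs : List B) (n : B → ℕ) x → ∑ xs n · x ≈ ∑M.∑ xs (λ y → n y · x)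
      ∑-· [] n x = refl
      ∑-· (y ∷ xs) n x = trans (·-homo-+ x (n y) _) (∙-congˡ (∑-· xs n x))

    multiplicity-sum : ∀ {k} (g : List (Vector K.Carrier k)) {h : Vector K.Carrier k → Carrier} → FM.Congruent h →
      FM.∑V k (λ v → multiplicity g v · h v) ≈
      ∑M.∑ g (λ w → FM.∑F (λ a → indicator (¬? (a K.≟ K.0#)) · h (λ i → a K.* w i)))
    multiplicity-sum {k} g {h} h-cong = trans
      (∑M.∑-cong (vecs k) (λ v → trans (∑-· g (λ w → hits w v) (h v)) (∑M.∑-cong g (λ w → ∑-· elements _ (h v)))))
      (trans (∑M.∑-swap (vecs k) g _) (∑M.∑-cong g (λ w → trans (∑M.∑-swap (vecs k) elements _) (∑M.∑-cong elements (λ a → trans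
        (FM.∑V-single {h = λ v → indicator (hits? w v a) · h v} (cong w a) (λ i → a K.* w i) (off w a))
        (reflexive (≡.cong (_· h (λ i → a K.* w i)) (indicator-cong (hits? w _ a) (¬? (a K.≟ K.0#)) proj₁ (λ a≉0 → a≉0 , λ _ → K.refl)))))))))
      where
      cong : ∀ w a → FM.Congruent (λ v → indicator (hits? w v a) · h v)
      cong w a {v} {v′} v≈v′ = trans
        (reflexive (≡.cong (_· h v) (indicator-cong (hits? w v a) (hits? w v′ a)
          (λ (a≉0 , aw≈v) → a≉0 , ≈ᵥ-trans aw≈v v≈v′) (λ (a≉0 , aw≈v) → a≉0 , ≈ᵥ-trans aw≈v (≈ᵥ-sym v≈v′)))))
        (·-congʳ (indicator (hits? w v′ a)) (h-cong v≈v′))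
        where open CommutativeMonoidMult M using () renaming (×-congʳ to ·-congʳ)
      off : ∀ w a v → ¬ v ≈ᵥ (λ i → a K.* w i) → indicator (hits? w v a) · h v ≈ ε
      off w a v v≉ = reflexive (≡.cong (_· h v) (indicator-no (hits? w v a) (λ (_ , aw≈v) → v≉ (≈ᵥ-sym aw≈v))))

  ≥⇒⌈/⌉≤ : ∀ d n .{{_ : NonZero n}} m → d ≤ m ℕ.* n → ⌈ d / n ⌉ ≤ m
  ≥⇒⌈/⌉≤ d (suc n) m d≤ = ℕ.≤-pred (m<n*o⇒m/o<n {d ℕ.+ n} {suc m} {suc n} (begin-strict
    d ℕ.+ n            <⟨ ℕ.+-mono-≤-< d≤ (ℕ.n<1+n n) ⟩
    m ℕ.* suc n ℕ.+ suc n   ≡⟨ ℕ.+-comm (m ℕ.* suc n) (suc n) ⟩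
    suc m ℕ.* suc n ∎))
    where open ℕ.≤-Reasoning

  ⌈/⌉≤⇒≥ : ∀ d n .{{_ : NonZero n}} m → ⌈ d / n ⌉ ≤ m → d ≤ m ℕ.* n
  ⌈/⌉≤⇒≥ d (suc n) m ≤m = ℕ.+-cancelʳ-≤ n d (m ℕ.* suc n) (begin
    d ℕ.+ n                                                  ≡⟨ m≡m%n+[m/n]*n (d ℕ.+ n) (suc n) ⟩
    (d ℕ.+ n) % suc n ℕ.+ (d ℕ.+ n) / suc n ℕ.* suc n        ≤⟨ ℕ.+-mono-≤ (ℕ.≤-pred (m%n<n (d ℕ.+ n) (suc n))) (ℕ.*-monoˡ-≤ (suc n) ≤m) ⟩
    n ℕ.+ m ℕ.* suc n                                        ≡⟨ ℕ.+-comm n _ ⟩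
    m ℕ.* suc n ℕ.+ n ∎)
    where open ℕ.≤-Reasoning

  q^≢0 : ∀ k → NonZero (q ℕ.^ k)
  q^≢0 k = ℕ.m^n≢0 q k

  units-count : ∑F (λ a → indicator (¬? (a K.≟ K.0#))) ≡ q′
  units-count = ℕ.+-cancelʳ-≡ 1 _ q′ (≡.trans
    (≡.trans (≡.cong (∑F (λ a → indicator (¬? (a K.≟ K.0#))) ℕ.+_) (≡.sym zeros)) (≡.sym (ℕ∑.∑-∙ elements _ _)))
    (≡.trans (ℕ∑.∑-cong elements (λ a → indicator-¬ (a K.≟ K.0#)))
      (≡.trans (∑F-const 1) (≡.trans (ℕ.*-identityʳ q) (≡.trans q≡1+q′ (ℕ.+-comm 1 q′))))))
    where
    zeros : ∑F (λ a → indicator (a K.≟ K.0#)) ≡ 1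
    zeros = ≡.trans (ℕF.∑F-single (λ a≈b → indicator-cong (_ K.≟ K.0#) (_ K.≟ K.0#) (K.trans (K.sym a≈b)) (K.trans a≈b)) K.0#
      (λ b → indicator-no (b K.≟ K.0#))) (indicator-yes (K.0# K.≟ K.0#) K.refl)

  ≟-indicator-sum : ∀ {k} (v₀ : Vector K.Carrier k) → ∑V k (λ v → indicator (v ≟ᵥ v₀)) ≡ 1
  ≟-indicator-sum v₀ = ≡.trans (ℕF.∑V-single
    (λ {v} {w} v≈w → indicator-cong (v ≟ᵥ v₀) (w ≟ᵥ v₀) (≈ᵥ-trans (≈ᵥ-sym v≈w)) (≈ᵥ-trans v≈w)) v₀
    (λ v → indicator-no (v ≟ᵥ v₀))) (indicator-yes (v₀ ≟ᵥ v₀) (λ _ → K.refl))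

  nonzeros : ℕ → ℕ
  nonzeros k = ∑V k (λ v → indicator (¬? (isZero? v)))

  nonzeros+1 : ∀ k → nonzeros k ℕ.+ 1 ≡ q ℕ.^ k
  nonzeros+1 k = ≡.trans
    (≡.trans (≡.cong (nonzeros k ℕ.+_) (≡.sym (≟-indicator-sum {k} 0ᵥ))) (≡.sym (ℕ∑.∑-∙ (vecs k) _ _)))
    (≡.trans (ℕ∑.∑-cong (vecs k) (λ v → indicator-¬ (isZero? v))) (≡.trans (∑V-const k 1) (ℕ.*-identityʳ _)))

  module _ {k} (v : Vector K.Carrier (suc k)) (v≉0 : ¬ v ≈ᵥ 0ᵥ) where
    private
      N : K.Carrier → ℕ
      N a = ∑V (suc k) (λ x → indicator (dot x v K.≟ a))

      dot-surjective : ∀ a → ∃ λ w → dot w v K.≈ a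
      dot-surjective a =
        let i , vi≉0 = pivot v≉0
            r , vir≈1 = K.inverse (v i) vi≉0
        in insertAt 0ᵥ i (a K.* r) , K.trans (dot-insert 0ᵥ i (a K.* r) v) (K.trans (K.+-cong
             (K.trans (K.*-assoc a r (v i)) (K.trans (K.*-congˡ (K.trans (K.*-comm r (v i)) vir≈1)) (K.*-identityʳ a)))
             (0-dot (removeAt v i))) (K.+-identityʳ a))

      N-constant : ∀ a → N a ≡ N K.0#
      N-constant a = ≡.trans
        (ℕF.∑V-translate (λ {x} {y} x≈y → indicator-cong (dot x v K.≟ a) (dot y v K.≟ a)
          (K.trans (K.sym (dot-cong {v = v} x≈y (λ _ → K.refl)))) (K.trans (dot-cong {v = v} x≈y (λ _ → K.refl)))) w)
        (ℕ∑.∑-cong (vecs (suc k)) (λ x → indicator-cong (dot (λ i → x i K.+ w i) v K.≟ a) (dot x v K.≟ K.0#)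
          (λ eq → +-identityˡ-unique (dot x v) a (K.trans (K.+-congˡ (K.sym w·v≈a)) (K.trans (K.sym (dot-+ x w v)) eq)))
          (λ eq → K.trans (dot-+ x w v) (K.trans (K.+-cong eq w·v≈a) (K.+-identityˡ a)))))
        where
        open import Algebra.Properties.Ring K.ring using (+-identityˡ-unique)
        w = proj₁ (dot-surjective a)
        w·v≈a = proj₂ (dot-surjective a)

    hyperplane-count : ∑V (suc k) (λ x → indicator (dot x v K.≟ K.0#)) ≡ q ℕ.^ k
    hyperplane-count = ℕ.*-cancelˡ-≡ (N K.0#) (q ℕ.^ k) q (begin
      q ℕ.* N K.0#                                                      ≡⟨ ∑F-const (N K.0#) ⟨
      ∑F (λ _ → N K.0#)                                                 ≡⟨ ℕ∑.∑-cong elements N-constant ⟨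
      ∑F N                                                              ≡⟨ ℕ∑.∑-swap elements (vecs (suc k)) _ ⟩
      ∑V (suc k) (λ x → ∑F (λ a → indicator (dot x v K.≟ a)))           ≡⟨ ℕ∑.∑-cong (vecs (suc k)) (λ x → ≡.trans
          (ℕF.∑F-single (λ {a} {b} a≈b → indicator-cong (dot x v K.≟ a) (dot x v K.≟ b) (λ eq → K.trans eq a≈b) (λ eq → K.trans eq (K.sym a≈b)))
            (dot x v) (λ b b≉ → indicator-no (dot x v K.≟ b) (λ eq → b≉ (K.sym eq))))
          (indicator-yes (dot x v K.≟ dot x v) K.refl)) ⟩
      ∑V (suc k) (λ _ → 1)                                              ≡⟨ ∑V-const (suc k) 1 ⟩
      q ℕ.* q ℕ.^ k ℕ.* 1                                               ≡⟨ ℕ.*-identityʳ _ ⟩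
      q ℕ.* q ℕ.^ k ∎)
      where open ≡.≡-Reasoning

    nonvanishing-count : ∑V (suc k) (λ x → indicator (¬? (dot x v K.≟ K.0#))) ≡ q′ ℕ.* q ℕ.^ k
    nonvanishing-count = ℕ.+-cancelʳ-≡ (q ℕ.^ k) _ _ (begin
      W ℕ.+ q ℕ.^ k                 ≡⟨ ≡.cong (W ℕ.+_) hyperplane-count ⟨
      W ℕ.+ N K.0#                  ≡⟨ ℕ∑.∑-∙ (vecs (suc k)) _ _ ⟨
      ∑V (suc k) (λ x → indicator (¬? (dot x v K.≟ K.0#)) ℕ.+ indicator (dot x v K.≟ K.0#))
                                    ≡⟨ ℕ∑.∑-cong (vecs (suc k)) (λ x → indicator-¬ (dot x v K.≟ K.0#)) ⟩
      ∑V (suc k) (λ _ → 1)          ≡⟨ ≡.trans (∑V-const (suc k) 1) (ℕ.*-identityʳ _) ⟩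
      q ℕ.* q ℕ.^ k                 ≡⟨ ≡.cong (ℕ._* q ℕ.^ k) q≡1+q′ ⟩
      q ℕ.^ k ℕ.+ q′ ℕ.* q ℕ.^ k    ≡⟨ ℕ.+-comm (q ℕ.^ k) _ ⟩
      q′ ℕ.* q ℕ.^ k ℕ.+ q ℕ.^ k ∎)
      where
      open ≡.≡-Reasoning
      W = ∑V (suc k) (λ x → indicator (¬? (dot x v K.≟ K.0#)))

  weight-sum : ∀ {k} (g : List (Vector K.Carrier (suc k))) → ∑V (suc k) (weight g) ≡ effectiveLength g ℕ.* (q′ ℕ.* q ℕ.^ k)
  weight-sum {k} g = ≡.trans (ℕ∑.∑-swap (vecs (suc k)) g _) (≡.trans (ℕ∑.∑-cong g column) (∑-*ʳ g _ (q′ ℕ.* q ℕ.^ k)))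
    where
    column : ∀ v → ∑V (suc k) (λ x → indicator (¬? (dot x v K.≟ K.0#))) ≡ indicator (¬? (isZero? v)) ℕ.* (q′ ℕ.* q ℕ.^ k)
    column v with isZero? v
    ... | no v≉0 = ≡.trans (nonvanishing-count v v≉0) (≡.sym (ℕ.+-identityʳ _))
    ... | yes v≈0 = ≡.trans (ℕ∑.∑-cong (vecs (suc k)) (λ x → indicator-no (¬? (dot x v K.≟ K.0#)) (λ ≉0 → ≉0 (dot-0 x v≈0)))) (ℕ∑.∑-ε (vecs (suc k)))

  multiplicity-total : ∀ {k} (g : List (Vector K.Carrier k)) →
    ∑V k (λ v → multiplicity g v ℕ.* indicator (¬? (isZero? v))) ≡ effectiveLength g ℕ.* q′
  multiplicity-total {k} g = begin
    ∑V k (λ v → multiplicity g v ℕ.* h v)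
      ≡⟨ ℕ∑.∑-cong (vecs k) (λ v → ·≡* (multiplicity g v) (h v)) ⟨
    ∑V k (λ v → multiplicity g v · h v)
      ≡⟨ multiplicity-sum ℕ.+-0-commutativeMonoid g (λ {v} {w} v≈w → indicator-cong (¬? (isZero? v)) (¬? (isZero? w))
           (λ ≉0 w≈0 → ≉0 (≈ᵥ-trans v≈w w≈0)) (λ ≉0 v≈0 → ≉0 (≈ᵥ-trans (≈ᵥ-sym v≈w) v≈0))) ⟩
    ∑ g (λ w → ∑F (λ a → indicator (¬? (a K.≟ K.0#)) · h (λ i → a K.* w i)))
      ≡⟨ ℕ∑.∑-cong g (λ w → ≡.trans (ℕ∑.∑-cong elements (λ a → ≡.trans (·≡* (indicator (¬? (a K.≟ K.0#))) _) (scaled w a)))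
           (∑-*ʳ elements _ (h w))) ⟩
    ∑ g (λ w → ∑F (λ a → indicator (¬? (a K.≟ K.0#))) ℕ.* h w)
      ≡⟨ ℕ∑.∑-cong g (λ w → ≡.trans (≡.cong (ℕ._* h w) units-count) (ℕ.*-comm q′ (h w))) ⟩
    ∑ g (λ w → h w ℕ.* q′)
      ≡⟨ ∑-*ʳ g h q′ ⟩
    effectiveLength g ℕ.* q′ ∎
    where
    open ≡.≡-Reasoning
    open CommutativeMonoidMult ℕ.+-0-commutativeMonoid using () renaming (_×_ to _·_)
    h : Vector K.Carrier k → ℕ
    h v = indicator (¬? (isZero? v))
    scaled : ∀ w a → indicator (¬? (a K.≟ K.0#)) ℕ.* h (λ i → a K.* w i) ≡ indicator (¬? (a K.≟ K.0#)) ℕ.* h w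
    scaled w a with a K.≟ K.0#
    ... | yes _ = ≡.refl
    ... | no a≉0 = ≡.cong (1 ℕ.*_) (indicator-cong (¬? (isZero? (λ i → a K.* w i))) (¬? (isZero? w))
      (λ ≉0 w≈0 → ≉0 (λ i → K.trans (K.*-congˡ (w≈0 i)) (K.zeroʳ a)))
      (λ ≉0 aw≈0 → ≉0 (λ i → *-cancelˡ (w i) K.0# a≉0 (K.trans (aw≈0 i) (K.sym (K.zeroʳ a))))))

  nonzeros≥1 : ∀ k → 1 ≤ nonzeros (suc k)
  nonzeros≥1 k = ℕ.+-cancelʳ-≤ 1 1 _ (ℕ.≤-trans 2≤q (ℕ.≤-trans (ℕ.m≤m*n q (q ℕ.^ k) {{q^≢0 k}}) (ℕ.≤-reflexive (≡.sym (nonzeros+1 (suc k))))))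

  nonzeros*d≤weight-sum : ∀ {k d} (g : List (Vector K.Carrier k)) → MinimumDistance d g → nonzeros k ℕ.* d ≤ ∑V k (weight g)
  nonzeros*d≤weight-sum {k} {d} g minimum = ℕ.≤-trans (ℕ.≤-reflexive (≡.sym (∑-*ʳ (vecs k) _ d))) (∑-mono (vecs k) bound)
    where
    bound : ∀ x → indicator (¬? (isZero? x)) ℕ.* d ≤ weight g x
    bound x with isZero? x
    ... | yes _ = z≤n
    ... | no x≉0 = ℕ.≤-trans (ℕ.≤-reflexive (ℕ.+-identityʳ d)) (minimum x x≉0)

  heavy-point : ∀ {k d} (g : List (Vector K.Carrier (suc k))) → MinimumDistance d g →
    ∃ λ v → ¬ v ≈ᵥ 0ᵥ × d ≤ multiplicity g v ℕ.* q ℕ.^ k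
  heavy-point {k} {d} g minimum with searchV (suc k) {P = λ v → ¬ v ≈ᵥ 0ᵥ × d ≤ multiplicity g v ℕ.* q ℕ.^ k}
    (λ v≈w (v≉0 , d≤) → (λ w≈0 → v≉0 (≈ᵥ-trans v≈w w≈0)) , ≡.subst (λ m → d ≤ m ℕ.* q ℕ.^ k) (multiplicity-cong g v≈w) d≤)
    (λ v → ¬? (isZero? v) ×-dec (d ℕ.≤? multiplicity g v ℕ.* q ℕ.^ k))
  ... | inj₁ found = found
  ... | inj₂ none = contradiction (nonzeros≥1 k) (ℕ.<⇒≱ (s≤s (ℕ.+-cancelˡ-≤ (L ℕ.* q′ ℕ.* q ℕ.^ k) (nonzeros (suc k)) 0 (begin
    L ℕ.* q′ ℕ.* q ℕ.^ k ℕ.+ nonzeros (suc k)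
      ≡⟨ ≡.cong (λ n → n ℕ.* q ℕ.^ k ℕ.+ nonzeros (suc k)) (multiplicity-total g) ⟨
    ∑V (suc k) (λ v → multiplicity g v ℕ.* ι v) ℕ.* q ℕ.^ k ℕ.+ nonzeros (suc k)
      ≡⟨ ≡.cong (ℕ._+ nonzeros (suc k)) (∑-*ʳ (vecs (suc k)) _ (q ℕ.^ k)) ⟨
    ∑V (suc k) (λ v → multiplicity g v ℕ.* ι v ℕ.* q ℕ.^ k) ℕ.+ nonzeros (suc k)
      ≡⟨ ℕ∑.∑-∙ (vecs (suc k)) _ _ ⟨
    ∑V (suc k) (λ v → multiplicity g v ℕ.* ι v ℕ.* q ℕ.^ k ℕ.+ ι v)
      ≤⟨ ∑-mono (vecs (suc k)) light ⟩
    ∑V (suc k) (λ v → ι v ℕ.* d)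
      ≡⟨ ∑-*ʳ (vecs (suc k)) ι d ⟩
    nonzeros (suc k) ℕ.* d
      ≤⟨ nonzeros*d≤weight-sum g minimum ⟩
    ∑V (suc k) (weight g)
      ≡⟨ weight-sum g ⟩
    L ℕ.* (q′ ℕ.* q ℕ.^ k)
      ≡⟨ ℕ.*-assoc L q′ _ ⟨
    L ℕ.* q′ ℕ.* q ℕ.^ k
      ≡⟨ ℕ.+-identityʳ _ ⟨
    L ℕ.* q′ ℕ.* q ℕ.^ k ℕ.+ 0 ∎))))
    where
    open ℕ.≤-Reasoning
    L = effectiveLength g
    ι : Vector K.Carrier (suc k) → ℕ
    ι v = indicator (¬? (isZero? v))
    light : ∀ v → multiplicity g v ℕ.* ι v ℕ.* q ℕ.^ k ℕ.+ ι v ≤ ι v ℕ.* d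
    light v with isZero? v
    ... | yes _ = ℕ.≤-reflexive (≡.trans (ℕ.+-identityʳ _) (≡.cong (ℕ._* q ℕ.^ k) (ℕ.*-zeroʳ (multiplicity g v))))
    ... | no v≉0 = begin
      multiplicity g v ℕ.* 1 ℕ.* q ℕ.^ k ℕ.+ 1   ≡⟨ ≡.cong (λ m → m ℕ.* q ℕ.^ k ℕ.+ 1) (ℕ.*-identityʳ (multiplicity g v)) ⟩
      multiplicity g v ℕ.* q ℕ.^ k ℕ.+ 1         ≡⟨ ℕ.+-comm _ 1 ⟩
      suc (multiplicity g v ℕ.* q ℕ.^ k)         ≤⟨ ℕ.≰⇒> (λ d≤ → none v (v≉0 , d≤)) ⟩
      d                                          ≡⟨ ℕ.+-identityʳ d ⟨
      1 ℕ.* d ∎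

  split-at : ∀ {k r} {P : Pred (Fin (suc k)) r} i₀ → P i₀ → (∀ j → P (punchIn i₀ j)) → ∀ i → P i
  split-at {P = P} i₀ P₀ P′ i with i₀ Fin.≟ i
  ... | yes ≡.refl = P₀
  ... | no i₀≢i = ≡.subst P (Fin.punchIn-punchOut i₀≢i) (P′ (punchOut i₀≢i))

  module ProjectionCounting {k} (P : Vector K.Carrier (suc k)) (i₀ : Fin (suc k)) (r : K.Carrier) (Pr≈1 : P i₀ K.* r K.≈ K.1#) where
    open Projection P i₀ r
    open RingSolver K.commutativeRing
    open SetoidReasoning K.setoid

    P′ : Vector K.Carrier k
    P′ = removeAt P i₀

    P≉0 : ¬ P ≈ᵥ 0ᵥ
    P≉0 P≈0 = 1≉0 (K.trans (K.sym Pr≈1) (K.trans (K.*-congʳ (P≈0 i₀)) (K.zeroˡ r)))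

    unproject : Vector K.Carrier k → Vector K.Carrier (suc k)
    unproject x = insertAt x i₀ (K.- (r K.* dot x P′))

    dot-project : ∀ x v → dot x (project v) K.≈ dot (unproject x) v
    dot-project x v = begin
      dot x (project v)                                       ≈⟨ dot-- x (removeAt v i₀) (coefficient v) P′ ⟩
      dot x (removeAt v i₀) K.- v i₀ K.* r K.* dot x P′       ≈⟨ solve 4 (λ s b r t → s :- b :* r :* t := (:- (r :* t)) :* b :+ s) K.refl _ (v i₀) r _ ⟩
      K.- (r K.* dot x P′) K.* v i₀ K.+ dot x (removeAt v i₀) ≈⟨ dot-insert x i₀ _ v ⟨
      dot (unproject x) v ∎

    unproject-nonzero : ∀ x → ¬ x ≈ᵥ 0ᵥ → ¬ unproject x ≈ᵥ 0ᵥ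
    unproject-nonzero x x≉0 ≈0 = x≉0 λ j → K.trans (K.reflexive (≡.sym (insertAt-punchIn x i₀ _ j))) (≈0 (punchIn i₀ j))

    weight-project : ∀ g x → weight (List.map project g) x ≡ weight g (unproject x)
    weight-project g x = ≡.trans (ℕ∑.∑-map project g _) (ℕ∑.∑-cong g (λ v →
      indicator-cong (¬? (dot x (project v) K.≟ K.0#)) (¬? (dot (unproject x) v K.≟ K.0#))
        (λ ≉0 eq → ≉0 (K.trans (dot-project x v) eq)) (λ ≉0 eq → ≉0 (K.trans (K.sym (dot-project x v)) eq))))

    minimum-project : ∀ {d} g → MinimumDistance d g → MinimumDistance d (List.map project g)
    minimum-project {d} g minimum x x≉0 = ≡.subst (d ≤_) (≡.sym (weight-project g x)) (minimum (unproject x) (unproject-nonzero x x≉0))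

    project-≈0 : ∀ v → project v ≈ᵥ 0ᵥ → v ≈ᵥ (λ i → coefficient v K.* P i)
    project-≈0 v ≈0 = split-at i₀
      (K.sym (K.trans (K.*-assoc _ _ _) (K.trans (K.*-congˡ (K.trans (K.*-comm r _) Pr≈1)) (K.*-identityʳ _))))
      (λ j → x∙y⁻¹≈ε⇒x≈y _ _ (≈0 j))
      where open import Algebra.Properties.Ring K.ring using (x∙y⁻¹≈ε⇒x≈y)

    project-cong-0 : ∀ v → v ≈ᵥ 0ᵥ → project v ≈ᵥ 0ᵥ
    project-cong-0 v v≈0 j = K.trans
      (K.+-cong (v≈0 (punchIn i₀ j)) (K.-‿cong (K.*-congʳ (K.*-congʳ (v≈0 i₀)))))
      (solve 2 (λ r t → con (+ 0) :- con (+ 0) :* r :* t := con (+ 0)) K.refl r _)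

    hits-P⇒project≈0 : ∀ {v a} → Hits v P a → project v ≈ᵥ 0ᵥ
    hits-P⇒project≈0 {v} {a} (a≉0 , av≈P) j = *-cancelˡ _ _ a≉0 (begin
      a K.* (v (punchIn i₀ j) K.- v i₀ K.* r K.* P (punchIn i₀ j))
        ≈⟨ solve 5 (λ a v b r t → a :* (v :- b :* r :* t) := a :* v :- (a :* b) :* r :* t) K.refl a _ (v i₀) r _ ⟩
      a K.* v (punchIn i₀ j) K.- a K.* v i₀ K.* r K.* P (punchIn i₀ j)
        ≈⟨ K.+-cong (av≈P _) (K.-‿cong (K.*-congʳ (K.trans (K.*-congʳ (av≈P i₀)) Pr≈1))) ⟩
      P (punchIn i₀ j) K.- K.1# K.* P (punchIn i₀ j)
        ≈⟨ solve 2 (λ t a → t :- con (+ 1) :* t := a :* con (+ 0)) K.refl _ a ⟩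
      a K.* K.0# ∎)

    hits-none : ∀ {m} (w v : Vector K.Carrier m) → (∀ a → ¬ Hits w v a) → hits w v ≡ 0
    hits-none w v none = ≡.trans (ℕ∑.∑-cong elements (λ a → indicator-no (hits? w v a) (none a))) (ℕ∑.∑-ε elements)

    nonzero-project : ∀ v → indicator (¬? (isZero? v)) ≡ indicator (¬? (isZero? (project v))) ℕ.+ hits v P
    nonzero-project v with isZero? (project v)
    ... | no πv≉0 = ≡.trans
      (indicator-yes (¬? (isZero? v)) (λ v≈0 → πv≉0 (project-cong-0 v v≈0)))
      (≡.cong suc (≡.sym (hits-none v P (λ a hit → πv≉0 (hits-P⇒project≈0 hit)))))
    ... | yes πv≈0 with isZero? v
    ...   | yes v≈0 = ≡.sym (hits-none v P λ a (_ , av≈P) → P≉0 λ i →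
      K.trans (K.sym (av≈P i)) (K.trans (K.*-congˡ (v≈0 i)) (K.zeroʳ a)))
    ...   | no v≉0 = ≡.sym (≡.trans
      (ℕF.∑F-single (λ {a} {b} a≈b → indicator-cong (hits? v P a) (hits? v P b)
          (λ (a≉0 , av≈P) → (λ b≈0 → a≉0 (K.trans a≈b b≈0)) , λ i → K.trans (K.*-congʳ (K.sym a≈b)) (av≈P i))
          (λ (b≉0 , bv≈P) → (λ a≈0 → b≉0 (K.trans (K.sym a≈b) a≈0)) , λ i → K.trans (K.*-congʳ a≈b) (bv≈P i)))
        μ⁻¹ (λ b b≉ → indicator-no (hits? v P b) (λ hit → b≉ (unique hit))))
      (indicator-yes (hits? v P μ⁻¹) (μ⁻¹≉0 , μ⁻¹v≈P)))
      where
      μ = coefficient v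
      μ≉0 : μ K.≉ K.0#
      μ≉0 μ≈0 = v≉0 λ i → K.trans (project-≈0 v πv≈0 i) (K.trans (K.*-congʳ μ≈0) (K.zeroˡ (P i)))
      μ⁻¹ = proj₁ (K.inverse μ μ≉0)
      μμ⁻¹≈1 : μ K.* μ⁻¹ K.≈ K.1#
      μμ⁻¹≈1 = proj₂ (K.inverse μ μ≉0)
      μ⁻¹≉0 : μ⁻¹ K.≉ K.0#
      μ⁻¹≉0 ≈0 = 1≉0 (K.trans (K.sym μμ⁻¹≈1) (K.trans (K.*-congˡ ≈0) (K.zeroʳ μ)))
      μ⁻¹v≈P : (λ i → μ⁻¹ K.* v i) ≈ᵥ P
      μ⁻¹v≈P i = begin
        μ⁻¹ K.* v i              ≈⟨ K.*-congˡ (project-≈0 v πv≈0 i) ⟩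
        μ⁻¹ K.* (μ K.* P i)      ≈⟨ solve 3 (λ a b t → a :* (b :* t) := b :* a :* t) K.refl μ⁻¹ μ (P i) ⟩
        μ K.* μ⁻¹ K.* P i        ≈⟨ K.*-congʳ μμ⁻¹≈1 ⟩
        K.1# K.* P i             ≈⟨ K.*-identityˡ _ ⟩
        P i ∎
      unique : ∀ {b} → Hits v P b → b K.≈ μ⁻¹
      unique {b} (_ , bv≈P) = *-cancelˡ b μ⁻¹ μ≉0 (begin
        v i₀ K.* r K.* b         ≈⟨ solve 3 (λ v r b → v :* r :* b := b :* v :* r) K.refl (v i₀) r b ⟩
        b K.* v i₀ K.* r         ≈⟨ K.*-congʳ (bv≈P i₀) ⟩
        P i₀ K.* r               ≈⟨ Pr≈1 ⟩
        K.1#                     ≈⟨ μμ⁻¹≈1 ⟨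
        μ K.* μ⁻¹ ∎)

    length-project : ∀ g → effectiveLength g ≡ effectiveLength (List.map project g) ℕ.+ multiplicity g P
    length-project g = ≡.trans (ℕ∑.∑-cong g nonzero-project) (≡.trans (ℕ∑.∑-∙ g _ _)
      (≡.cong (ℕ._+ multiplicity g P) (≡.sym (ℕ∑.∑-map project g _))))

    line : Vector K.Carrier k → K.Carrier → Vector K.Carrier (suc k)
    line w b i = insertAt w i₀ K.0# i K.+ b K.* P i

    line-cong : ∀ w {b b′} → b K.≈ b′ → line w b ≈ᵥ line w b′
    line-cong w b≈b′ i = K.+-congˡ (K.*-congʳ b≈b′)

    project-line : ∀ w b → project (line w b) ≈ᵥ w
    project-line w b j = begin
      insertAt w i₀ K.0# (punchIn i₀ j) K.+ b K.* t K.- (insertAt w i₀ K.0# i₀ K.+ b K.* P i₀) K.* r K.* t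
        ≈⟨ K.+-cong (K.+-congʳ (K.reflexive (insertAt-punchIn w i₀ K.0# j)))
             (K.-‿cong (K.*-congʳ (K.*-congʳ (K.+-congʳ (K.reflexive (insertAt-lookup w i₀ K.0#)))))) ⟩
      w j K.+ b K.* t K.- (K.0# K.+ b K.* P i₀) K.* r K.* t
        ≈⟨ solve 5 (λ w b t P r → w :+ b :* t :- (con (+ 0) :+ b :* P) :* r :* t := w :+ b :* t :- b :* (P :* r) :* t) K.refl (w j) b t (P i₀) r ⟩
      w j K.+ b K.* t K.- b K.* (P i₀ K.* r) K.* t
        ≈⟨ K.+-congˡ (K.-‿cong (K.*-congʳ (K.*-congˡ Pr≈1))) ⟩
      w j K.+ b K.* t K.- b K.* K.1# K.* t
        ≈⟨ solve 3 (λ w b t → w :+ b :* t :- b :* con (+ 1) :* t := w) K.refl (w j) b t ⟩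
      w j ∎
      where t = P (punchIn i₀ j)

    hits-line : ∀ u w → hits (project u) w ≤ ∑F (λ b → hits u (line w b))
    hits-line u w = ℕ.≤-trans (∑-mono elements pointwise) (ℕ.≤-reflexive (ℕ∑.∑-swap elements elements _))
      where
      pointwise : ∀ a → indicator (hits? (project u) w a) ≤ ∑F (λ b → indicator (hits? u (line w b) a))
      pointwise a with hits? (project u) w a
      ... | no _ = z≤n
      ... | yes (a≉0 , aπu≈w) = ℕ.≤-trans
        (ℕ.≤-reflexive (≡.sym (indicator-yes (hits? u (line w b₀) a) (a≉0 , onLine))))
        (∑F-≥ (λ {b} {b′} b≈b′ → indicator-cong (hits? u (line w b) a) (hits? u (line w b′) a)
          (λ (a≉0 , eq) → a≉0 , ≈ᵥ-trans eq (line-cong w b≈b′))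
          (λ (a≉0 , eq) → a≉0 , ≈ᵥ-trans eq (≈ᵥ-sym (line-cong w b≈b′)))) b₀)
        where
        b₀ = a K.* (u i₀ K.* r)
        onLine : (λ i → a K.* u i) ≈ᵥ line w b₀
        onLine = split-at i₀
          (begin
            a K.* u i₀
              ≈⟨ solve 2 (λ a u → a :* u := con (+ 0) :+ a :* u :* con (+ 1)) K.refl a (u i₀) ⟩
            K.0# K.+ a K.* u i₀ K.* K.1#
              ≈⟨ K.+-cong (K.reflexive (≡.sym (insertAt-lookup w i₀ K.0#))) (K.*-congˡ (K.sym Pr≈1)) ⟩
            insertAt w i₀ K.0# i₀ K.+ a K.* u i₀ K.* (P i₀ K.* r)
              ≈⟨ K.+-congˡ (solve 4 (λ a u t r → a :* u :* (t :* r) := a :* (u :* r) :* t) K.refl a (u i₀) (P i₀) r) ⟩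
            line w b₀ i₀ ∎)
          (λ j → begin
            a K.* u (punchIn i₀ j)
              ≈⟨ solve 5 (λ a u b r t → a :* u := a :* (u :- b :* r :* t) :+ a :* (b :* r) :* t) K.refl a _ (u i₀) r (P (punchIn i₀ j)) ⟩
            a K.* project u j K.+ b₀ K.* P (punchIn i₀ j)
              ≈⟨ K.+-congʳ (K.trans (aπu≈w j) (K.reflexive (≡.sym (insertAt-punchIn w i₀ K.0# j)))) ⟩
            line w b₀ (punchIn i₀ j) ∎)

    multiplicity-line : ∀ g w → multiplicity (List.map project g) w ≤ ∑F (λ b → multiplicity g (line w b))
    multiplicity-line g w = ℕ.≤-trans (ℕ.≤-reflexive (ℕ∑.∑-map project g _))
      (ℕ.≤-trans (∑-mono g (λ u → hits-line u w)) (ℕ.≤-reflexive (ℕ∑.∑-swap g elements _)))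

  pivotInverse : ∀ {k} {v : Vector K.Carrier k} → ¬ v ≈ᵥ 0ᵥ → ∃₂ λ i r → v i K.* r K.≈ K.1#
  pivotInverse v≉0 = let i , vi≉0 = pivot v≉0 ; r , eq = K.inverse _ vi≉0 in i , r , eq

  griesmer-bound : ∀ {k d} (g : List (Vector K.Carrier k)) → MinimumDistance d g → griesmer q k d ≤ effectiveLength g
  griesmer-bound {zero} g _ = z≤n
  griesmer-bound {suc k} {d} g minimum =
    let v , v≉0 , d≤ = heavy-point g minimum
        i , r , vr≈1 = pivotInverse v≉0
        open ProjectionCounting v i r vr≈1
    in ℕ.≤-trans (ℕ.+-mono-≤ (griesmer-bound (List.map (Projection.project v i r) g) (minimum-project g minimum)) (≥⇒⌈/⌉≤ d (q ℕ.^ k) {{q^≢0 k}} (multiplicity g v) d≤))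
         (ℕ.≤-reflexive (≡.sym (length-project g)))

  module GriesmerCode {k d} (g : List (Vector K.Carrier (suc k))) (minimum : MinimumDistance d g)
                      (griesmer≡ : effectiveLength g ≡ griesmer q (suc k) d) where
    t : ℕ
    t = ⌈ d / q ℕ.^ k ⌉

    multiplicity≤t : ∀ v → ¬ v ≈ᵥ 0ᵥ → multiplicity g v ≤ t
    multiplicity≤t v v≉0 =
      let i , r , vr≈1 = pivotInverse v≉0
          open ProjectionCounting v i r vr≈1
      in ℕ.+-cancelˡ-≤ (griesmer q k d) _ t (ℕ.≤-trans
           (ℕ.+-monoˡ-≤ (multiplicity g v) (griesmer-bound (List.map (Projection.project v i r) g) (minimum-project g minimum)))
           (ℕ.≤-reflexive (≡.trans (≡.sym (length-project g)) griesmer≡)))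

    Maximal : Vector K.Carrier (suc k) → Set ℓ
    Maximal v = ¬ v ≈ᵥ 0ᵥ × multiplicity g v ≡ t

    maximal-point : ∃ Maximal
    maximal-point =
      let v , v≉0 , d≤ = heavy-point g minimum
      in v , v≉0 , ℕ.≤-antisym (multiplicity≤t v v≉0) (≥⇒⌈/⌉≤ d (q ℕ.^ k) {{q^≢0 k}} (multiplicity g v) d≤)

    weighted≤ : ∀ v → multiplicity g v ℕ.* indicator (¬? (isZero? v)) ≤ indicator (¬? (isZero? v)) ℕ.* t
    weighted≤ v with isZero? v
    ... | yes _ = ℕ.≤-reflexive (ℕ.*-zeroʳ (multiplicity g v))
    ... | no v≉0 = ℕ.≤-trans (ℕ.≤-reflexive (ℕ.*-identityʳ _)) (ℕ.≤-trans (multiplicity≤t v v≉0) (ℕ.≤-reflexive (≡.sym (ℕ.+-identityʳ t))))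

    length*q′≤ : effectiveLength g ℕ.* q′ ≤ nonzeros (suc k) ℕ.* t
    length*q′≤ = ℕ.≤-trans (ℕ.≤-reflexive (≡.sym (multiplicity-total g)))
      (ℕ.≤-trans (∑-mono (vecs (suc k)) weighted≤) (ℕ.≤-reflexive (∑-*ʳ (vecs (suc k)) _ t)))

    project-griesmer : ∀ v → multiplicity g v ≡ t → ∀ i r → (vr≈1 : v i K.* r K.≈ K.1#) →
      effectiveLength (List.map (Projection.project v i r) g) ≡ griesmer q k d
    project-griesmer v max i r vr≈1 = ℕ.+-cancelʳ-≡ t _ (griesmer q k d) (≡.trans
      (≡.cong (effectiveLength (List.map (Projection.project v i r) g) ℕ.+_) (≡.sym max))
      (≡.trans (≡.sym (ProjectionCounting.length-project v i r vr≈1 g)) griesmer≡))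

    module Sharp (d≡ : d ≡ t ℕ.* q ℕ.^ k) where

      all-maximal : ∀ v → ¬ v ≈ᵥ 0ᵥ → multiplicity g v ≡ t
      all-maximal v₀ v₀≉0 = ℕ.≤-antisym (multiplicity≤t v₀ v₀≉0) (ℕ.≮⇒≥ λ <t → ℕ.<⇒≱
        (ℕ.*-monoˡ-< (q ℕ.^ k) {{q^≢0 k}} (begin-strict
          effectiveLength g ℕ.* q′
            <⟨ ℕ.n<1+n _ ⟩
          suc (effectiveLength g ℕ.* q′)
            ≡⟨ ℕ.+-comm 1 _ ⟩
          effectiveLength g ℕ.* q′ ℕ.+ 1
            ≡⟨ ≡.cong₂ ℕ._+_ (multiplicity-total g) (≟-indicator-sum v₀) ⟨
          ∑V (suc k) (λ v → multiplicity g v ℕ.* indicator (¬? (isZero? v))) ℕ.+ ∑V (suc k) (λ v → indicator (v ≟ᵥ v₀))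
            ≡⟨ ℕ∑.∑-∙ (vecs (suc k)) _ _ ⟨
          ∑V (suc k) (λ v → multiplicity g v ℕ.* indicator (¬? (isZero? v)) ℕ.+ indicator (v ≟ᵥ v₀))
            ≤⟨ ∑-mono (vecs (suc k)) (gap <t) ⟩
          ∑V (suc k) (λ v → indicator (¬? (isZero? v)) ℕ.* t)
            ≡⟨ ∑-*ʳ (vecs (suc k)) _ t ⟩
          nonzeros (suc k) ℕ.* t ∎))
        (begin
          nonzeros (suc k) ℕ.* t ℕ.* q ℕ.^ k      ≡⟨ ℕ.*-assoc (nonzeros (suc k)) t _ ⟩
          nonzeros (suc k) ℕ.* (t ℕ.* q ℕ.^ k)    ≡⟨ ≡.cong (nonzeros (suc k) ℕ.*_) d≡ ⟨
          nonzeros (suc k) ℕ.* d                  ≤⟨ nonzeros*d≤weight-sum g minimum ⟩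
          ∑V (suc k) (weight g)                   ≡⟨ weight-sum g ⟩
          effectiveLength g ℕ.* (q′ ℕ.* q ℕ.^ k)  ≡⟨ ℕ.*-assoc (effectiveLength g) q′ _ ⟨
          effectiveLength g ℕ.* q′ ℕ.* q ℕ.^ k ∎))
        where
        open ℕ.≤-Reasoning
        gap : multiplicity g v₀ < t → ∀ v → multiplicity g v ℕ.* indicator (¬? (isZero? v)) ℕ.+ indicator (v ≟ᵥ v₀) ≤ indicator (¬? (isZero? v)) ℕ.* t
        gap <t v with v ≟ᵥ v₀
        ... | no _ = ℕ.≤-trans (ℕ.≤-reflexive (ℕ.+-identityʳ _)) (weighted≤ v)
        ... | yes v≈v₀ with isZero? v
        ...   | yes v≈0 = contradiction (≈ᵥ-trans (≈ᵥ-sym v≈v₀) v≈0) v₀≉0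
        ...   | no _ = begin
          multiplicity g v ℕ.* 1 ℕ.+ 1   ≡⟨ ≡.cong (ℕ._+ 1) (ℕ.*-identityʳ _) ⟩
          multiplicity g v ℕ.+ 1         ≡⟨ ℕ.+-comm _ 1 ⟩
          suc (multiplicity g v)         ≡⟨ ≡.cong suc (multiplicity-cong g v≈v₀) ⟩
          suc (multiplicity g v₀)        ≤⟨ <t ⟩
          t                              ≡⟨ ℕ.+-identityʳ t ⟨
          1 ℕ.* t ∎

      constant-weight : ∀ x → ¬ x ≈ᵥ 0ᵥ → weight g x ≡ d
      constant-weight x₀ x₀≉0 = ℕ.≤-antisym (ℕ.≮⇒≥ λ d< → ℕ.<⇒≱ (begin-strict
          nonzeros (suc k) ℕ.* d
            <⟨ ℕ.n<1+n _ ⟩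
          suc (nonzeros (suc k) ℕ.* d)
            ≡⟨ ℕ.+-comm 1 _ ⟩
          nonzeros (suc k) ℕ.* d ℕ.+ 1
            ≡⟨ ≡.cong₂ ℕ._+_ (∑-*ʳ (vecs (suc k)) _ d) (≟-indicator-sum x₀) ⟨
          ∑V (suc k) (λ x → indicator (¬? (isZero? x)) ℕ.* d) ℕ.+ ∑V (suc k) (λ x → indicator (x ≟ᵥ x₀))
            ≡⟨ ℕ∑.∑-∙ (vecs (suc k)) _ _ ⟨
          ∑V (suc k) (λ x → indicator (¬? (isZero? x)) ℕ.* d ℕ.+ indicator (x ≟ᵥ x₀))
            ≤⟨ ∑-mono (vecs (suc k)) (gap d<) ⟩
          ∑V (suc k) (weight g) ∎)
        (begin
          ∑V (suc k) (weight g)                   ≡⟨ weight-sum g ⟩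
          effectiveLength g ℕ.* (q′ ℕ.* q ℕ.^ k)  ≡⟨ ℕ.*-assoc (effectiveLength g) q′ _ ⟨
          effectiveLength g ℕ.* q′ ℕ.* q ℕ.^ k    ≤⟨ ℕ.*-monoˡ-≤ (q ℕ.^ k) length*q′≤ ⟩
          nonzeros (suc k) ℕ.* t ℕ.* q ℕ.^ k      ≡⟨ ℕ.*-assoc (nonzeros (suc k)) t _ ⟩
          nonzeros (suc k) ℕ.* (t ℕ.* q ℕ.^ k)    ≡⟨ ≡.cong (nonzeros (suc k) ℕ.*_) d≡ ⟨
          nonzeros (suc k) ℕ.* d ∎)) (minimum x₀ x₀≉0)
        where
        open ℕ.≤-Reasoning
        weight-cong : ∀ {x y} → x ≈ᵥ y → weight g x ≡ weight g y
        weight-cong {x} {y} x≈y = ℕ∑.∑-cong g (λ v → indicator-cong (¬? (dot x v K.≟ K.0#)) (¬? (dot y v K.≟ K.0#))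
          (λ ≉0 eq → ≉0 (K.trans (dot-cong {v = v} x≈y (λ _ → K.refl)) eq))
          (λ ≉0 eq → ≉0 (K.trans (K.sym (dot-cong {v = v} x≈y (λ _ → K.refl))) eq)))
        gap : d < weight g x₀ → ∀ x → indicator (¬? (isZero? x)) ℕ.* d ℕ.+ indicator (x ≟ᵥ x₀) ≤ weight g x
        gap d< x with x ≟ᵥ x₀ | isZero? x
        ... | yes x≈x₀ | yes x≈0 = contradiction (≈ᵥ-trans (≈ᵥ-sym x≈x₀) x≈0) x₀≉0
        ... | no _ | yes _ = z≤n
        ... | no _ | no x≉0 = ℕ.≤-trans (ℕ.≤-reflexive (≡.trans (ℕ.+-identityʳ _) (ℕ.+-identityʳ d))) (minimum x x≉0)
        ... | yes x≈x₀ | no _ = begin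
          1 ℕ.* d ℕ.+ 1     ≡⟨ ≡.cong (ℕ._+ 1) (ℕ.+-identityʳ d) ⟩
          d ℕ.+ 1           ≡⟨ ℕ.+-comm d 1 ⟩
          suc d             ≤⟨ d< ⟩
          weight g x₀       ≡⟨ weight-cong x≈x₀ ⟨
          weight g x ∎

  -- Weights as values of power sums

  module PowerResidues (A : LiftRing) (s : ℕ) where
    open LiftRing A
    open LiftRingProperties A
    open Evaluation A
    open Powers A
    open Exp semiring using (_^_)
    open RingSolver commutativeRing

    0^ : ∀ n → .{{NonZero n}} → 0# ^ n ≈ 0#
    0^ (suc n) = zeroˡ _

    1^ : ∀ n → 1# ^ n ≈ 1#
    1^ zero = refl
    1^ (suc n) = trans (*-identityˡ _) (1^ n)

    M-nonZero : NonZero (M s)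
    M-nonZero = ℕ.m*n≢0 q′ (p ℕ.^ s) {{q′-nonZero}} {{ℕ.m^n≢0 p s}}

    ^M-zero : ∀ {x} → J 1 x → x ^ M s ≡ 0# [ suc s ]
    ^M-zero Jx = Q.trans (suc s) (≡-^M s (≡-^ 1 q′ (J⇒≡0 1 Jx))) (≈⇒≡ (suc s) (0^ (M s) {{M-nonZero}}))

    ⟨⟩^q′ : ∀ a → a K.≉ K.0# → ⟨ a ⟩ ^ q′ ≡ 1# [ 1 ]
    ⟨⟩^q′ a a≉0 = Q.trans 1 (Q.sym 1 (⟨⟩-^ a q′)) (Q.trans 1 (⟨⟩-cong a^q′≈1) ⟨⟩-1)
      where
      a^q′≈1 : a ^K q′ K.≈ K.1#
      a^q′≈1 = *-cancelˡ _ _ a≉0 (K.trans (≡.subst (λ n → a ^K n K.≈ a) q≡1+q′ (^q a)) (K.sym (K.*-identityʳ a)))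

    ^M-one : ∀ {x a} → x ≡ ⟨ a ⟩ [ 1 ] → a K.≉ K.0# → x ^ M s ≡ 1# [ suc s ]
    ^M-one x≡a a≉0 = Q.trans (suc s)
      (≡-^M s (Q.trans 1 (≡-^ 1 q′ x≡a) (Q.trans 1 (⟨⟩^q′ _ a≉0) (≈⇒≡ 1 (sym (1^ q′))))))
      (≈⇒≡ (suc s) (1^ (M s)))

    ^M-scale : ∀ {k} (X : Vector Carrier k) a v → a K.≉ K.0# → (X ⊙ (λ i → a K.* v i)) ^ M s ≡ (X ⊙ v) ^ M s [ suc s ]
    ^M-scale X a v a≉0 = ≡-^M s (Q.trans 1 (≡-^ 1 q′ (⊙-scale X a v))
      (Q.trans 1 (≈⇒≡ 1 (^-distrib-* ⟨ a ⟩ (X ⊙ v) q′)) (Q.trans 1 (Q.*-congʳ 1 (⟨⟩^q′ a a≉0)) (Q.*-identityˡ 1 _))))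
      where open import Algebra.Properties.CommutativeSemiring.Exp commutativeSemiring using (^-distrib-*)

    q′-cancellable : Cancellable (q′ · 1#)
    q′-cancellable = unit-cancellable {y = - 1#} (J-cong 1
      (solve 1 (λ n → :- (con (+ 1) :+ n) := n :* (:- con (+ 1)) :- con (+ 1)) refl (q′ · 1#))
      (J-neg 1 (≡.subst (λ n → J 1 (n · 1#)) q≡1+q′ q∈J)))

    ⊙-⟨⟩ : ∀ {k} (x v : Vector K.Carrier k) → (λ i → ⟨ x i ⟩) ⊙ v ≡ ⟨ dot x v ⟩ [ 1 ]
    ⊙-⟨⟩ {zero} x v = Q.sym 1 (J⇒≡0 1 ⟨0⟩)
    ⊙-⟨⟩ {suc k} x v = Q.trans 1 (Q.+-cong 1 (Q.sym 1 (⟨⟩-* (x zero) (v zero))) (⊙-⟨⟩ (x ∘ suc) (v ∘ suc))) (Q.sym 1 (⟨⟩-+ _ _))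

    powerSum-weight : ∀ {k} (g : List (Vector K.Carrier k)) x → powerSum (M s) g (λ i → ⟨ x i ⟩) ≡ weight g x · 1# [ suc s ]
    powerSum-weight [] x = Q.refl (suc s)
    powerSum-weight (v ∷ g) x with dot x v K.≟ K.0#
    ... | yes ≈0 = Q.trans (suc s)
      (Q.+-cong (suc s) (^M-zero (J-≡ 1 (⊙-⟨⟩ x v) (J-≡ 1 (⟨⟩-cong ≈0) ⟨0⟩))) (powerSum-weight g x)) (Q.+-identityˡ (suc s) _)
    ... | no ≉0 = Q.+-cong (suc s) (^M-one (⊙-⟨⟩ x v) ≉0) (powerSum-weight g x)

  module ProjectiveSpace (s : ℕ) (g : List (Vector K.Carrier (suc (suc s)))) (t : ℕ)
                         (constant : ∀ v → ¬ v ≈ᵥ 0ᵥ → multiplicity g v ≡ t) (A : LiftRing) (X : Vector (LiftRing.Carrier A) (suc (suc s))) where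
    open LiftRing A
    open LiftRingProperties A
    open Evaluation A
    open Powers A
    open PowerResidues A s
    open Exp semiring using (_^_)
    private
      e = suc s
      module QM = CommutativeMonoidMult (Q.+-commutativeMonoid e)
      module Q∑ = ListSum (Q.+-commutativeMonoid e)
      module QF = FieldSum (Q.+-commutativeMonoid e)
      open SetoidReasoning (Q.setoid e)

      h : Vector K.Carrier (suc (suc s)) → Carrier
      h v = (X ⊙ v) ^ M s

      h-cong : ∀ {v w} → v ≈ᵥ w → h v ≡ h w [ e ]
      h-cong v≈w = ≡-^M s (≡-^ 1 q′ (⊙-≡ X v≈w))

      ·-as-* : ∀ n y → n QM.× y ≡ (n · 1#) * y [ e ]
      ·-as-* zero y = ≈⇒≡ e (sym (zeroˡ y))
      ·-as-* (suc n) y = Q.trans e (Q.+-congˡ e (·-as-* n y)) (≈⇒≡ e (trans (+-congʳ (sym (*-identityˡ y))) (sym (distribʳ y 1# (n · 1#)))))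

      ∑-*ˡ : ∀ {d} {B : Set d} (xs : List B) u (g : B → Carrier) → Q∑.∑ xs (λ a → u * g a) ≡ u * Q∑.∑ xs g [ e ]
      ∑-*ˡ [] u g = ≈⇒≡ e (sym (zeroʳ u))
      ∑-*ˡ (x ∷ xs) u g = Q.trans e (Q.+-congˡ e (∑-*ˡ xs u g)) (≈⇒≡ e (sym (distribˡ u _ _)))

      ∑-indicator : ∀ (xs : List K.Carrier) y → Q∑.∑ xs (λ a → indicator (¬? (a K.≟ K.0#)) QM.× y) ≡ (ℕ∑.∑ xs (λ a → indicator (¬? (a K.≟ K.0#))) · 1#) * y [ e ]
      ∑-indicator [] y = ≈⇒≡ e (sym (zeroˡ y))
      ∑-indicator (x ∷ xs) y = Q.trans e (Q.+-cong e (·-as-* (indicator (¬? (x K.≟ K.0#))) y) (∑-indicator xs y))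
        (≈⇒≡ e (trans (sym (distribʳ y _ _)) (*-congʳ (sym (CommutativeMonoidMult.×-homo-+ +-commutativeMonoid 1# (indicator (¬? (x K.≟ K.0#))) _)))))

      weighted : ∀ v → multiplicity g v QM.× h v ≡ (t · 1#) * h v [ e ]
      weighted v with isZero? v
      ... | no v≉0 = Q.trans e (·-as-* (multiplicity g v) (h v)) (Q.reflexive e (≡.cong (λ n → (n · 1#) * h v) (constant v v≉0)))
      ... | yes v≈0 = Q.trans e (·-as-* (multiplicity g v) (h v)) (Q.trans e (to-0 (multiplicity g v · 1#)) (Q.sym e (to-0 (t · 1#))))
        where
        to-0 : ∀ u → u * h v ≡ 0# [ e ]
        to-0 u = Q.trans e (Q.*-congˡ e (^M-zero (⊙-zero X v≈0))) (≈⇒≡ e (zeroʳ u))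

      columns : ∀ w a → indicator (¬? (a K.≟ K.0#)) QM.× h (λ i → a K.* w i) ≡ indicator (¬? (a K.≟ K.0#)) QM.× h w [ e ]
      columns w a with a K.≟ K.0#
      ... | yes _ = Q.refl e
      ... | no a≉0 = Q.+-congʳ e (^M-scale X a w a≉0)

    vanishes : J e (powerSum (M s) g X)
    vanishes = q′-cancellable e _ (J-≡ e (begin
      (q′ · 1#) * powerSum (M s) g X
        ≈⟨ ∑-*ˡ g (q′ · 1#) h ⟨
      Q∑.∑ g (λ w → (q′ · 1#) * h w)
        ≈⟨ Q∑.∑-cong g (λ w → Q.reflexive e (≡.cong (λ n → (n · 1#) * h w) units-count)) ⟨
      Q∑.∑ g (λ w → (ℕ∑.∑ elements (λ a → indicator (¬? (a K.≟ K.0#))) · 1#) * h w)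
        ≈⟨ Q∑.∑-cong g (λ w → Q.trans e (Q∑.∑-cong elements (columns w)) (∑-indicator elements (h w))) ⟨
      Q∑.∑ g (λ w → QF.∑F (λ a → indicator (¬? (a K.≟ K.0#)) QM.× h (λ i → a K.* w i)))
        ≈⟨ multiplicity-sum (Q.+-commutativeMonoid e) g {h} h-cong ⟨
      QF.∑V (suc (suc s)) (λ v → multiplicity g v QM.× h v)
        ≈⟨ Q∑.∑-cong (vecs (suc (suc s))) weighted ⟩
      QF.∑V (suc (suc s)) (λ v → (t · 1#) * h v)
        ≈⟨ ∑-*ˡ (vecs (suc (suc s))) (t · 1#) h ⟩
      (t · 1#) * QF.∑V (suc (suc s)) h ∎)
      (J-*ˡ e (t · 1#) (all-vectors-vanish e s ℕ.≤-refl A X)))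

  sharp-distance : ∀ k {d} → q ℕ.^ k ∣ d → d ≡ ⌈ d / q ℕ.^ k ⌉ ℕ.* q ℕ.^ k
  sharp-distance k {d} (divides m d≡) = ℕ.≤-antisym
    (⌈/⌉≤⇒≥ d (q ℕ.^ k) {{q^≢0 k}} _ ℕ.≤-refl)
    (ℕ.≤-trans (ℕ.*-monoˡ-≤ (q ℕ.^ k) (≥⇒⌈/⌉≤ d (q ℕ.^ k) {{q^≢0 k}} m (ℕ.≤-reflexive d≡))) (ℕ.≤-reflexive (≡.sym d≡)))

  -- If every further point of the line had multiplicity below t, these q points would carry at most q (t - 1) < ⌈ d / q ^ k ⌉ columns.
  maximal-lift : ∀ {k d} (g : List (Vector K.Carrier (suc (suc k)))) (minimum : MinimumDistance d g)
    (griesmer≡ : effectiveLength g ≡ griesmer q (suc (suc k)) d) → let open GriesmerCode g minimum griesmer≡ in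
    ∀ P i₀ r (Pr≈1 : P i₀ K.* r K.≈ K.1#) w → ¬ w ≈ᵥ 0ᵥ →
    ⌈ d / q ℕ.^ k ⌉ ≤ multiplicity (List.map (Projection.project P i₀ r) g) w →
    ∃ λ b → Maximal (ProjectionCounting.line P i₀ r Pr≈1 w b)
  maximal-lift {k} {d} g minimum griesmer≡ P i₀ r Pr≈1 w w≉0 t′≤ = result
    where
    open GriesmerCode g minimum griesmer≡
    open ProjectionCounting P i₀ r Pr≈1
    line≉0 : ∀ b → ¬ line w b ≈ᵥ 0ᵥ
    line≉0 b ≈0 = w≉0 (≈ᵥ-trans (≈ᵥ-sym (project-line w b)) (project-cong-0 (line w b) ≈0))

    too-light : ∀ t → (∀ b → multiplicity g (line w b) < t) → d ≤ (t ℕ.∸ 1) ℕ.* q ℕ.^ suc k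
    too-light zero light = contradiction (light K.0#) λ ()
    too-light (suc t) light = begin
      d                                                       ≤⟨ ⌈/⌉≤⇒≥ d (q ℕ.^ k) {{q^≢0 k}} _ t′≤ ⟩
      multiplicity (List.map (Projection.project P i₀ r) g) w ℕ.* q ℕ.^ k
                                                              ≤⟨ ℕ.*-monoˡ-≤ (q ℕ.^ k) (multiplicity-line g w) ⟩
      ∑F (λ b → multiplicity g (line w b)) ℕ.* q ℕ.^ k        ≤⟨ ℕ.*-monoˡ-≤ (q ℕ.^ k) (∑-mono elements (λ b → ℕ.≤-pred (light b))) ⟩
      ∑F (λ _ → t) ℕ.* q ℕ.^ k                                ≡⟨ ≡.cong (ℕ._* q ℕ.^ k) (≡.trans (∑F-const t) (ℕ.*-comm q t)) ⟩
      t ℕ.* q ℕ.* q ℕ.^ k                                     ≡⟨ ℕ.*-assoc t q _ ⟩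
      t ℕ.* (q ℕ.* q ℕ.^ k) ∎
      where open ℕ.≤-Reasoning

    result : ∃ λ b → Maximal (line w b)
    result with searchF {P = λ b → t ≤ multiplicity g (line w b)}
      (λ b≈b′ t≤ → ≡.subst (t ≤_) (multiplicity-cong g (line-cong w b≈b′)) t≤)
      (λ b → t ℕ.≤? multiplicity g (line w b))
    ... | inj₁ (b , t≤) = b , line≉0 b , ℕ.≤-antisym (multiplicity≤t (line w b) (line≉0 b)) t≤
    ... | inj₂ light = contradiction
      (≥⇒⌈/⌉≤ d (q ℕ.^ suc k) {{q^≢0 (suc k)}} (t ℕ.∸ 1) (too-light t (λ b → ℕ.≰⇒> (light b))))
      (ℕ.<⇒≱ (ℕ.∸-monoʳ-< (s≤s z≤n) (ℕ.≤-trans (s≤s z≤n) (ℕ.≰⇒> (light K.0#)))))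

  minor : ∀ {k} → Vector K.Carrier k → Vector K.Carrier k → Fin k → Fin k → K.Carrier
  minor v w i j = v i K.* w j K.- v j K.* w i

  module _ {k} (P : Vector K.Carrier (suc k)) (i₀ : Fin (suc k)) (r : K.Carrier) (Pr≈1 : P i₀ K.* r K.≈ K.1#) where
    open ProjectionCounting P i₀ r Pr≈1
    open Projection P i₀ r
    open RingSolver K.commutativeRing

    minor-lift : ∀ w w′ b b′ → (∃₂ λ i j → minor w w′ i j K.≉ K.0#) → ∃₂ λ i j → minor (line w b) (line w′ b′) i j K.≉ K.0#
    minor-lift w w′ b b′ (i , j , ≉0)
      with Fin.any? (λ x → Fin.any? (λ y → ¬? (minor (line w b) (line w′ b′) x y K.≟ K.0#)))
    ... | yes found = found
    ... | no ¬∃ = contradiction minor≈0 ≉0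
      where
      u = line w b
      v = line w′ b′
      all≈0 : ∀ x y → minor u v x y K.≈ K.0#
      all≈0 x y with minor u v x y K.≟ K.0#
      ... | yes ≈0 = ≈0
      ... | no ≉0 = contradiction (x , y , ≉0) ¬∃
      I = punchIn i₀ i
      J′ = punchIn i₀ j
      minor≈0 : minor w w′ i j K.≈ K.0#
      minor≈0 = begin
        minor w w′ i j
          ≈⟨ K.+-cong (K.*-cong (project-line w b i) (project-line w′ b′ j)) (K.-‿cong (K.*-cong (project-line w b j) (project-line w′ b′ i))) ⟨
        minor (project u) (project v) i j
          ≈⟨ solve 9 (λ ui uj u₀ vi vj v₀ r Pi Pj →
               (ui :- u₀ :* r :* Pi) :* (vj :- v₀ :* r :* Pj) :- (uj :- u₀ :* r :* Pj) :* (vi :- v₀ :* r :* Pi) :=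
               (ui :* vj :- uj :* vi) :- r :* Pj :* (ui :* v₀ :- u₀ :* vi) :+ r :* Pi :* (uj :* v₀ :- u₀ :* vj))
               K.refl (u I) (u J′) (u i₀) (v I) (v J′) (v i₀) r (P I) (P J′) ⟩
        minor u v I J′ K.- r K.* P J′ K.* minor u v I i₀ K.+ r K.* P I K.* minor u v J′ i₀
          ≈⟨ K.+-cong (K.+-cong (all≈0 I J′) (K.-‿cong (K.*-congˡ (all≈0 I i₀)))) (K.*-congˡ (all≈0 J′ i₀)) ⟩
        K.0# K.- r K.* P J′ K.* K.0# K.+ r K.* P I K.* K.0#
          ≈⟨ solve 2 (λ a b → con (+ 0) :- a :* con (+ 0) :+ b :* con (+ 0) := con (+ 0)) K.refl _ _ ⟩
        K.0# ∎
        where open SetoidReasoning K.setoid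

  module Divisible (s : ℕ) {d : ℕ} (q^e∣d : q ℕ.^ suc s ∣ d) where

    record Structure {m} (g : List (Vector K.Carrier (suc m))) : Set (lsuc (c ⊔ ℓ)) where
      field
        points   : Points (suc (M s)) (suc m)
        maximal  : ∀ i → multiplicity g (Points.point points i) ≡ ⌈ d / q ℕ.^ m ⌉
        vanishes : Vanishes (suc s) (M s) g

    nonzero⇒≉0 : ∀ {k} {v : Vector K.Carrier k} → (∃ λ i → v i K.≉ K.0#) → ¬ v ≈ᵥ 0ᵥ
    nonzero⇒≉0 (i , ≉0) v≈0 = ≉0 (v≈0 i)

    structure : ∀ r (g : List (Vector K.Carrier (suc (r ℕ.+ suc s)))) → MinimumDistance d g →
      effectiveLength g ≡ griesmer q (suc (r ℕ.+ suc s)) d → Structure g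
    structure zero g minimum griesmer≡ = record
      { points = affinePoints (M<q^ s)
      ; maximal = λ i → all-maximal _ (nonzero⇒≉0 (zero , 1≉0))
      ; vanishes = λ A X → ProjectiveSpace.vanishes s g t all-maximal A X
      }
      where
      open GriesmerCode g minimum griesmer≡
      open Sharp (sharp-distance (suc s) q^e∣d)
    structure (suc r) g minimum griesmer≡ = record
      { points = points
      ; maximal = λ i → proj₂ (proj₂ (lift i))
      ; vanishes = vanishes-everywhere points (suc s) g λ i → vanishes-at (Points.point points i) (proj₂ (lift i))
      }
      where
      open GriesmerCode g minimum griesmer≡

      projected : ∀ v → Maximal v → ∀ i ρ (vρ≈1 : v i K.* ρ K.≈ K.1#) → Structure (List.map (Projection.project v i ρ) g)
      projected v (_ , max) i ρ vρ≈1 = structure r _ (ProjectionCounting.minimum-project v i ρ vρ≈1 g minimum)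
        (project-griesmer v max i ρ vρ≈1)

      P = proj₁ maximal-point
      P-maximal = proj₂ maximal-point
      P-pivot = pivotInverse (proj₁ P-maximal)
      i₀ = proj₁ P-pivot
      ρ₀ = proj₁ (proj₂ P-pivot)
      Pρ≈1 = proj₂ (proj₂ P-pivot)
      open Structure (projected P P-maximal i₀ ρ₀ Pρ≈1) using () renaming (points to lines; maximal to lines-maximal)
      open Points lines using () renaming (point to direction; nonzero to direction-nonzero; distinct to directions-distinct)

      lift : ∀ i → ∃ λ b → Maximal (ProjectionCounting.line P i₀ ρ₀ Pρ≈1 (direction i) b)
      lift i = maximal-lift g minimum griesmer≡ P i₀ ρ₀ Pρ≈1 (direction i) (nonzero⇒≉0 (direction-nonzero i))
        (ℕ.≤-reflexive (≡.sym (lines-maximal i)))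

      points : Points (suc (M s)) (suc (suc (r ℕ.+ suc s)))
      points = record
        { point = λ i → ProjectionCounting.line P i₀ ρ₀ Pρ≈1 (direction i) (proj₁ (lift i))
        ; nonzero = λ i → pivot (proj₁ (proj₂ (lift i)))
        ; distinct = λ i j i≢j → minor-lift P i₀ ρ₀ Pρ≈1 _ _ _ _ (directions-distinct i j i≢j)
        }

      vanishes-at : ∀ v → Maximal v → VanishesAt (suc s) (M s) g v
      vanishes-at v v-maximal A X JXv =
        let i , ρ , vρ≈1 = pivotInverse (proj₁ v-maximal)
        in J-≡ (suc s) (restrict i ρ vρ≈1 g) (Structure.vanishes (projected v v-maximal i ρ vρ≈1) A (removeAt X i))
        where
        open LiftRing A
        open LiftRingProperties A
        open Evaluation A
        open Powers A
        restrict : ∀ i ρ (vρ≈1 : v i K.* ρ K.≈ K.1#) g →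
          powerSum (M s) g X ≡ powerSum (M s) (List.map (Projection.project v i ρ) g) (removeAt X i) [ suc s ]
        restrict i ρ vρ≈1 [] = Q.refl (suc s)
        restrict i ρ vρ≈1 (w ∷ g) = Q.+-cong (suc s)
          (≡-^M s (≡-^ 1 q′ (Q.sym 1 (⊙-project v i ρ vρ≈1 X JXv w)))) (restrict i ρ vρ≈1 g)

    weight-divisible : ∀ r (g : List (Vector K.Carrier (suc (r ℕ.+ suc s)))) → MinimumDistance d g →
      effectiveLength g ≡ griesmer q (suc (r ℕ.+ suc s)) d → ∀ x → p ℕ.^ suc s ∣ weight g x
    weight-divisible r g minimum griesmer≡ x = Jₜ-integer (suc s) (weight g x)
      (J-≡ (suc s) (Q.sym (suc s) (PowerResidues.powerSum-weight termLift s g x))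
        (Structure.vanishes (structure r g minimum griesmer≡) termLift (λ i → ‹ x i ›)))
      where
      open LiftRingProperties termLift

  weight-zero : ∀ {k} (g : List (Vector K.Carrier k)) x → x ≈ᵥ 0ᵥ → weight g x ≡ 0
  weight-zero g x x≈0 = ≡.trans
    (ℕ∑.∑-cong g (λ v → indicator-no (¬? (dot x v K.≟ K.0#)) (λ ≉0 → ≉0 (K.trans (dot-cong {v = v} x≈0 (λ _ → K.refl)) (0-dot v)))))
    (ℕ∑.∑-ε g)

  p^∣q^ : ∀ e → p ℕ.^ e ∣ q ℕ.^ e
  p^∣q^ zero = ∣-refl
  p^∣q^ (suc e) = *-pres-∣ (≡.subst (p ∣_) (≡.sym q≡p*p^f′) (m∣m*n (p ℕ.^ f′))) (p^∣q^ e)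

  griesmer-divisible : ∀ {k d} e (g : List (Vector K.Carrier (suc k))) → MinimumDistance d g →
    effectiveLength g ≡ griesmer q (suc k) d → q ℕ.^ e ∣ d → ∀ x → p ℕ.^ e ∣ weight g x
  griesmer-divisible zero g minimum griesmer≡ q^e∣d x = 1∣ _
  griesmer-divisible {k} {d} (suc s) g minimum griesmer≡ q^e∣d x with suc s ℕ.≤? k
  ... | yes s<k = go (k ℕ.∸ suc s) (≡.sym (ℕ.m∸n+n≡m s<k)) g minimum griesmer≡
    where
    go : ∀ r → k ≡ r ℕ.+ suc s → (g : List (Vector K.Carrier (suc k))) → MinimumDistance d g →
         effectiveLength g ≡ griesmer q (suc k) d → p ℕ.^ suc s ∣ weight g x
    go r ≡.refl g minimum griesmer≡ = Divisible.weight-divisible s q^e∣d r g minimum griesmer≡ x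
  ... | no s≮k with isZero? x
  ...   | yes x≈0 = ≡.subst (p ℕ.^ suc s ∣_) (≡.sym (weight-zero g x x≈0)) (_ ∣0)
  ...   | no x≉0 = ≡.subst (p ℕ.^ suc s ∣_) (≡.sym (constant-weight x x≉0)) (∣-trans (p^∣q^ (suc s)) q^e∣d)
    where
    open GriesmerCode g minimum griesmer≡
    q^k∣q^e : q ℕ.^ k ∣ q ℕ.^ suc s
    q^k∣q^e = ≡.subst (λ n → q ℕ.^ k ∣ q ℕ.^ n) (ℕ.m+[n∸m]≡n (ℕ.<⇒≤ (ℕ.≰⇒> s≮k)))
      (≡.subst (q ℕ.^ k ∣_) (≡.sym (ℕ.^-distribˡ-+-* q k (suc s ℕ.∸ k))) (m∣m*n (q ℕ.^ (suc s ℕ.∸ k))))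
    open Sharp (sharp-distance k (∣-trans q^k∣q^e q^e∣d))

  open Coding F using (lincomb; wt; LinearCode)

  lincomb≈dot : ∀ {k n} (G : Fin k → Vector K.Carrier n) x j → lincomb G x j K.≈ dot x (λ i → G i j)
  lincomb≈dot {zero} G x j = K.refl
  lincomb≈dot {suc k} G x j = K.+-congˡ (lincomb≈dot (G ∘ suc) (x ∘ suc) j)

  weight-tabulate : ∀ {k n} (column : Fin n → Vector K.Carrier k) x (v : Vector K.Carrier n) →
    (∀ j → v j K.≈ dot x (column j)) → weight (List.tabulate column) x ≡ wt v
  weight-tabulate {n = zero} column x v eq = ≡.refl
  weight-tabulate {n = suc n} column x v eq with v zero K.≟ K.0#
  ... | yes v₀≈0 = ≡.cong₂ ℕ._+_
    (indicator-no (¬? (dot x (column zero) K.≟ K.0#)) (λ ≉0 → ≉0 (K.trans (K.sym (eq zero)) v₀≈0)))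
    (weight-tabulate (column ∘ suc) x (v ∘ suc) (eq ∘ suc))
  ... | no v₀≉0 = ≡.cong₂ ℕ._+_
    (indicator-yes (¬? (dot x (column zero) K.≟ K.0#)) (λ ≈0 → v₀≉0 (K.trans (eq zero) ≈0)))
    (weight-tabulate (column ∘ suc) x (v ∘ suc) (eq ∘ suc))

  length-tabulate : ∀ {k n} (column : Fin n → Vector K.Carrier k) → (∀ j → ¬ (∀ i → column j i K.≈ K.0#)) →
    effectiveLength (List.tabulate column) ≡ n
  length-tabulate {n = zero} column nonzero = ≡.refl
  length-tabulate {n = suc n} column nonzero = ≡.cong₂ ℕ._+_
    (indicator-yes (¬? (isZero? (column zero))) (nonzero zero)) (length-tabulate (column ∘ suc) (nonzero ∘ suc))

  code-divisible : ∀ k d e n → (C : LinearCode n (suc k) d) → n ≡ griesmer q (suc k) d → q ℕ.^ e ∣ d →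
    ∀ x → p ℕ.^ e ∣ wt (LinearCode.codeword C x)
  code-divisible k d e n C n≡ q^e∣d x = ≡.subst (p ℕ.^ e ∣_) (weight≡wt x)
    (griesmer-divisible e columns minimum (≡.trans (length-tabulate column column≉0) n≡) q^e∣d x)
    where
    open LinearCode C
    column : Fin n → Vector K.Carrier (suc k)
    column j i = G i j
    columns = List.tabulate column
    weight≡wt : ∀ x → weight columns x ≡ wt (codeword x)
    weight≡wt x = weight-tabulate column x (codeword x) (lincomb≈dot G x)
    minimum : MinimumDistance d columns
    minimum x x≉0 = ≡.subst (d ℕ.≤_) (≡.sym (weight≡wt x)) (minWt x (λ zeroWord → x≉0 (independent x zeroWord)))
    column≉0 : ∀ j → ¬ (∀ i → column j i K.≈ K.0#)
    column≉0 j ≈0 = let x , ≉0 = fullLength j in ≉0 (K.trans (lincomb≈dot G x j) (dot-0 x ≈0))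

open import Data.Nat using (_^_; _≥_)

theorem1p7 : ∀ {c ℓ : Level} (p f q k d e n : ℕ) → Prime p → f ≥ 1 → q ≡ p ^ f →
    k ≥ 1 → d ≥ 1 →
    (F : FiniteField c ℓ q) → (C : Coding.LinearCode F n k d) →
    n ≡ griesmer q k d →
    q ^ e ∣ d →
    ∀ (x : Vector (FiniteField.Carrier F) k) →
    p ^ e ∣ Coding.wt F (Coding.LinearCode.codeword C x)
theorem1p7 p f q (suc k) d e n p-prime f≥1 q≡p^f k≥1 d≥1 F C n≡ q^e∣d x =
  Divisibility.code-divisible F p p-prime f q≡p^f f≥1 k d e n C n≡ q^e∣d x
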